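{- Suppose there exists a data structure that, given the LZ78 representation of a string $T\in\Sigma^{N}$, where $\Sigma=\{1,\ldots,\sigma\}$ and $\sigma=\Omega(N^{1/3})$, answers position-restricted pattern matching queries on $T$ (that, given any pattern $P\in\Sigma^{M}$ and any pair $b,e\in\{0,\ldots,N-M+1\}$, check whether there exists $i$ with $b<i\le e$ satisfying $T[i]T[i+1]\cdots T[i+M-1]=P$) in $O(M^{O(1)}\log^{O(1)}N)$ time, and takes $O(z_{78}(T)\log^{O(1)}N)$ time to construct. Then the Boolean matrix product of any two $n\times n$ Boolean matrices can be computed in $O(n^2\log^{O(1)}n)$ time.
   Context: **Model and asymptotics.** Running times are in the standard word RAM model with machine words of $\Theta(\log n)$ bits ($n$ the input-size parameter), where standard arithmetic and bitwise operations take $O(1)$ time. $\log^{O(1)}N$ means $(\log N)^c$, and $M^{O(1)}$ means $M^{c'}$, for some constants $c,c'$. The condition $\sigma=\Omega(N^{1/3})$ restricts the inputs that must be handled to those with $\sigma\ge\kappa N^{1/3}$ for a fixed constant $\kappa>0$. Strings are indexed from $1$. **LZ78.** The LZ78 factorization of a string $T$ is the factorization $T=f_1f_2\cdots f_k$ such that, with $f_0=\varepsilon$ (the empty string), for every $i\in\{1,\ldots,k\}$, $f_i$ is the longest prefix of the remaining suffix $f_if_{i+1}\cdots f_k$ for which there is $j\in\{0,\ldots,i-1\}$ with $f_i=f_j\cdot c$ for some symbol $c$. The strings $f_1,\ldots,f_k$ are called phrases, and $z_{78}(T)=k$ is their number. The LZ78 representation of $T$ is the sequence of pairs $((p_1,c_1),\ldots,(p_k,c_k))$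 with $p_i\in\{0,\ldots,i-1\}$ and $f_i=f_{p_i}\cdot c_i$ for every $i$. **Boolean matrix product.** For $A,B\in\{0,1\}^{n\times n}$, $(AB)[i,j]=\bigvee_{k=1}^n A[i,k]\wedge B[k,j]$. -}

module Defs where

open import Data.Bool.Base using (Bool; true; false; if_then_else_; _∧_; _∨_; _xor_)
open import Data.Bool.ListAction using (or)
open import Data.Fin.Base using (Fin; toℕ)
open import Data.List.Base using (List; []; _∷_; _++_; _∷ʳ_; concat; concatMap; drop; length; map; take; allFin)
open import Data.List.Relation.Binary.Prefix.Heterogeneous using (Prefix)
open import Data.Nat.Base
open import Data.Nat.Logarithm using (⌊log₂_⌋)
open import Data.Nat.Properties using (m^n≢0)
open import Data.Product.Base using (_×_; _,_; ∃; ∃-syntax; proj₁; proj₂)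
open import Data.Sum.Base using (_⊎_)
open import Data.Vec.Base as Vec using (Vec; lookup; toList)
open import Relation.Binary.PropositionalEquality.Core using (_≡_; _≢_)
open import Relation.Nullary.Negation.Core using (¬_)

-- The number of bits of n.  For n ≥ 2 it lies between log₂ n and 2 log₂ n;
-- unlike log₂ it does not vanish at n = 1, so bounds O(… log^{O(1)} n) can
-- be stated for every n ≥ 1.
lg : ℕ → ℕ
lg n = suc ⌊log₂ n ⌋

------------------------------------------------------------------------
-- Word RAM

-- A word of w bits is a natural number below 2 ^ w; all operations are
-- modulo 2 ^ w.  Division and remainder by 0 give 0.

_mod2^_ : ℕ → ℕ → ℕ
x mod2^ w = _%_ x (2 ^ w) {{m^n≢0 2 w}}

data Op : Set where
  add sub mul quo rem and ior xor shl shr eq lt : Op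

fromBool : Bool → ℕ
fromBool b = if b then 1 else 0

bitwise : (Bool → Bool → Bool) → ℕ → ℕ → ℕ → ℕ
bitwise f zero    x y = 0
bitwise f (suc w) x y =
  fromBool (f (x % 2 ≡ᵇ 1) (y % 2 ≡ᵇ 1)) + 2 * bitwise f w (x / 2) (y / 2)

-- The last two arguments are assumed to be words of w bits.
evalOp : Op → ℕ → ℕ → ℕ → ℕ
evalOp add w x y       = (x + y) mod2^ w
evalOp sub w x y       = (x + 2 ^ w ∸ y) mod2^ w
evalOp mul w x y       = (x * y) mod2^ w
evalOp quo w x zero    = 0
evalOp quo w x (suc y) = x / suc y
evalOp rem w x zero    = 0
evalOp rem w x (suc y) = x % suc y
evalOp and w x y       = bitwise _∧_ w x y
evalOp ior w x y       = bitwise _∨_ w x y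
evalOp xor w x y       = bitwise _xor_ w x y
evalOp shl w x y       = (x * 2 ^ y) mod2^ w
evalOp shr w x y       = _/_ x (2 ^ y) {{m^n≢0 2 y}}
evalOp eq  w x y       = fromBool (x ≡ᵇ y)
evalOp lt  w x y       = fromBool (x <ᵇ y)

-- A machine has finitely many registers (those a program mentions), a
-- random-access memory with one cell per word-sized address, and a
-- read-only random-access input.  Below, r, a and b are register numbers;
-- the comments write a and b for the contents of the registers.
data Instr : Set where
  const : (r k   : ℕ) → Instr             -- r := k
  arith : (o : Op) (r a b : ℕ) → Instr    -- r := a o b
  load  : (r a   : ℕ) → Instr             -- r := memory[a]
  store : (a b   : ℕ) → Instr             -- memory[a] := b
  input : (r a   : ℕ) → Instr             -- r := input[a]

infixr 4 _⨾_

-- Control flow is structured; this simulates jumps, and is simulated by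
-- them, with a constant-factor overhead.
data Program : Set where
  skip          : Program
  instr         : Instr → Program
  _⨾_           : Program → Program → Program
  ifNonzero     : (r : ℕ) → Program → Program → Program
  whileNonzero  : (r : ℕ) → Program → Program

record State : Set where
  constructor ⟨_,_⟩
  field
    reg : ℕ → ℕ
    mem : ℕ → ℕ

open State public

initial : State
initial = ⟨ (λ _ → 0) , (λ _ → 0) ⟩

update : (ℕ → ℕ) → ℕ → ℕ → (ℕ → ℕ)
update f i v j = if j ≡ᵇ i then v else f j

-- Indexed from 0; 0 beyond the end of the list.
nth : List ℕ → ℕ → ℕ
nth []       _       = 0
nth (x ∷ xs) zero    = x
nth (x ∷ xs) (suc i) = nth xs i

exec : (w : ℕ) (inp : List ℕ) → Instr → State → State
exec w inp (const r k)     s = record s { reg = update (reg s) r (k mod2^ w) }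
exec w inp (arith o r a b) s = record s { reg = update (reg s) r (evalOp o w (reg s a) (reg s b)) }
exec w inp (load r a)      s = record s { reg = update (reg s) r (mem s (reg s a)) }
exec w inp (store a b)     s = record s { mem = update (mem s) (reg s a) (reg s b) }
exec w inp (input r a)     s = record s { reg = update (reg s) r (nth inp (reg s a) mod2^ w) }

-- Run w inp p s s′ t: with words of w bits and input inp, the program p
-- started in state s halts in state s′ after t steps.  Each instruction
-- and each evaluation of a branch or loop condition is one step.
data Run (w : ℕ) (inp : List ℕ) : Program → State → State → ℕ → Set where
  skip       : ∀ {s} → Run w inp skip s s 0
  instr      : ∀ {i s} → Run w inp (instr i) s (exec w inp i s) 1
  _⨾_        : ∀ {p q s s′ s″ t u} →
               Run w inp p s s′ t → Run w inp q s′ s″ u →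
               Run w inp (p ⨾ q) s s″ (t + u)
  if-true    : ∀ {r p q s s′ t} → reg s r ≢ 0 → Run w inp p s s′ t →
               Run w inp (ifNonzero r p q) s s′ (suc t)
  if-false   : ∀ {r p q s s′ t} → reg s r ≡ 0 → Run w inp q s s′ t →
               Run w inp (ifNonzero r p q) s s′ (suc t)
  while-true : ∀ {r p s s′ s″ t u} → reg s r ≢ 0 →
               Run w inp p s s′ t → Run w inp (whileNonzero r p) s′ s″ u →
               Run w inp (whileNonzero r p) s s″ (suc (t + u))
  while-done : ∀ {r p s} → reg s r ≡ 0 →
               Run w inp (whileNonzero r p) s s 1

------------------------------------------------------------------------
-- Strings and LZ78

-- c : Fin σ stands for the symbol suc (toℕ c) of the alphabet {1, …, σ}.
symbol : ∀ {σ} → Fin σ → ℕ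
symbol c = suc (toℕ c)

module _ {σ k : ℕ} (fs : Vec (List (Fin σ)) k) where

  -- phrase j is f_j for 0 ≤ j ≤ k, whereas lookup fs i, with i counted
  -- from 0, is f_{i+1}.
  phrase : Fin (suc k) → List (Fin σ)
  phrase = lookup ([] Vec.∷ fs)

  remaining : Fin k → List (Fin σ)
  remaining i = concat (drop (toℕ i) (toList fs))

  record Candidate (i : Fin k) (u : List (Fin σ)) : Set where
    field
      prefix    : Prefix _≡_ u (remaining i)
      extension : ∃[ j ] ∃[ c ] toℕ j ≤ toℕ i × u ≡ phrase j ∷ʳ c

  record IsLZ78Factorization (T : List (Fin σ)) : Set where
    field
      factors   : concat (toList fs) ≡ T
      candidate : ∀ i → Candidate i (lookup fs i)
      longest   : ∀ i u → Candidate i u → length u ≤ length (lookup fs i)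

record LZ78Representation {σ : ℕ} (T : List (Fin σ)) : Set where
  field
    z₇₈           : ℕ
    phrases       : Vec (List (Fin σ)) z₇₈
    factorization : IsLZ78Factorization phrases T
    pairs         : Vec (Fin (suc z₇₈) × Fin σ) z₇₈
    earlier       : ∀ i → toℕ (proj₁ (lookup pairs i)) ≤ toℕ i
    decodes       : ∀ i → lookup phrases i ≡
                      phrase phrases (proj₁ (lookup pairs i)) ∷ʳ proj₂ (lookup pairs i)

  pairWords : List ℕ
  pairWords = concatMap (λ (p , c) → toℕ p ∷ symbol c ∷ []) (toList pairs)

open LZ78Representation public using (z₇₈; pairWords)

------------------------------------------------------------------------
-- Position-restricted pattern matching

-- P = T[i] T[i+1] ⋯ T[i+M-1] for some b < i ≤ e, with T indexed from 1.
OccursIn : ∀ {σ N M} → Vec (Fin σ) N → Vec (Fin σ) M → (b e : ℕ) → Set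
OccursIn {M = M} T P b e =
  ∃[ i ] b < i × i ≤ e × take M (drop (pred i) (toList T)) ≡ toList P

IsTruthValue : Set → ℕ → Set
IsTruthValue A v = (A × v ≡ 1) ⊎ (¬ A × v ≡ 0)

-- N, σ and z₇₈ precede the pairs (p₁, c₁), (p₂, c₂), ….
buildInput : ∀ {σ N} {T : Vec (Fin σ) N} → LZ78Representation (toList T) → List ℕ
buildInput {σ} {N} R = N ∷ σ ∷ z₇₈ R ∷ pairWords R

queryInput : ∀ {σ M} → Vec (Fin σ) M → (b e : ℕ) → List ℕ
queryInput {M = M} P b e = M ∷ b ∷ e ∷ map symbol (toList P)

IsQuery : (N M b e : ℕ) → Set
IsQuery N M b e = NonZero M × b + M ≤ suc N × e + M ≤ suc N

-- The states in which a query may be posed: after construction and any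
-- number of earlier queries.  Registers and memory are kept between the
-- runs, so queries are allowed to modify the data structure; the LZ78
-- representation itself is no longer accessible unless it was copied.
data Ready (build query : Program) (w : ℕ) {σ N} {T : Vec (Fin σ) N}
           (R : LZ78Representation (toList T)) : State → Set where
  built   : ∀ {s t} → Run w (buildInput R) build initial s t →
            Ready build query w R s
  queried : ∀ {s s′ t M b e} {P : Vec (Fin σ) M} → IsQuery N M b e →
            Ready build query w R s → Run w (queryInput P b e) query s s′ t →
            Ready build query w R s′

record PositionRestrictedMatching : Set where
  field
    build query : Program

    -- words have wordFactor * lg N = Θ(log N) bits
    wordFactor : ℕ
    {{wordFactor≢0}} : NonZero wordFactor

    -- κ = κ-num / κ-den.  A real κ > 0 can be replaced by any larger rational.
    κ-num κ-den : ℕ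
    {{κ-num≢0}} : NonZero κ-num
    {{κ-den≢0}} : NonZero κ-den

    -- time bounds: build-C · z₇₈ · lg^build-c N  and
    -- query-C · M^query-a · lg^query-c N
    build-C build-c         : ℕ
    query-C query-a query-c : ℕ

  wordLength : ℕ → ℕ
  wordLength N = wordFactor * lg N

  -- σ ≥ κ N^{1/3}, cubed and without denominators; moreover the symbols
  -- have to be representable by words.
  AdmissibleAlphabet : (N σ : ℕ) → Set
  AdmissibleAlphabet N σ =
    κ-num ^ 3 * N ≤ (κ-den * σ) ^ 3 × σ < 2 ^ wordLength N

  field
    build-correct :
      ∀ {N σ} → NonZero N → AdmissibleAlphabet N σ →
      (T : Vec (Fin σ) N) (R : LZ78Representation (toList T)) →
      ∃[ s ] ∃[ t ]
        Run (wordLength N) (buildInput R) build initial s t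
        × t ≤ build-C * z₇₈ R * lg N ^ build-c

    -- register 0 contains the answer
    query-correct :
      ∀ {N σ} → NonZero N → AdmissibleAlphabet N σ →
      (T : Vec (Fin σ) N) (R : LZ78Representation (toList T)) →
      ∀ {s} → Ready build query (wordLength N) R s →
      ∀ {M} (P : Vec (Fin σ) M) b e → IsQuery N M b e →
      ∃[ s′ ] ∃[ t ]
        Run (wordLength N) (queryInput P b e) query s s′ t
        × t ≤ query-C * M ^ query-a * lg N ^ query-c
        × IsTruthValue (OccursIn T P b e) (reg s′ 0)

------------------------------------------------------------------------
-- Boolean matrices

BoolMatrix : ℕ → Set
BoolMatrix n = Fin n → Fin n → Bool

_⊗_ : ∀ {n} → BoolMatrix n → BoolMatrix n → BoolMatrix n
_⊗_ {n} A B i j = or (map (λ k → A i k ∧ B k j) (allFin n))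

rowMajor : ∀ {n} → BoolMatrix n → List ℕ
rowMajor {n} A = concatMap (λ i → map (λ j → fromBool (A i j)) (allFin n)) (allFin n)

productInput : ∀ {n} → BoolMatrix n → BoolMatrix n → List ℕ
productInput {n} A B = n ∷ rowMajor A ++ rowMajor B

-- The matrix is stored in the first n² memory cells in row-major order.
Stores : ∀ {n} → State → BoolMatrix n → Set
Stores {n} s A = ∀ i j → mem s (toℕ i * n + toℕ j) ≡ fromBool (A i j)

{-# OPTIONS --safe #-}

-- Since the phrases of an LZ78 factorization are determined by the pairs
-- (p , c), any sequence of distinct pairs with p referring backwards is the
-- LZ78 representation of the string it decodes to.  Given A and B, O(n²)
-- pairs spell a string of length Θ(n³): first every row of B, prefix by
-- prefix, where a one in column j becomes the symbol j; then, for every row i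
-- of A, a block of n phrases, the k-th of which repeats row k of B if
-- A i k = 1 (and an all-zero row otherwise) and ends with a fresh symbol.
-- Thus (A ⊗ B) i j holds iff the one-letter pattern j occurs in block i, and
-- n² queries compute the product.  All lengths depend on n only, and extra
-- all-zero rows make the string so long that its length N can serve as the
-- size of the alphabet, which is then at least κ N^{1/3}.  The words of the
-- data structure are shorter than those of the host by a constant factor; its
-- programs are simulated by reducing every result modulo 2 ^ w.
module Submission where

open import Data.Bool.Base using (Bool; true; false; _∧_; _∨_; _xor_; if_then_else_) renaming (T to True)
open import Data.Bool.ListAction using (or)
open import Data.Empty using (⊥-elim)
open import Data.Fin.Base using (Fin; zero; suc; toℕ; fromℕ<)
open import Data.Fin.Patterns using (0F; 1F; 2F; 3F; 4F; 5F; 6F)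
open import Data.Fin.Properties using (toℕ<n; toℕ-injective; toℕ-fromℕ<) renaming (_≟_ to _≟ᶠ_)
open import Data.List.Base using (List; []; _∷_; _++_; _∷ʳ_; concat; drop; take; length; map; applyUpTo; allFin; [_])
import Data.List.Base as List
open import Data.List.Membership.Propositional using (_∈_)
open import Data.List.Membership.Propositional.Properties
  using (∈-map⁺; ∈-map⁻; ∈-++⁺ˡ; ∈-++⁻; ∈-concat⁺′; ∈-concat⁻′; ∈-applyUpTo⁺; ∈-applyUpTo⁻)
open import Data.List.Properties
  using (∷ʳ-injective; ++-assoc; ++-identityʳ; applyUpTo-∷ʳ; concat-++; concat-map; length-++; length-applyUpTo;
         length-map; length-tabulate; map-++; map-applyUpTo; map-tabulate)
open import Data.List.Relation.Binary.Prefix.Heterogeneous using (Prefix; []; _∷_)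
import Data.List.Relation.Binary.Prefix.Heterogeneous.Properties as Prefix
open import Data.List.Relation.Unary.All as ListAll using () renaming ([] to []ₗ; _∷_ to _∷ₗ_)
open import Data.List.Relation.Unary.All.Properties using (concat⁺; applyUpTo⁺₁)
open import Data.List.Relation.Unary.Any using (here; there)
open import Data.Nat.Base
open import Data.Nat.DivMod
  using (_mod_; _%_; _/_; m≡m%n+[m/n]*n; m%n<n; m%n≤m; m/n≤m; m<n⇒m%n≡m; m<n⇒m/n≡0; m*n/n≡m; m<n*o⇒m/o<n;
         [m+kn]%n≡m%n; +-distrib-/-∣ˡ; m∣n⇒o%n%m≡o%m)
open import Data.Nat.Divisibility using (_∣_; divides; n∣m*n)
open import Data.Nat.Logarithm using (⌊log₂_⌋; ⌊log₂⌋-mono-≤; ⌊log₂⌊n/2⌋⌋≡⌊log₂n⌋∸1; ⌊log₂[2^n]⌋≡n)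
open import Data.Nat.Properties
open import Data.Nat.Solver using (module +-*-Solver)
open import Data.Product.Base using (_×_; _,_; ∃-syntax; proj₁; proj₂)
open import Data.Sum.Base as Sum using (_⊎_; inj₁; inj₂)
open import Data.Unit.Base using (tt)
open import Data.Vec.Base as Vec using (Vec; []; _∷_; lookup; toList; fromList; tabulate; _[_]≔_)
open import Data.Vec.Properties using (lookup∘tabulate; lookup∘update; lookup∘update′; lookup-replicate; toList-cast; toList∘fromList)
open import Data.Vec.Relation.Unary.All using (All; []; _∷_)
open import Data.Vec.Relation.Unary.All.Properties using (lookup⁺)
open import Function.Base using (_∘_; id)
open import Relation.Binary.PropositionalEquality hiding ([_])
open import Relation.Nullary using (¬_; yes; no; contradiction)
open import Defs

-- The gap between quadratically many phrases and a text of cubic length makes the reduction work: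
-- construction is charged by phrases, and patterns of length 1 turn the factor M^{O(1)} into a
-- constant. Distinctness of the pairs is bought with private symbols: a marker at the start of each
-- row, because rows with a common prefix would otherwise collide, and the fresh symbol at the end
-- of a block phrase, because the same row is repeated for many rows of `A`. With σ = N the alphabet
-- condition only needs N ≥ κ, where κ is the cube of the given numerator; `2 * r` rows with
-- `r = κ * n` ensure this, and as κ is a constant, log N stays O(log n). The data structure is an
-- arbitrary program, so its runs are reproduced step by step: its input and its memory become
-- segments of the host memory, and a query must find the state that the previous query left behind.
-- Overflow on the host is excluded by bounding every expression by a fixed power of `U`, a small
-- multiple of the modulus.

-- Stated for the unfolded body of update, from which Agda can infer the
-- updated function's values.
update-same : ∀ i {v x : ℕ} → (if i ≡ᵇ i then v else x) ≡ v
update-same zero    = refl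
update-same (suc i) = update-same i

update-other : ∀ {i j} {v x : ℕ} → j ≢ i → (if j ≡ᵇ i then v else x) ≡ x
update-other {zero}  {zero}  j≢i = contradiction refl j≢i
update-other {zero}  {suc j} j≢i = refl
update-other {suc i} {zero}  j≢i = refl
update-other {suc i} {suc j} j≢i = update-other {i} {j} (j≢i ∘ cong suc)

update-cong : ∀ i j {v v′ x x′ : ℕ} → v ≡ v′ → x ≡ x′ →
              (if j ≡ᵇ i then v else x) ≡ (if j ≡ᵇ i then v′ else x′)
update-cong i j v≡v′ x≡x′ = cong₂ (if j ≡ᵇ i then_else_) v≡v′ x≡x′

mod2^-small : ∀ w {x} → x < 2 ^ w → x mod2^ w ≡ x
mod2^-small w x< = m<n⇒m%n≡m {{m^n≢0 2 w}} x<

-- Registers 0 … V - 1 of the host are variables, V … K - 1 are temporaries, and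
-- K + r is register r of the simulated machine.
V K : ℕ
V = 7
K = 16

-- An expression language and its compilation to the word RAM

data BinOp : Set where
  plus times over modulo less : BinOp

toOp : BinOp → Op
toOp plus   = add
toOp times  = mul
toOp over   = quo
toOp modulo = rem
toOp less   = lt

⟦_⟧ : BinOp → ℕ → ℕ → ℕ
⟦ plus   ⟧ x y = x + y
⟦ times  ⟧ x y = x * y
⟦ over   ⟧ x y = evalOp quo 0 x y
⟦ modulo ⟧ x y = evalOp rem 0 x y
⟦ less   ⟧ x y = evalOp lt 0 x y

infixl 6 _⊕_
infixl 7 _⊛_ _⊘_ _⊚_
infix  5 _≺_

data Exp : Set where
  var    : Fin V → Exp
  lit    : ℕ → Exp
  read   : Exp → Exp
  binary : BinOp → Exp → Exp → Exp
  cond   : Exp → Exp → Exp → Exp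

pattern _⊕_ x y = binary plus x y
pattern _⊛_ x y = binary times x y
pattern _⊘_ x y = binary over x y
pattern _⊚_ x y = binary modulo x y
pattern _≺_ x y = binary less x y

choose : ℕ → ℕ → ℕ → ℕ
choose zero    x y = y
choose (suc _) x y = x

-- A state of the host up to the contents of the temporaries.
record Config : Set where
  constructor config
  field
    vars  : Vec ℕ V
    sim   : ℕ → ℕ
    cells : ℕ → ℕ

open Config

record Holds (s : State) (c : Config) : Set where
  field
    vars-≡  : ∀ i → reg s (toℕ i) ≡ lookup (vars c) i
    sim-≡   : ∀ r → reg s (K + r) ≡ sim c r
    cells-≡ : ∀ a → mem s a ≡ cells c a

open Holds

eval : List ℕ → Config → Exp → ℕ
eval inp c (var i)        = lookup (vars c) i
eval inp c (lit k)        = k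
eval inp c (read e)       = nth inp (eval inp c e)
eval inp c (binary o x y) = ⟦ o ⟧ (eval inp c x) (eval inp c y)
eval inp c (cond e x y)   = choose (eval inp c e) (eval inp c x) (eval inp c y)

-- Register `d` and those above it serve as the evaluation stack. The machine has no instruction
-- that moves a register, so a variable is copied by adding it to zero.
code : Exp → ℕ → Program
code (var i)        d = instr (const d 0) ⨾ instr (arith add d d (toℕ i))
code (lit k)        d = instr (const d k)
code (read e)       d = code e d ⨾ instr (input d d)
code (binary o x y) d = code x d ⨾ code y (suc d) ⨾ instr (arith (toOp o) d d (suc d))
code (cond e x y)   d = code e d ⨾ ifNonzero d (code x d) (code y d)

cost : Exp → ℕ
cost (var i)        = 2
cost (lit k)        = 1
cost (read e)       = cost e + 1
cost (binary o x y) = cost x + (cost y + 1)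
cost (cond e x y)   = cost e + suc (cost x + cost y)

-- The number of stack registers in use. In `binary` the value of `x` stays on the stack while `y`
-- is evaluated; in `cond` the branch may overwrite the value that was tested.
height : Exp → ℕ
height (var i)        = 1
height (lit k)        = 1
height (read e)       = height e
height (binary o x y) = height x ⊔ suc (height y)
height (cond e x y)   = height e ⊔ (height x ⊔ height y)

-- If the variables and the input are at most U ≥ 2, then the
-- value of e is at most U ^ weight e; this rules out overflow.
weight : Exp → ℕ
weight (var i)        = 1
weight (lit k)        = suc k
weight (read e)       = weight e
weight (binary o x y) = weight x + weight y
weight (cond e x y)   = weight e + (weight x + weight y)

weight≥1 : ∀ e → 1 ≤ weight e
weight≥1 (var i)        = s≤s z≤n
weight≥1 (lit k)        = s≤s z≤n
weight≥1 (read e)       = weight≥1 e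
weight≥1 (binary o x y) = ≤-trans (weight≥1 x) (m≤m+n _ _)
weight≥1 (cond e x y)   = ≤-trans (weight≥1 e) (m≤m+n _ _)

height≥1 : ∀ e → 1 ≤ height e
height≥1 (var i)        = s≤s z≤n
height≥1 (lit k)        = s≤s z≤n
height≥1 (read e)       = height≥1 e
height≥1 (binary o x y) = ≤-trans (height≥1 x) (m≤m⊔n _ _)
height≥1 (cond e x y)   = ≤-trans (height≥1 e) (m≤m⊔n _ _)

n<2^n : ∀ n → n < 2 ^ n
n<2^n zero    = s≤s z≤n
n<2^n (suc n) = begin-strict
  suc n         <⟨ +-mono-≤-< (m^n>0 2 n) (n<2^n n) ⟩
  2 ^ n + 2 ^ n ≡⟨ cong (2 ^ n +_) (+-identityʳ _) ⟨
  2 ^ suc n     ∎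
  where open ≤-Reasoning

-- Lets sums obey the same rule as products: powers of `U` with positive exponents are at least 2,
-- so the weights of both arguments simply add.
+≤* : ∀ {x y} → 2 ≤ x → 2 ≤ y → x + y ≤ x * y
+≤* {x} {y} 2≤x 2≤y with ≤-total x y
... | inj₁ x≤y = begin
  x + y ≤⟨ +-monoˡ-≤ y x≤y ⟩
  y + y ≡⟨ cong (y +_) (+-identityʳ y) ⟨
  2 * y ≤⟨ *-monoˡ-≤ y 2≤x ⟩
  x * y ∎
  where open ≤-Reasoning
... | inj₂ y≤x = begin
  x + y ≤⟨ +-monoʳ-≤ x y≤x ⟩
  x + x ≡⟨ cong (x +_) (+-identityʳ x) ⟨
  2 * x ≡⟨ *-comm 2 x ⟩
  x * 2 ≤⟨ *-monoʳ-≤ x 2≤y ⟩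
  x * y ∎
  where open ≤-Reasoning

fromBool≤1 : ∀ b → fromBool b ≤ 1
fromBool≤1 true  = ≤-refl
fromBool≤1 false = z≤n

quo≤ : ∀ w x y → evalOp quo w x y ≤ x
quo≤ w x zero    = z≤n
quo≤ w x (suc y) = m/n≤m x (suc y)

rem≤ : ∀ w x y → evalOp rem w x y ≤ x
rem≤ w x zero    = z≤n
rem≤ w x (suc y) = m%n≤m x (suc y)

module _ {U : ℕ} (2≤U : 2 ≤ U) where

  private instance
    U≢0 : NonZero U
    U≢0 = >-nonZero (≤-trans (s≤s z≤n) 2≤U)

  ^-≥2 : ∀ {a} → 1 ≤ a → 2 ≤ U ^ a
  ^-≥2 {suc a} _ = ≤-trans 2≤U (≤-trans (≤-reflexive (sym (*-identityʳ U))) (*-monoʳ-≤ U (m^n>0 U a)))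

  ⟦⟧-bound : ∀ o {a b x y} → 1 ≤ a → 1 ≤ b → x ≤ U ^ a → y ≤ U ^ b → ⟦ o ⟧ x y ≤ U ^ (a + b)
  ⟦⟧-bound o {a} {b} {x} {y} 1≤a 1≤b x≤ y≤ = go o
    where
    left : x ≤ U ^ (a + b)
    left = ≤-trans x≤ (^-monoʳ-≤ U (m≤m+n a b))
    go : ∀ o → ⟦ o ⟧ x y ≤ U ^ (a + b)
    go plus = begin
      x + y           ≤⟨ +-mono-≤ x≤ y≤ ⟩
      U ^ a + U ^ b   ≤⟨ +≤* (^-≥2 1≤a) (^-≥2 1≤b) ⟩
      U ^ a * U ^ b   ≡⟨ ^-distribˡ-+-* U a b ⟨
      U ^ (a + b)     ∎
      where open ≤-Reasoning
    go times = begin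
      x * y           ≤⟨ *-mono-≤ x≤ y≤ ⟩
      U ^ a * U ^ b   ≡⟨ ^-distribˡ-+-* U a b ⟨
      U ^ (a + b)     ∎
      where open ≤-Reasoning
    go over   = ≤-trans (quo≤ 0 x y) left
    go modulo = ≤-trans (rem≤ 0 x y) left
    go less = ≤-trans (fromBool≤1 (x <ᵇ y)) (m^n>0 U (a + b))

quo-word : ∀ v w x y → evalOp quo w x y ≡ evalOp quo v x y
quo-word v w x zero    = refl
quo-word v w x (suc y) = refl

rem-word : ∀ v w x y → evalOp rem w x y ≡ evalOp rem v x y
rem-word v w x zero    = refl
rem-word v w x (suc y) = refl

toOp-correct : ∀ o {w x y} → ⟦ o ⟧ x y < 2 ^ w → evalOp (toOp o) w x y ≡ ⟦ o ⟧ x y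
toOp-correct plus   {w} v< = mod2^-small w v<
toOp-correct times  {w} v< = mod2^-small w v<
toOp-correct over   {w} {x} {y} _ = quo-word 0 w x y
toOp-correct modulo {w} {x} {y} _ = rem-word 0 w x y
toOp-correct less   _ = refl

not-target : ∀ {d i} → d < K → i < d ⊎ K ≤ i → i ≢ d
not-target d<K (inj₁ i<d) = <⇒≢ i<d
not-target d<K (inj₂ K≤i) = λ i≡d → <⇒≢ (≤-trans d<K K≤i) (sym i≡d)

assign : Fin V → Exp → Program
assign x e = code e V ⨾ instr (const (toℕ x) 0) ⨾ instr (arith add (toℕ x) (toℕ x) V)

set : Fin V → ℕ → Config → Config
set x v c = record c { vars = vars c [ x ]≔ v }

put : Exp → Exp → Program
put e₁ e₂ = code e₁ V ⨾ code e₂ (suc V) ⨾ instr (store V (suc V))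

write : ℕ → ℕ → Config → Config
write a v c = record c { cells = update (cells c) a v }

-- Register `K` is register 0 of the simulated machine, where a query leaves its answer; expressions
-- cannot refer to it.
putAnswer : Exp → Program
putAnswer e = code e V ⨾ instr (store V K)

while : Fin V → Program → Program
while x = whileNonzero (toℕ x)

-- Correctness and running time of compiled expressions and loops

-- Expressions of weight at most `Ω` have values below `2 ^ w`, so on them machine arithmetic agrees
-- with arithmetic on natural numbers. The constant 60 bounds the weight of every expression of the
-- program that contains no parameter.
module Machine (w : ℕ) (inp : List ℕ) (U : ℕ) (2≤U : 2 ≤ U) (inp≤U : ∀ a → nth inp a ≤ U)
               (Ω : ℕ) (60≤Ω : 60 ≤ Ω) (^Ω< : U ^ Ω < 2 ^ w) where

  private instance
    U≢0 : NonZero U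
    U≢0 = >-nonZero (≤-trans (s≤s z≤n) 2≤U)

  Small : Config → Set
  Small c = All (_≤ U) (vars c)

  -- A record rather than a synonym, so that the type determines `k`; the bare `U ^ k` would unfold
  -- as soon as `k` is a successor.
  record Fits (k : ℕ) : Set where
    constructor fits
    field ^< : U ^ k < 2 ^ w

  fits-≤ : ∀ {j k} → j ≤ k → Fits k → Fits j
  fits-≤ j≤k (fits ^<) = fits (≤-<-trans (^-monoʳ-≤ U j≤k) ^<)

  U≤U^ : ∀ {k} → 1 ≤ k → U ≤ U ^ k
  U≤U^ {suc k} _ = m≤m*n U (U ^ k) {{m^n≢0 U k}}

  eval-bound : ∀ {c} → Small c → ∀ e → eval inp c e ≤ U ^ weight e
  eval-bound sm (var i) = ≤-trans (lookup⁺ sm i) (≤-reflexive (sym (*-identityʳ U)))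
  eval-bound sm (lit k) = <⇒≤ (begin-strict
    k         <⟨ n<2^n k ⟩
    2 ^ k     ≤⟨ ^-monoˡ-≤ k 2≤U ⟩
    U ^ k     ≤⟨ ^-monoʳ-≤ U (n≤1+n k) ⟩
    U ^ suc k ∎)
    where open ≤-Reasoning
  eval-bound sm (read e) = ≤-trans (inp≤U _) (U≤U^ (weight≥1 e))
  eval-bound sm (binary o x y) =
    ⟦⟧-bound 2≤U o (weight≥1 x) (weight≥1 y) (eval-bound sm x) (eval-bound sm y)
  eval-bound {c} sm (cond e x y) with eval inp c e
  ... | zero  = ≤-trans (eval-bound sm y) (^-monoʳ-≤ U (≤-trans (m≤n+m _ (weight x)) (m≤n+m _ (weight e))))
  ... | suc _ = ≤-trans (eval-bound sm x) (^-monoʳ-≤ U (≤-trans (m≤m+n _ (weight y)) (m≤n+m _ (weight e))))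

  eval-word : ∀ {c} → Small c → ∀ e → Fits (weight e) → eval inp c e < 2 ^ w
  eval-word sm e (fits ^<) = ≤-<-trans (eval-bound sm e) ^<

  -- Registers from `d` to `K - 1` may be overwritten; `frame` protects what lies below on the
  -- stack, the variables, and the simulated registers.
  record Computes (p : Program) (s : State) (d v t : ℕ) : Set where
    field
      final : State
      time  : ℕ
      run   : Run w inp p s final time
      time≤ : time ≤ t
      value : reg final d ≡ v
      frame : ∀ r → r < d ⊎ K ≤ r → reg final r ≡ reg s r
      mem-≡ : ∀ a → mem final a ≡ mem s a

  open Computes

  keeps : ∀ {p s d v t c} (C : Computes p s d v t) → V ≤ d → Holds s c → Holds (final C) c
  keeps C V≤d h = record
    { vars-≡  = λ i → trans (frame C _ (inj₁ (<-≤-trans (toℕ<n i) V≤d))) (vars-≡ h i)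
    ; sim-≡   = λ r → trans (frame C _ (inj₂ (m≤m+n K r))) (sim-≡ h r)
    ; cells-≡ = λ a → trans (mem-≡ C a) (cells-≡ h a) }

  code-correct : ∀ {c} → Small c → ∀ e d {s} → Holds s c → V ≤ d → d + height e ≤ K →
                 Fits (weight e) → Computes (code e d) s d (eval inp c e) (cost e)

  move-correct : ∀ {s d r x} → d < K → r < d ⊎ K ≤ r → reg s r ≡ x → x < 2 ^ w →
                 Computes (instr (const d 0) ⨾ instr (arith add d d r)) s d x 2
  move-correct {s} {d} {r} {x} d<K r-ok r≡x x< = record
    { run = instr ⨾ instr
    ; time≤ = ≤-refl
    ; value = trans (update-same d) (begin
        (update (reg s) d z d + update (reg s) d z r) mod2^ w
          ≡⟨ cong₂ (λ a b → (a + b) mod2^ w)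
               (trans (update-same d) (mod2^-small w (m^n>0 2 w)))
               (trans (update-other (not-target d<K r-ok)) r≡x) ⟩
        x mod2^ w ≡⟨ mod2^-small w x< ⟩
        x         ∎)
    ; frame = λ i i-ok → trans (update-other (not-target d<K i-ok)) (update-other (not-target d<K i-ok))
    ; mem-≡ = λ _ → refl }
    where
    open ≡-Reasoning
    z = 0 mod2^ w

  code-correct {c} sm (var i) d h V≤d d+1≤K ok =
    move-correct (≤-trans (≤-reflexive (+-comm 1 d)) d+1≤K) (inj₁ (<-≤-trans (toℕ<n i) V≤d))
      (vars-≡ h i) (eval-word {c} sm (var i) ok)
  code-correct {c} sm (lit k) d h V≤d d+1≤K ok = record
    { run = instr
    ; time≤ = ≤-refl
    ; value = trans (update-same d) (mod2^-small w (eval-word {c} sm (lit k) ok))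
    ; frame = λ r r-ok → update-other (not-target (≤-trans (≤-reflexive (+-comm 1 d)) d+1≤K) r-ok)
    ; mem-≡ = λ _ → refl }
  code-correct {c} sm (read e) d {s} h V≤d ≤K ok = record
    { run = run E ⨾ instr
    ; time≤ = +-monoˡ-≤ 1 (time≤ E)
    ; value = trans (update-same d)
        (trans (cong (λ a → nth inp a mod2^ w) (value E))
               (mod2^-small w (eval-word sm (read e) ok)))
    ; frame = λ r r-ok → trans (update-other (not-target (≤-trans (m<m+n d (height≥1 e)) ≤K) r-ok)) (frame E r r-ok)
    ; mem-≡ = mem-≡ E }
    where
    E = code-correct sm e d h V≤d ≤K ok
  code-correct {c} sm e@(binary o x y) d {s} h V≤d ≤K ok = record
    { run = run X ⨾ run Y ⨾ instr
    ; time≤ = +-mono-≤ (time≤ X) (+-monoˡ-≤ 1 (time≤ Y))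
    ; value = trans (update-same d)
        (trans (cong₂ (evalOp (toOp o) w) (trans (frame Y d (inj₁ ≤-refl)) (value X)) (value Y))
               (toOp-correct o (eval-word sm e ok)))
    ; frame = λ r r-ok → trans (update-other (not-target d<K r-ok))
        (trans (frame Y r (Sum.map₁ m≤n⇒m≤1+n r-ok)) (frame X r r-ok))
    ; mem-≡ = λ a → trans (mem-≡ Y a) (mem-≡ X a) }
    where
    X = code-correct sm x d h V≤d (≤-trans (+-monoʳ-≤ d (m≤m⊔n _ _)) ≤K)
          (fits-≤ (m≤m+n _ _) ok)
    hX = keeps X V≤d h
    ≤K′ : suc d + height y ≤ K
    ≤K′ = ≤-trans (≤-reflexive (sym (+-suc d (height y)))) (≤-trans (+-monoʳ-≤ d (m≤n⊔m (height x) _)) ≤K)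
    d<K : d < K
    d<K = ≤-trans (m≤m+n (suc d) _) ≤K′
    Y = code-correct sm y (suc d) hX (m≤n⇒m≤1+n V≤d) ≤K′ (fits-≤ (m≤n+m _ _) ok)
  code-correct {c} sm (cond e x y) d {s} h V≤d ≤K ok = branch
    where
    E = code-correct sm e d h V≤d (≤-trans (+-monoʳ-≤ d (m≤m⊔n _ _)) ≤K)
          (fits-≤ (m≤m+n _ _) ok)
    hE = keeps E V≤d h
    X = code-correct sm x d hE V≤d
          (≤-trans (+-monoʳ-≤ d (≤-trans (m≤m⊔n _ _) (m≤n⊔m (height e) _))) ≤K)
          (fits-≤ (≤-trans (m≤m+n (weight x) _) (m≤n+m _ (weight e))) ok)
    Y = code-correct sm y d hE V≤d
          (≤-trans (+-monoʳ-≤ d (≤-trans (m≤n⊔m (height x) _) (m≤n⊔m (height e) _))) ≤K)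
          (fits-≤ (≤-trans (m≤n+m (weight y) _) (m≤n+m _ (weight e))) ok)
    branch : Computes (code (cond e x y) d) s d (eval inp c (cond e x y)) (cost (cond e x y))
    branch with eval inp c e | value E
    ... | zero | v≡ = record
      { run = run E ⨾ if-false v≡ (run Y)
      ; time≤ = +-mono-≤ (time≤ E) (s≤s (≤-trans (time≤ Y) (m≤n+m _ _)))
      ; value = value Y
      ; frame = λ r r-ok → trans (frame Y r r-ok) (frame E r r-ok)
      ; mem-≡ = λ a → trans (mem-≡ Y a) (mem-≡ E a) }
    ... | suc _ | v≡ = record
      { run = run E ⨾ if-true (λ ≡0 → 1+n≢0 (trans (sym v≡) ≡0)) (run X)
      ; time≤ = +-mono-≤ (time≤ E) (s≤s (≤-trans (time≤ X) (m≤m+n _ _)))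
      ; value = value X
      ; frame = λ r r-ok → trans (frame X r r-ok) (frame E r r-ok)
      ; mem-≡ = λ a → trans (mem-≡ X a) (mem-≡ E a) }

  -- One register more than `e` needs is demanded, because `put` evaluates its second expression one
  -- place higher on the stack.
  record Suitable (e : Exp) : Set where
    field
      height≤     : V + suc (height e) ≤ K
      fits-weight : Fits (weight e)

  open Suitable

  -- For a concrete expression both implicit tests compute to the unit type and are filled in by the
  -- type checker.
  suitable : ∀ {e} {_ : True (V + suc (height e) ≤ᵇ K)} {_ : True (weight e ≤ᵇ 60)} → Suitable e
  suitable {e} {h} {k} = record
    { height≤ = ≤ᵇ⇒≤ _ _ h
    ; fits-weight = fits-≤ (≤-trans (≤ᵇ⇒≤ (weight e) 60 k) 60≤Ω) (fits ^Ω<) }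

  record Reaches (p : Program) (s : State) (t : ℕ) (Q : Config → Set) : Set where
    field
      {final}  : State
      {result} : Config
      {time}   : ℕ
      run      : Run w inp p s final time
      time≤    : time ≤ t
      holds    : Holds final result
      post     : Q result

  -- Total correctness with a time bound. The precondition is a configuration instead of a
  -- predicate, so that matching on `refl` in a chain of `_then_` lets the type checker compute the
  -- successive configurations.
  record Triple (c : Config) (p : Program) (t : ℕ) (Q : Config → Set) : Set where
    constructor triple
    field from : ∀ {s} → Holds s c → Reaches p s t Q

  open Triple

  weaken : ∀ {c p t u} {Q R : Config → Set} → t ≤ u → (∀ {c} → Q c → R c) → Triple c p t Q → Triple c p u R
  weaken t≤u Q⇒R τ = triple λ h → let module P = Reaches (from τ h) in record
    { run = P.run ; time≤ = ≤-trans P.time≤ t≤u ; holds = P.holds ; post = Q⇒R P.post }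

  done : ∀ {c} {Q : Config → Set} → Q c → Triple c skip 0 Q
  done q = triple λ h → record { run = skip ; time≤ = z≤n ; holds = h ; post = q }

  infixr 4 _then_
  _then_ : ∀ {c p q t u} {Q R : Config → Set} → Triple c p t Q →
           (∀ {c′} → Q c′ → Triple c′ q u R) → Triple c (p ⨾ q) (t + u) R
  τ then k = triple λ h →
    let module P = Reaches (from τ h)
        module Q = Reaches (from (k P.post) P.holds)
    in record { run = P.run ⨾ Q.run ; time≤ = +-mono-≤ P.time≤ Q.time≤ ; holds = Q.holds ; post = Q.post }

  assign-triple : ∀ {c} x e → Small c → Suitable e →
                  Triple c (assign x e) (cost e + 2) (_≡ set x (eval inp c e) c)
  assign-triple {c} x e sm ok = triple run-assign
    where
    run-assign : ∀ {s} → Holds s c → Reaches (assign x e) s (cost e + 2) (_≡ set x (eval inp c e) c)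
    run-assign {s} h = record
      { run = E.run ⨾ instr ⨾ instr
      ; time≤ = +-monoˡ-≤ 2 E.time≤
      ; holds = record { vars-≡ = vars′ ; sim-≡ = sim′ ; cells-≡ = cells-≡ hE }
      ; post = refl }
      where
      C = code-correct sm e V h ≤-refl
            (≤-trans (+-monoʳ-≤ V (n≤1+n (height e))) (height≤ ok)) (fits-weight ok)
      module E = Computes C
      hE = keeps C ≤-refl h
      zero′ = 0 mod2^ w
      zeroed = update (reg E.final) (toℕ x) zero′
      x≢V : V ≢ toℕ x
      x≢V V≡x = <⇒≢ (toℕ<n x) (sym V≡x)
      sum-≡ : (zeroed (toℕ x) + zeroed V) mod2^ w ≡ eval inp c e
      sum-≡ = trans
        (cong₂ (λ a b → (a + b) mod2^ w)
          (trans (update-same (toℕ x)) (mod2^-small w (m^n>0 2 w)))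
          (trans (update-other x≢V) E.value))
        (mod2^-small w (eval-word sm e (fits-weight ok)))
      vars′ : ∀ i → _ ≡ lookup (vars c [ x ]≔ eval inp c e) i
      vars′ i with i ≟ᶠ x
      ... | yes refl = trans (update-same (toℕ i)) (trans sum-≡ (sym (lookup∘update i (vars c) _)))
      ... | no  i≢x  = trans (update-other (i≢x ∘ toℕ-injective)) (trans (update-other (i≢x ∘ toℕ-injective))
          (trans (vars-≡ hE i) (sym (lookup∘update′ i≢x (vars c) _))))
      sim′ : ∀ r → _ ≡ sim c r
      sim′ r = trans (update-other K+r≢x) (trans (update-other K+r≢x) (sim-≡ hE r))
        where
        K+r≢x : K + r ≢ toℕ x
        K+r≢x K+r≡x = <⇒≢ (<-≤-trans (toℕ<n x) (≤-trans (≤ᵇ⇒≤ V K tt) (m≤m+n K r))) (sym K+r≡x)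

  assign-value : ∀ {c} x e {v} → eval inp c e ≡ v → Small c → Suitable e →
                 Triple c (assign x e) (cost e + 2) (_≡ set x v c)
  assign-value x e refl = assign-triple x e

  put-triple : ∀ {c} e₁ e₂ → Small c → Suitable e₁ → Suitable e₂ →
               Triple c (put e₁ e₂) (cost e₁ + (cost e₂ + 1)) (_≡ write (eval inp c e₁) (eval inp c e₂) c)
  put-triple {c} e₁ e₂ sm ok₁ ok₂ = triple λ h →
    let C₁ = code-correct sm e₁ V h ≤-refl
               (≤-trans (+-monoʳ-≤ V (n≤1+n (height e₁))) (height≤ ok₁)) (fits-weight ok₁)
        h₁ = keeps C₁ ≤-refl h
        C₂ = code-correct sm e₂ (suc V) h₁ (n≤1+n V)
               (≤-trans (≤-reflexive (sym (+-suc V (height e₂)))) (height≤ ok₂)) (fits-weight ok₂)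
        h₂ = keeps C₂ (n≤1+n V) h₁
    in record
      { run = run C₁ ⨾ run C₂ ⨾ instr
      ; time≤ = +-mono-≤ (time≤ C₁) (+-monoˡ-≤ 1 (time≤ C₂))
      ; holds = record
          { vars-≡ = vars-≡ h₂
          ; sim-≡ = sim-≡ h₂
          ; cells-≡ = λ a → trans
              (cong (λ i → update (mem (final C₂)) i (reg (final C₂) (suc V)) a)
                (trans (frame C₂ V (inj₁ ≤-refl)) (value C₁)))
              (update-cong (eval inp c e₁) a (value C₂) (cells-≡ h₂ a)) }
      ; post = refl }

  putAnswer-triple : ∀ {c} e → Small c → Suitable e →
                     Triple c (putAnswer e) (cost e + 1) (_≡ write (eval inp c e) (sim c 0) c)
  putAnswer-triple {c} e sm ok = triple λ h →
    let C = code-correct sm e V h ≤-refl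
              (≤-trans (+-monoʳ-≤ V (n≤1+n (height e))) (height≤ ok)) (fits-weight ok)
        hC = keeps C ≤-refl h
    in record
      { run = run C ⨾ instr
      ; time≤ = +-monoˡ-≤ 1 (time≤ C)
      ; holds = record
          { vars-≡ = vars-≡ hC
          ; sim-≡ = sim-≡ hC
          ; cells-≡ = λ a → trans
              (cong (λ i → update (mem (final C)) i (reg (final C) K) a) (value C))
              (update-cong (eval inp c e) a (sim-≡ hC 0) (cells-≡ hC a)) }
      ; post = refl }

  -- The invariant is indexed by the number of completed rounds, which forces exactly `m` of them.
  -- Each round pays for its body and its test; the remaining 1 is the failing test at the end.
  while-triple : ∀ (I : ℕ → Config → Set) x {body m t} →
                 (∀ {j c} → j < m → I j c → lookup (vars c) x ≢ 0) →
                 (∀ {c} → I m c → lookup (vars c) x ≡ 0) →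
                 (∀ {j c} → j < m → I j c → Triple c body t (I (suc j))) →
                 ∀ {c} → I 0 c → Triple c (while x body) (1 + m * suc t) (I m)
  while-triple I x {body} {m} {t} continue stop step = go m 0 (+-identityʳ m)
    where
    go : ∀ d j → d + j ≡ m → ∀ {c} → I j c → Triple c (while x body) (1 + d * suc t) (I m)
    go zero j refl i = triple λ h → record
      { run = while-done (trans (vars-≡ h x) (stop i)) ; time≤ = ≤-refl ; holds = h ; post = i }
    go (suc d) j d+j≡m {c} i = triple λ h →
      let j<m = ≤-trans (s≤s (m≤n+m j d)) (≤-reflexive d+j≡m)
          module B = Reaches (from (step j<m i) h)
          module R = Reaches (from (go d (suc j) (trans (+-suc d j) d+j≡m) B.post) B.holds)
      in record
      { run = while-true (λ ≡0 → continue j<m i (trans (sym (vars-≡ h x)) ≡0)) B.run R.run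
      ; time≤ = s≤s (begin
          B.time + R.time         ≤⟨ +-mono-≤ B.time≤ R.time≤ ⟩
          t + (1 + d * suc t)     ≡⟨ +-suc t (d * suc t) ⟩
          suc t + d * suc t       ∎)
      ; holds = R.holds
      ; post = R.post }
      where open ≤-Reasoning

-- Simulating short words by long ones

compileInstr : Instr → Program
compileInstr (const r k)     = instr (const (K + r) k) ⨾ instr (arith rem (K + r) (K + r) 2)
compileInstr (arith o r a b) = instr (arith o (K + r) (K + a) (K + b)) ⨾ instr (arith rem (K + r) (K + r) 2)
-- Simulated cells and the stored input are already reduced modulo `W`, so no second reduction is
-- needed; the extra instruction computes the address instead.
compileInstr (load r a)      = instr (arith add V (K + a) 2) ⨾ instr (load (K + r) V)
compileInstr (store a b)     = instr (arith add V (K + a) 2) ⨾ instr (store V (K + b))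
compileInstr (input r a)     = instr (arith add V (K + a) 3) ⨾ instr (load (K + r) V)

-- Variable 2 holds the modulus W, which is also the offset of the simulated
-- memory; variable 3 holds the offset of the simulated input.
compile : Program → Program
compile skip               = skip
compile (instr i)          = compileInstr i
compile (p ⨾ q)            = compile p ⨾ compile q
compile (ifNonzero r p q)  = ifNonzero (K + r) (compile p) (compile q)
compile (whileNonzero r p) = whileNonzero (K + r) (compile p)

2^≢0 : ∀ w → NonZero (2 ^ w)
2^≢0 w = m^n≢0 2 w

mod2^< : ∀ x w → x mod2^ w < 2 ^ w
mod2^< x w = m%n<n x (2 ^ w) {{2^≢0 w}}

2^∣2^ : ∀ {v w} → v ≤ w → 2 ^ v ∣ 2 ^ w
2^∣2^ {v} {w} v≤w = divides (2 ^ (w ∸ v)) (begin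
  2 ^ w                   ≡⟨ cong (2 ^_) (m∸n+n≡m v≤w) ⟨
  2 ^ (w ∸ v + v)         ≡⟨ ^-distribˡ-+-* 2 (w ∸ v) v ⟩
  2 ^ (w ∸ v) * 2 ^ v     ∎)
  where open ≡-Reasoning

mod2^-mod2^ : ∀ {v w} → v ≤ w → ∀ x → (x mod2^ w) mod2^ v ≡ x mod2^ v
mod2^-mod2^ {v} {w} v≤w x = m∣n⇒o%n%m≡o%m (2 ^ v) (2 ^ w) x {{2^≢0 v}} {{2^≢0 w}} (2^∣2^ v≤w)

bitwise-zeros : ∀ f → f false false ≡ false → ∀ w → bitwise f w 0 0 ≡ 0
bitwise-zeros f f≡ zero    = refl
bitwise-zeros f f≡ (suc w) rewrite f≡ | bitwise-zeros f f≡ w = refl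

half< : ∀ {x w} → x < 2 ^ suc w → x / 2 < 2 ^ w
half< {x} {w} x< = m<n*o⇒m/o<n {x} {2 ^ w} {2} (≤-trans x< (≤-reflexive (*-comm 2 (2 ^ w))))

-- The bits of `x` and `y` beyond the first `v` are zero, and `f` sends two zeros to zero.
bitwise-extend : ∀ f → f false false ≡ false → ∀ {v w x y} → v ≤ w → x < 2 ^ v → y < 2 ^ v →
                 bitwise f w x y ≡ bitwise f v x y
bitwise-extend f f≡ {w = w} z≤n (s≤s z≤n) (s≤s z≤n) = bitwise-zeros f f≡ w
bitwise-extend f f≡ {x = x} {y} (s≤s {v} v≤w) x< y< =
  cong (λ b → fromBool (f (x % 2 ≡ᵇ 1) (y % 2 ≡ᵇ 1)) + 2 * b) (bitwise-extend f f≡ v≤w (half< {w = v} x<) (half< {w = v} y<))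

bitwise< : ∀ f w x y → bitwise f w x y < 2 ^ w
bitwise< f zero    x y = s≤s z≤n
bitwise< f (suc w) x y = begin-strict
  b + 2 * r           ≤⟨ +-monoˡ-≤ (2 * r) (fromBool≤1 (f (x % 2 ≡ᵇ 1) (y % 2 ≡ᵇ 1))) ⟩
  1 + 2 * r           <⟨ n<1+n _ ⟩
  2 + 2 * r           ≡⟨ *-suc 2 r ⟨
  2 * suc r           ≤⟨ *-monoʳ-≤ 2 (bitwise< f w (x / 2) (y / 2)) ⟩
  2 ^ suc w           ∎
  where
  open ≤-Reasoning
  b = fromBool (f (x % 2 ≡ᵇ 1) (y % 2 ≡ᵇ 1))
  r = bitwise f w (x / 2) (y / 2)

-- Results taken modulo `2 ^ w` can be reduced further because `2 ^ v` divides `2 ^ w`; for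
-- subtraction the two summands that prevent negative values differ by a multiple of `2 ^ v`. The
-- results of the other operations are below `2 ^ v` already, where `1 ≤ v` makes room for the
-- outcome 1 of a comparison.
evalOp-mod2^ : ∀ o {v w x y} → 1 ≤ v → v ≤ w → x < 2 ^ v → y < 2 ^ v →
               evalOp o w x y mod2^ v ≡ evalOp o v x y
evalOp-mod2^ o {v} {w} {x} {y} 1≤v v≤w x< y< = go o
  where
  bit : ∀ b → fromBool b < 2 ^ v
  bit b = ≤-<-trans (fromBool≤1 b) (^-monoʳ-< 2 (s≤s (s≤s z≤n)) 1≤v)
  bits : ∀ f → f false false ≡ false → bitwise f w x y mod2^ v ≡ bitwise f v x y
  bits f f≡ = trans (cong (_mod2^ v) (bitwise-extend f f≡ v≤w x< y<)) (mod2^-small v (bitwise< f v x y))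
  instance
    2^v≢0 : NonZero (2 ^ v)
    2^v≢0 = 2^≢0 v
  -- `2 ^ w` consists of `2 ^ v` and `m` further copies of it.
  m = pred (2 ^ (w ∸ v))
  split : x + 2 ^ w ∸ y ≡ x + 2 ^ v ∸ y + m * 2 ^ v
  split = begin
    x + 2 ^ w ∸ y                    ≡⟨ cong (λ u → x + 2 ^ u ∸ y) (m∸n+n≡m v≤w) ⟨
    x + 2 ^ (w ∸ v + v) ∸ y          ≡⟨ cong (λ u → x + u ∸ y) (^-distribˡ-+-* 2 (w ∸ v) v) ⟩
    x + 2 ^ (w ∸ v) * 2 ^ v ∸ y      ≡⟨ cong (λ u → x + u * 2 ^ v ∸ y) (suc-pred (2 ^ (w ∸ v)) {{2^≢0 (w ∸ v)}}) ⟨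
    x + (2 ^ v + m * 2 ^ v) ∸ y      ≡⟨ cong (_∸ y) (+-assoc x (2 ^ v) _) ⟨
    x + 2 ^ v + m * 2 ^ v ∸ y        ≡⟨ +-∸-comm (m * 2 ^ v) (≤-trans (<⇒≤ y<) (m≤n+m (2 ^ v) x)) ⟩
    x + 2 ^ v ∸ y + m * 2 ^ v        ∎
    where open ≡-Reasoning
  go : ∀ o → evalOp o w x y mod2^ v ≡ evalOp o v x y
  go add = mod2^-mod2^ v≤w (x + y)
  go sub = begin
    ((x + 2 ^ w ∸ y) mod2^ w) mod2^ v      ≡⟨ mod2^-mod2^ v≤w _ ⟩
    (x + 2 ^ w ∸ y) mod2^ v                ≡⟨ cong (_mod2^ v) split ⟩
    (x + 2 ^ v ∸ y + m * 2 ^ v) mod2^ v    ≡⟨ [m+kn]%n≡m%n (x + 2 ^ v ∸ y) m (2 ^ v) ⟩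
    (x + 2 ^ v ∸ y) mod2^ v                ∎
    where open ≡-Reasoning
  go mul = mod2^-mod2^ v≤w (x * y)
  go quo = trans (mod2^-small v (≤-<-trans (quo≤ w x y) x<)) (quo-word v w x y)
  go rem = trans (mod2^-small v (≤-<-trans (rem≤ w x y) x<)) (rem-word v w x y)
  go and = bits _∧_ refl
  go ior = bits _∨_ refl
  go xor = bits _xor_ refl
  go shl = mod2^-mod2^ v≤w (x * 2 ^ y)
  go shr = mod2^-small v (≤-<-trans (m/n≤m x (2 ^ y) {{2^≢0 y}}) x<)
  go eq  = mod2^-small v (bit (x ≡ᵇ y))
  go lt  = mod2^-small v (bit (x <ᵇ y))

rem-2^ : ∀ w x v → evalOp rem w x (2 ^ v) ≡ x mod2^ v
rem-2^ w x v = go (2 ^ v) {{2^≢0 v}}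
  where
  go : ∀ y .{{_ : NonZero y}} → evalOp rem w x y ≡ x % y
  go (suc y) = refl

update-update : ∀ f i v v′ j → update (update f i v) i v′ j ≡ update f i v′ j
update-update f i v v′ j with j ≡ᵇ i
... | true  = refl
... | false = refl

update-skip : ∀ i {k j} {t v x : ℕ} → j ≢ k →
              (if j ≡ᵇ i then v else (if j ≡ᵇ k then t else x)) ≡ (if j ≡ᵇ i then v else x)
update-skip i {j = j} j≢k = update-cong i j refl (update-other j≢k)

-- The simulated memory occupies the host addresses from `W` up to `W + W`. The input lies beyond
-- this window by `W+W≤base`, so the stores of the simulated program cannot damage it. `μ` records
-- the host memory outside the window, which stays fixed during a run.
module Simulation
  (w : ℕ) (inp : List ℕ) (w₀ : ℕ) (inp₀ : List ℕ) (1≤w₀ : 1 ≤ w₀) (w₀≤w : w₀ ≤ w)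
  (vs : Vec ℕ V) (μ : ℕ → ℕ) (vs-W : lookup vs 2F ≡ 2 ^ w₀)
  (W+W≤base : 2 ^ w₀ + 2 ^ w₀ ≤ lookup vs 3F) (base+W≤ : lookup vs 3F + 2 ^ w₀ ≤ 2 ^ w)
  (μ-input : ∀ a → a < 2 ^ w₀ → μ (lookup vs 3F + a) ≡ nth inp₀ a mod2^ w₀)
  where

  private
    W base : ℕ
    W = 2 ^ w₀
    base = lookup vs 3F

  record Simulates (s h : State) : Set where
    field
      vars-≡  : ∀ i → reg h (toℕ i) ≡ lookup vs i
      sim-≡   : ∀ r → reg h (K + r) ≡ reg s r
      inside  : ∀ a → a < W → mem h (W + a) ≡ mem s a
      outside : ∀ a → a < W ⊎ W + W ≤ a → mem h a ≡ μ a
      reg<    : ∀ r → reg s r < W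
      mem<    : ∀ a → mem s a < W

  open Simulates

  update< : ∀ {f} → (∀ i → f i < W) → ∀ i {v} → v < W → ∀ j → update f i v j < W
  update< f< i v< j with j ≡ᵇ i
  ... | true  = v<
  ... | false = f< j

  -- Register `V` is exempt because compiled loads and inputs leave an address in it.
  sim-assign : ∀ {s h} → Simulates s h → ∀ r {v h′} → v < W →
               (∀ j → j ≢ V → reg h′ j ≡ update (reg h) (K + r) v j) →
               (∀ a → mem h′ a ≡ mem h a) →
               Simulates (record s { reg = update (reg s) r v }) h′
  sim-assign {s} {h} S r {v} v< reg′ mem′ = record
    { vars-≡  = λ i → trans (reg′ (toℕ i) (<⇒≢ (toℕ<n i)))
                  (trans (update-other (<⇒≢ (<-≤-trans (toℕ<n i) (≤-trans (≤ᵇ⇒≤ V K tt) (m≤m+n K r)))))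
                         (vars-≡ S i))
    ; sim-≡   = λ j → trans (reg′ (K + j) λ ()) (sim′ j)
    ; inside  = λ a a< → trans (mem′ _) (inside S a a<)
    ; outside = λ a a∉ → trans (mem′ a) (outside S a a∉)
    ; reg<    = update< (reg< S) r v<
    ; mem<    = mem< S }
    where
    sim′ : ∀ j → update (reg h) (K + r) v (K + j) ≡ update (reg s) r v j
    sim′ j with j ≡ᵇ r
    ... | true  = refl
    ... | false = sim-≡ S j

  address : ∀ {s h} → Simulates s h → ∀ a (k : Fin V) → lookup vs k + W ≤ 2 ^ w →
            evalOp add w (reg h (K + a)) (reg h (toℕ k)) ≡ lookup vs k + reg s a
  address {s} S a k k+W≤ rewrite sim-≡ S a | vars-≡ S k | +-comm (reg s a) (lookup vs k) =
    mod2^-small w (<-≤-trans (+-monoʳ-< (lookup vs k) (reg< S a)) k+W≤)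

  W-fits : lookup vs 2F + W ≤ 2 ^ w
  W-fits rewrite vs-W = ≤-trans W+W≤base (≤-trans (m≤m+n base W) base+W≤)

  record Outcome (p : Program) (h : State) (s′ : State) (t : ℕ) : Set where
    field
      {final}   : State
      {time}    : ℕ
      run       : Run w inp (compile p) h final time
      time≤     : time ≤ t
      simulates : Simulates s′ final

  compileInstr-correct : ∀ i {s h} → Simulates s h → Outcome (instr i) h (exec w₀ inp₀ i s) 2
  compileInstr-correct (const r k) {s} {h} S = record
    { run = instr ⨾ instr
    ; time≤ = ≤-refl
    ; simulates = sim-assign S r (mod2^< k w₀)
        (λ j _ → trans (update-update (reg h) (K + r) _ _ j)
                   (update-cong (K + r) j value refl))
        (λ _ → refl) }
    where
    value : evalOp rem w (update (reg h) (K + r) (k mod2^ w) (K + r)) (reg h 2) ≡ k mod2^ w₀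
    value = begin
      _                                   ≡⟨ cong₂ (evalOp rem w) (update-same (K + r)) (trans (vars-≡ S 2F) vs-W) ⟩
      evalOp rem w (k mod2^ w) W          ≡⟨ rem-2^ w _ w₀ ⟩
      (k mod2^ w) mod2^ w₀                ≡⟨ mod2^-mod2^ w₀≤w k ⟩
      k mod2^ w₀                          ∎
      where open ≡-Reasoning
  compileInstr-correct (arith o r a b) {s} {h} S = record
    { run = instr ⨾ instr
    ; time≤ = ≤-refl
    ; simulates = sim-assign S r value<
        (λ j _ → trans (update-update (reg h) (K + r) _ _ j)
                   (update-cong (K + r) j value refl))
        (λ _ → refl) }
    where
    reduced : evalOp o w (reg s a) (reg s b) mod2^ w₀ ≡ evalOp o w₀ (reg s a) (reg s b)
    reduced = evalOp-mod2^ o 1≤w₀ w₀≤w (reg< S a) (reg< S b)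
    value< : evalOp o w₀ (reg s a) (reg s b) < W
    value< = subst (_< W) reduced (mod2^< _ w₀)
    value : evalOp rem w (update (reg h) (K + r) (evalOp o w (reg h (K + a)) (reg h (K + b))) (K + r)) (reg h 2)
            ≡ evalOp o w₀ (reg s a) (reg s b)
    value = begin
      _   ≡⟨ cong₂ (evalOp rem w) (update-same (K + r)) (trans (vars-≡ S 2F) vs-W) ⟩
      _   ≡⟨ rem-2^ w _ w₀ ⟩
      _   ≡⟨ cong (_mod2^ w₀) (cong₂ (evalOp o w) (sim-≡ S a) (sim-≡ S b)) ⟩
      _   ≡⟨ reduced ⟩
      _   ∎
      where open ≡-Reasoning
  compileInstr-correct (load r a) {s} {h} S = record
    { run = instr ⨾ instr
    ; time≤ = ≤-refl
    ; simulates = sim-assign S r (mem< S _)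
        (λ j j≢V → trans (update-cong (K + r) j
          (trans (cong (mem h) (trans (address S a 2F W-fits) (cong (_+ reg s a) vs-W)))
                 (inside S _ (reg< S a)))
          refl) (update-skip (K + r) j≢V))
        (λ _ → refl) }
  compileInstr-correct (store a b) {s} {h} S = record
    { run = instr ⨾ instr
    ; time≤ = ≤-refl
    ; simulates = record
        { vars-≡  = λ i → trans (update-other (<⇒≢ (toℕ<n i))) (vars-≡ S i)
        ; sim-≡   = sim-≡ S
        ; inside  = inside′
        ; outside = λ j j∉ → trans (update-other (outside≢ j j∉)) (outside S j j∉)
        ; reg<    = reg< S
        ; mem<    = update< (mem< S) (reg s a) (reg< S b) } }
    where
    target : evalOp add w (reg h (K + a)) (reg h 2) ≡ W + reg s a
    target = trans (address S a 2F W-fits) (cong (_+ reg s a) vs-W)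
    inside′ : ∀ j → j < W →
              update (mem h) (evalOp add w (reg h (K + a)) (reg h 2)) (reg h (K + b)) (W + j) ≡
              update (mem s) (reg s a) (reg s b) j
    inside′ j j<W with j ≟ reg s a
    ... | yes refl rewrite target = trans (update-same (W + j)) (trans (sim-≡ S b) (sym (update-same j)))
    ... | no  j≢ rewrite target = trans (update-other (j≢ ∘ +-cancelˡ-≡ W j (reg s a)))
                                    (trans (inside S j j<W) (sym (update-other j≢)))
    outside≢ : ∀ j → j < W ⊎ W + W ≤ j → j ≢ evalOp add w (reg h (K + a)) (reg h 2)
    outside≢ j (inj₁ j<W) j≡ = <⇒≢ (<-≤-trans j<W (m≤m+n W (reg s a))) (trans j≡ target)
    outside≢ j (inj₂ ≤j)  j≡ = <⇒≢ (<-≤-trans (+-monoʳ-< W (reg< S a)) ≤j) (sym (trans j≡ target))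
  compileInstr-correct (input r a) {s} {h} S = record
    { run = instr ⨾ instr
    ; time≤ = ≤-refl
    ; simulates = sim-assign S r (mod2^< _ w₀)
        (λ j j≢V → trans (update-cong (K + r) j value refl) (update-skip (K + r) j≢V))
        (λ _ → refl) }
    where
    value : mem h (evalOp add w (reg h (K + a)) (reg h 3)) ≡ nth inp₀ (reg s a) mod2^ w₀
    value = begin
      _                       ≡⟨ cong (mem h) (address S a 3F base+W≤) ⟩
      mem h (base + reg s a)  ≡⟨ outside S _ (inj₂ (≤-trans W+W≤base (m≤m+n base _))) ⟩
      μ (base + reg s a)      ≡⟨ μ-input _ (reg< S a) ⟩
      _                       ∎
      where open ≡-Reasoning

  double-suc-+ : ∀ t u → suc (2 * t + 2 * u) ≤ 2 * suc (t + u)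
  double-suc-+ t u = begin
    suc (2 * t + 2 * u)   ≡⟨ cong suc (*-distribˡ-+ 2 t u) ⟨
    1 + 2 * (t + u)       ≤⟨ n≤1+n _ ⟩
    2 + 2 * (t + u)       ≡⟨ *-suc 2 (t + u) ⟨
    2 * suc (t + u)       ∎
    where open ≤-Reasoning

  suc-double : ∀ t → suc (2 * t) ≤ 2 * suc t
  suc-double t = ≤-trans (n≤1+n _) (≤-reflexive (sym (*-suc 2 t)))

  -- Two host steps for each simulated step suffice: every instruction becomes two, and the test of
  -- a branch or loop remains one.
  compile-correct : ∀ {p s s′ t} → Run w₀ inp₀ p s s′ t → ∀ {h} → Simulates s h → Outcome p h s′ (2 * t)
  compile-correct skip S = record { run = skip ; time≤ = z≤n ; simulates = S }
  compile-correct (instr {i}) S = compileInstr-correct i S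
  compile-correct (_⨾_ {t = t} {u} p q) S = record
    { run = P.run ⨾ Q.run
    ; time≤ = ≤-trans (+-mono-≤ P.time≤ Q.time≤) (≤-reflexive (sym (*-distribˡ-+ 2 t u)))
    ; simulates = Q.simulates }
    where
    module P = Outcome (compile-correct p S)
    module Q = Outcome (compile-correct q P.simulates)
  compile-correct (if-true {r = r} {t = t} r≢0 p) S = record
    { run = if-true (r≢0 ∘ trans (sym (sim-≡ S r))) P.run
    ; time≤ = ≤-trans (s≤s P.time≤) (suc-double t)
    ; simulates = P.simulates }
    where module P = Outcome (compile-correct p S)
  compile-correct (if-false {r = r} {t = t} r≡0 p) S = record
    { run = if-false (trans (sim-≡ S r) r≡0) P.run
    ; time≤ = ≤-trans (s≤s P.time≤) (suc-double t)
    ; simulates = P.simulates }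
    where module P = Outcome (compile-correct p S)
  compile-correct (while-true {r = r} {t = t} {u} r≢0 p q) S = record
    { run = while-true (r≢0 ∘ trans (sym (sim-≡ S r))) P.run Q.run
    ; time≤ = ≤-trans (s≤s (+-mono-≤ P.time≤ Q.time≤)) (double-suc-+ t u)
    ; simulates = Q.simulates }
    where
    module P = Outcome (compile-correct p S)
    module Q = Outcome (compile-correct q P.simulates)
  compile-correct (while-done {r = r} r≡0) S = record
    { run = while-done (trans (sim-≡ S r) r≡0) ; time≤ = s≤s z≤n ; simulates = S }

-- LZ78 factorizations from tries

module _ {A : Set} where

  prefix-++ : ∀ (xs ys : List A) → Prefix _≡_ xs (xs ++ ys)
  prefix-++ []       ys = []
  prefix-++ (x ∷ xs) ys = refl ∷ prefix-++ xs ys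

  prefix-nested : ∀ {xs ys zs : List A} → Prefix _≡_ xs zs → Prefix _≡_ ys zs →
                  length xs ≤ length ys → Prefix _≡_ xs ys
  prefix-nested []         ys≤        _       = []
  prefix-nested (refl ∷ p) (refl ∷ q) (s≤s l) = refl ∷ prefix-nested p q l

  prefix-∷ʳ : ∀ {xs : List A} ys {y} → Prefix _≡_ xs (ys ∷ʳ y) → Prefix _≡_ xs ys ⊎ xs ≡ ys ∷ʳ y
  prefix-∷ʳ []       []         = inj₁ []
  prefix-∷ʳ []       (refl ∷ []) = inj₂ refl
  prefix-∷ʳ (y ∷ ys) []         = inj₁ []
  prefix-∷ʳ (y ∷ ys) (refl ∷ p) with prefix-∷ʳ ys p
  ... | inj₁ q    = inj₁ (refl ∷ q)
  ... | inj₂ refl = inj₂ refl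

  prefix-[] : ∀ {xs : List A} → Prefix _≡_ xs [] → xs ≡ []
  prefix-[] [] = refl

  drop-lookup : ∀ {k} (xs : Vec (List A) k) i →
                concat (drop (toℕ i) (toList xs)) ≡ lookup xs i ++ concat (drop (suc (toℕ i)) (toList xs))
  drop-lookup (x ∷ xs) zero    = refl
  drop-lookup (x ∷ xs) (suc i) = drop-lookup xs i

  length-∷ʳ : ∀ (xs : List A) x → length (xs ∷ʳ x) ≡ suc (length xs)
  length-∷ʳ xs x = trans (length-++ xs) (+-comm (length xs) 1)

module _ {σ k : ℕ} (fs : Vec (List (Fin σ)) k) (pairs : Vec (Fin (suc k) × Fin σ) k)
  (earlier : ∀ i → toℕ (proj₁ (lookup pairs i)) ≤ toℕ i)
  (decodes : ∀ i → lookup fs i ≡ phrase fs (proj₁ (lookup pairs i)) ∷ʳ proj₂ (lookup pairs i))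
  (distinct : ∀ i j → lookup pairs i ≡ lookup pairs j → i ≡ j)
  where

  private
    parent : Fin k → Fin (suc k)
    parent i = proj₁ (lookup pairs i)

  -- Equal phrases end in the same symbol, and what precedes it are the equal phrases of their
  -- parents. These come earlier, so by induction the parents coincide; then so do the pairs, and
  -- `distinct` applies. The bound `b` makes the recursion structural.
  phrase-injective : ∀ i j → phrase fs i ≡ phrase fs j → i ≡ j
  phrase-injective i j = go (suc (toℕ i)) i j ≤-refl
    where
    []≢∷ʳ : ∀ (xs : List (Fin σ)) {x} → [] ≢ xs ∷ʳ x
    []≢∷ʳ []       ()
    []≢∷ʳ (x ∷ xs) ()
    go : ∀ b i j → toℕ i < b → phrase fs i ≡ phrase fs j → i ≡ j
    go (suc b) zero    zero    _ _  = refl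
    go (suc b) zero    (suc j) _ same = ⊥-elim ([]≢∷ʳ (phrase fs (parent j)) (trans same (decodes j)))
    go (suc b) (suc i) zero    _ same = ⊥-elim ([]≢∷ʳ (phrase fs (parent i)) (trans (sym same) (decodes i)))
    go (suc b) (suc i) (suc j) (s≤s i<b) same
      with ∷ʳ-injective (phrase fs (parent i)) (phrase fs (parent j))
             (trans (sym (decodes i)) (trans same (decodes j)))
    ... | same-prefix , same-char =
      cong suc (distinct i j (cong₂ _,_ (go b _ _ (≤-<-trans (earlier i) i<b) same-prefix) same-char))

  -- Removing the last symbol of a phrase leads to its parent, whose number is smaller.
  prefix-closed : ∀ j {u} → Prefix _≡_ u (phrase fs j) → ∃[ i ] toℕ i ≤ toℕ j × phrase fs i ≡ u
  prefix-closed j = go (suc (toℕ j)) j ≤-refl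
    where
    go : ∀ b j {u} → toℕ j < b → Prefix _≡_ u (phrase fs j) → ∃[ i ] toℕ i ≤ toℕ j × phrase fs i ≡ u
    go (suc b) zero    _         p = zero , z≤n , sym (prefix-[] p)
    go (suc b) (suc j) (s≤s j<b) p
      with prefix-∷ʳ (phrase fs (parent j)) (subst (Prefix _≡_ _) (decodes j) p)
    ... | inj₂ whole  = suc j , ≤-refl , trans (decodes j) (sym whole)
    ... | inj₁ proper with go b (parent j) (≤-<-trans (earlier j) j<b) proper
    ...   | i , i≤ , same = i , m≤n⇒m≤1+n (≤-trans i≤ (earlier j)) , same

  distinct⇒factorization : IsLZ78Factorization fs (concat (toList fs))
  distinct⇒factorization = record
    { factors   = refl
    ; candidate = λ i → record
        { prefix    = is-prefix i
        ; extension = parent i , proj₂ (lookup pairs i) , earlier i , decodes i }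
    ; longest   = longest′ }
    where
    is-prefix : ∀ i → Prefix _≡_ (lookup fs i) (remaining fs i)
    is-prefix i = subst (Prefix _≡_ (lookup fs i)) (sym (drop-lookup fs i)) (prefix-++ (lookup fs i) _)
    -- A longer candidate would contain the phrase as a prefix of an earlier one.
    longest′ : ∀ i u → Candidate fs i u → length u ≤ length (lookup fs i)
    longest′ i u cand with length u ≤? length (lookup fs i) | Candidate.extension cand
    ... | yes u≤ | _ = u≤
    ... | no  u≰ | j , c , j≤i , refl
      with prefix-closed j (prefix-nested (is-prefix i)
             (Prefix.trans trans (prefix-++ (phrase fs j) [ c ]) (Candidate.prefix cand))
             (≤-pred (≤-trans (≰⇒> u≰) (≤-reflexive (length-∷ʳ (phrase fs j) c)))))
    ... | i′ , i′≤j , same with phrase-injective i′ (suc i) same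
    -- Injectivity identifies `i′` with `suc i`, the number of the phrase under consideration,
    -- although `i′ ≤ j ≤ i`.
    ... | refl = contradiction (≤-trans i′≤j j≤i) 1+n≰n

-- Concatenated words, their lengths and their symbols

toList-tabulate : ∀ {A : Set} (f : ℕ → A) n → toList (tabulate {n = n} (f ∘ toℕ)) ≡ applyUpTo f n
toList-tabulate f zero    = refl
toList-tabulate f (suc n) = cong (f 0 ∷_) (toList-tabulate (f ∘ suc) n)

applyUpTo-+ : ∀ {A : Set} (f : ℕ → A) m n → applyUpTo f (m + n) ≡ applyUpTo f m ++ applyUpTo (λ i → f (m + i)) n
applyUpTo-+ f zero    n = refl
applyUpTo-+ f (suc m) n = cong (f 0 ∷_) (applyUpTo-+ (f ∘ suc) m n)

applyUpTo-cong : ∀ {A : Set} {f g : ℕ → A} n → (∀ {i} → i < n → f i ≡ g i) → applyUpTo f n ≡ applyUpTo g n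
applyUpTo-cong zero    f≗g = refl
applyUpTo-cong (suc n) f≗g = cong₂ _∷_ (f≗g (s≤s z≤n)) (applyUpTo-cong n (f≗g ∘ s≤s))

concat-applyUpTo-suc : ∀ {A : Set} (f : ℕ → List A) n → concat (applyUpTo f (suc n)) ≡ concat (applyUpTo f n) ++ f n
concat-applyUpTo-suc f n = begin
  concat (applyUpTo f (suc n))                ≡⟨ cong concat (applyUpTo-∷ʳ f n) ⟨
  concat (applyUpTo f n ∷ʳ f n)               ≡⟨ concat-++ (applyUpTo f n) (f n ∷ []) ⟨
  concat (applyUpTo f n) ++ (f n ++ [])       ≡⟨ cong (concat (applyUpTo f n) ++_) (++-identityʳ (f n)) ⟩
  concat (applyUpTo f n) ++ f n               ∎
  where open ≡-Reasoning

concat-applyUpTo-+ : ∀ {A : Set} (f : ℕ → List A) m n →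
                     concat (applyUpTo f (m + n)) ≡ concat (applyUpTo f m) ++ concat (applyUpTo (λ i → f (m + i)) n)
concat-applyUpTo-+ f m n = trans (cong concat (applyUpTo-+ f m n)) (sym (concat-++ (applyUpTo f m) _))

total : ∀ {A : Set} → (ℕ → List A) → ℕ → ℕ
total f n = length (concat (applyUpTo f n))

total-suc : ∀ {A : Set} (f : ℕ → List A) n → total f (suc n) ≡ total f n + length (f n)
total-suc f n = trans (cong length (concat-applyUpTo-suc f n)) (length-++ (concat (applyUpTo f n)))

total-const : ∀ {A : Set} (f : ℕ → List A) n {c} → (∀ {q} → q < n → length (f q) ≡ c) → total f n ≡ n * c
total-const f zero    _ = refl
total-const f (suc n) {c} lengths = begin
  total f (suc n)              ≡⟨ total-suc f n ⟩
  total f n + length (f n)     ≡⟨ cong₂ _+_ (total-const f n (lengths ∘ m≤n⇒m≤1+n)) (lengths ≤-refl) ⟩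
  n * c + c                    ≡⟨ +-comm (n * c) c ⟩
  c + n * c                    ∎
  where open ≡-Reasoning

total-+ : ∀ {A : Set} (f : ℕ → List A) m n → total f (m + n) ≡ total f m + total (λ i → f (m + i)) n
total-+ f m n = trans (cong length (concat-applyUpTo-+ f m n)) (length-++ (concat (applyUpTo f m)))

module _ {A : Set} where

  -- Occurrences are counted from 1, so those inside `ys` are the `i` with
  -- `length xs < i ≤ length xs + length ys`. The offsets of a block can therefore be used as the
  -- bounds of a query without correction.
  ∈⇒take-drop : ∀ {c : A} {ys} xs zs → c ∈ ys →
                ∃[ i ] length xs < i × i ≤ length xs + length ys × take 1 (drop (pred i) (xs ++ ys ++ zs)) ≡ c ∷ []
  ∈⇒take-drop []       zs (here refl) = 1 , s≤s z≤n , s≤s z≤n , refl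
  ∈⇒take-drop []       zs (there c∈) with ∈⇒take-drop [] zs c∈
  ... | suc i , _ , i≤ , found = suc (suc i) , s≤s z≤n , s≤s i≤ , found
  ∈⇒take-drop (x ∷ xs) zs c∈ with ∈⇒take-drop xs zs c∈
  ... | suc i , <i , i≤ , found = suc (suc i) , s≤s <i , s≤s i≤ , found

  take-drop⇒∈ : ∀ {c : A} xs ys {zs} i → length xs < i → i ≤ length xs + length ys →
                take 1 (drop (pred i) (xs ++ ys ++ zs)) ≡ c ∷ [] → c ∈ ys
  take-drop⇒∈ []       (y ∷ ys) (suc zero)    _        _        refl  = here refl
  take-drop⇒∈ []       (y ∷ ys) (suc (suc i)) _        (s≤s i≤) found =
    there (take-drop⇒∈ [] ys (suc i) (s≤s z≤n) i≤ found)
  take-drop⇒∈ (x ∷ xs) ys       (suc (suc i)) (s≤s <i) (s≤s i≤) found = take-drop⇒∈ xs ys (suc i) <i i≤ found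
  take-drop⇒∈ (x ∷ xs) ys       (suc zero)    (s≤s ()) _ _

module _ {σ N : ℕ} (T : Vec (Fin σ) N) (X Y Z : List (Fin σ)) {b e : ℕ} {c : Fin σ}
  (T≡ : toList T ≡ X ++ Y ++ Z) (b≡ : length X ≡ b) (e≡ : length X + length Y ≡ e) where

  ∈⇒occurs : c ∈ Y → OccursIn T (c ∷ []) b e
  ∈⇒occurs c∈ rewrite T≡ | sym b≡ | sym e≡ = ∈⇒take-drop X Z c∈

  occurs⇒∈ : OccursIn T (c ∷ []) b e → c ∈ Y
  occurs⇒∈ (i , b<i , i≤e , found) rewrite T≡ | sym b≡ | sym e≡ = take-drop⇒∈ X Y i b<i i≤e found

-- Passes from words counted from 0 to the numbering of phrases, in which 0 is the empty phrase.
prepend : {A : Set} → A → (ℕ → A) → ℕ → A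
prepend x f zero    = x
prepend x f (suc q) = f q

mod-small : ∀ {x n} .{{_ : NonZero n}} → x < n → toℕ (x mod n) ≡ x
mod-small {x} {n} x<n = trans (toℕ-fromℕ< (m%n<n x n)) (m<n⇒m%n≡m x<n)

-- Describes an LZ78 representation by functions on natural numbers. Position `q` belongs to phrase
-- `suc q`, whereas `parent` already uses the numbers of phrases; hence `parent q ≤ q` means
-- strictly earlier. Reducing modulo `σ` is a way to enter `Fin`, and the bounds on parents and
-- symbols make it harmless for the pairs.
module WordTrie
  (σ z : ℕ) {{σ≢0 : NonZero σ}} (words : ℕ → List ℕ) (parent char : ℕ → ℕ)
  (earlier : ∀ {q} → q < z → parent q ≤ q)
  (char< : ∀ {q} → q < z → char q < σ)
  (decodes : ∀ {q} → q < z → words q ≡ prepend [] words (parent q) ∷ʳ char q)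
  (distinct : ∀ {p q} → p < z → q < z → parent p ≡ parent q → char p ≡ char q → p ≡ q)
  where

  private
    fs : Vec (List (Fin σ)) z
    fs = tabulate (map (_mod σ) ∘ words ∘ toℕ)

    pair : ℕ → Fin (suc z) × Fin σ
    pair q = parent q mod suc z , char q mod σ

    pairs : Vec (Fin (suc z) × Fin σ) z
    pairs = tabulate (pair ∘ toℕ)

    pairs-lookup : ∀ i → lookup pairs i ≡ pair (toℕ i)
    pairs-lookup = lookup∘tabulate (pair ∘ toℕ)

    toℕ-parent : ∀ i → toℕ (proj₁ (lookup pairs i)) ≡ parent (toℕ i)
    toℕ-parent i rewrite pairs-lookup i =
      mod-small (s≤s (≤-trans (earlier (toℕ<n i)) (<⇒≤ (toℕ<n i))))

    toℕ-char : ∀ i → toℕ (proj₂ (lookup pairs i)) ≡ char (toℕ i)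
    toℕ-char i rewrite pairs-lookup i = mod-small (char< (toℕ<n i))

    phrase-words : ∀ j → phrase fs j ≡ map (_mod σ) (prepend [] words (toℕ j))
    phrase-words zero    = refl
    phrase-words (suc i) = lookup∘tabulate (map (_mod σ) ∘ words ∘ toℕ) i

    earlier′ : ∀ i → toℕ (proj₁ (lookup pairs i)) ≤ toℕ i
    earlier′ i = ≤-trans (≤-reflexive (toℕ-parent i)) (earlier (toℕ<n i))

    decodes′ : ∀ i → lookup fs i ≡ phrase fs (proj₁ (lookup pairs i)) ∷ʳ proj₂ (lookup pairs i)
    decodes′ i = begin
      lookup fs i
        ≡⟨ phrase-words (suc i) ⟩
      map (_mod σ) (words (toℕ i))
        ≡⟨ cong (map (_mod σ)) (decodes (toℕ<n i)) ⟩
      map (_mod σ) (prepend [] words (parent (toℕ i)) ∷ʳ char (toℕ i))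
        ≡⟨ map-++ (_mod σ) (prepend [] words (parent (toℕ i))) _ ⟩
      map (_mod σ) (prepend [] words (parent (toℕ i))) ∷ʳ char (toℕ i) mod σ
        ≡⟨ cong₂ (λ p c → map (_mod σ) (prepend [] words p) ∷ʳ c) (toℕ-parent i) (cong proj₂ (pairs-lookup i)) ⟨
      map (_mod σ) (prepend [] words (toℕ (proj₁ (lookup pairs i)))) ∷ʳ proj₂ (lookup pairs i)
        ≡⟨ cong (_∷ʳ proj₂ (lookup pairs i)) (phrase-words (proj₁ (lookup pairs i))) ⟨
      phrase fs (proj₁ (lookup pairs i)) ∷ʳ proj₂ (lookup pairs i) ∎
      where open ≡-Reasoning

    distinct′ : ∀ i j → lookup pairs i ≡ lookup pairs j → i ≡ j
    distinct′ i j same = toℕ-injective (distinct (toℕ<n i) (toℕ<n j)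
      (trans (sym (toℕ-parent i)) (trans (cong (toℕ ∘ proj₁) same) (toℕ-parent j)))
      (trans (sym (toℕ-char i)) (trans (cong (toℕ ∘ proj₂) same) (toℕ-char j))))

  text : List ℕ
  text = concat (applyUpTo words z)

  private
    concat-fs : concat (toList fs) ≡ map (_mod σ) text
    concat-fs = begin
      concat (toList fs)                                 ≡⟨ cong concat (toList-tabulate (map (_mod σ) ∘ words) z) ⟩
      concat (applyUpTo (map (_mod σ) ∘ words) z)        ≡⟨ cong concat (map-applyUpTo words (map (_mod σ)) z) ⟨
      concat (map (map (_mod σ)) (applyUpTo words z))    ≡⟨ concat-map (applyUpTo words z) ⟩
      map (_mod σ) text                                  ∎
      where open ≡-Reasoning

  -- `T` is general up to an equality because it will be the list of a vector whose length had to be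
  -- cast.
  representation : ∀ {T} → map (_mod σ) text ≡ T → LZ78Representation T
  representation text≡T = record
    { z₇₈           = z
    ; phrases       = fs
    ; factorization = subst (IsLZ78Factorization fs) (trans concat-fs text≡T)
                        (distinct⇒factorization fs pairs earlier′ decodes′ distinct′)
    ; pairs         = pairs
    ; earlier       = earlier′
    ; decodes       = decodes′ }

  pairWords-representation : ∀ {T} (text≡T : map (_mod σ) text ≡ T) →
    pairWords (representation text≡T) ≡ concat (applyUpTo (λ q → parent q ∷ suc (char q) ∷ []) z)
  pairWords-representation _ = cong concat (begin
    map _ (toList pairs)                                       ≡⟨ cong (map _) (toList-tabulate pair z) ⟩
    map _ (applyUpTo pair z)                                   ≡⟨ map-applyUpTo pair _ z ⟩
    applyUpTo _ z                                              ≡⟨ applyUpTo-cong z (λ q<z →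
      cong₂ (λ p c → p ∷ suc c ∷ [])
        (mod-small (s≤s (≤-trans (earlier q<z) (<⇒≤ q<z)))) (mod-small (char< q<z))) ⟩
    applyUpTo (λ q → parent q ∷ suc (char q) ∷ []) z           ∎)
    where open ≡-Reasoning

-- The string

glue : {A : Set} → ℕ → (ℕ → A) → (ℕ → A) → ℕ → A
glue zero    f g q       = g q
glue (suc m) f g zero    = f 0
glue (suc m) f g (suc q) = glue m (f ∘ suc) g q

module _ {A : Set} where

  glue-left : ∀ {m} {f g : ℕ → A} {q} → q < m → glue m f g q ≡ f q
  glue-left {suc m} {q = zero}  _         = refl
  glue-left {suc m} {q = suc q} (s≤s q<m) = glue-left q<m

  glue-right : ∀ m {f g : ℕ → A} q → glue m f g (m + q) ≡ g q
  glue-right zero    q = refl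
  glue-right (suc m) q = glue-right m q

data Split (m k : ℕ) : ℕ → Set where
  left  : ∀ {q} → q < m → Split m k q
  right : ∀ q → q < k → Split m k (m + q)

split : ∀ m {k q} → q < m + k → Split m k q
split zero    {q = q}     q<  = right q q<
split (suc m) {q = zero}  _   = left (s≤s z≤n)
split (suc m) {q = suc q} (s≤s q<) with split m q<
... | left q<m   = left (s≤s q<m)
... | right q q<k = right q q<k

/-quotient : ∀ k {m t} .{{_ : NonZero m}} → t < m → (k * m + t) / m ≡ k
/-quotient k {m} {t} t<m = begin
  (k * m + t) / m          ≡⟨ +-distrib-/-∣ˡ t (n∣m*n k) ⟩
  k * m / m + t / m        ≡⟨ cong₂ _+_ (m*n/n≡m k m) (m<n⇒m/n≡0 t<m) ⟩
  k + 0                    ≡⟨ +-identityʳ k ⟩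
  k                        ∎
  where open ≡-Reasoning

%-remainder : ∀ k {m t} .{{_ : NonZero m}} → t < m → (k * m + t) % m ≡ t
%-remainder k {m} {t} t<m = begin
  (k * m + t) % m          ≡⟨ cong (_% m) (+-comm (k * m) t) ⟩
  (t + k * m) % m          ≡⟨ [m+kn]%n≡m%n t k m ⟩
  t % m                    ≡⟨ m<n⇒m%n≡m t<m ⟩
  t                        ∎
  where open ≡-Reasoning

choose≡ : ∀ v {x y z} → choose v x y ≡ z → (v ≢ 0 × x ≡ z) ⊎ (v ≡ 0 × y ≡ z)
choose≡ zero    e = inj₂ (refl , e)
choose≡ (suc v) e = inj₁ ((λ ()) , e)

choose-nonzero : ∀ {v x y} → v ≢ 0 → choose v x y ≡ x
choose-nonzero {zero}  v≢0 = contradiction refl v≢0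
choose-nonzero {suc v} _   = refl

tri : ℕ → ℕ
tri zero    = 0
tri (suc l) = tri l + suc l

tri+tri : ∀ l → tri l + tri l ≡ l * suc l
tri+tri zero    = refl
tri+tri (suc l) = begin
  tri l + suc l + (tri l + suc l)     ≡⟨ +-*-Solver.solve 2 (λ t l → t :+ l :+ (t :+ l) := t :+ t :+ (l :+ l)) refl (tri l) (suc l) ⟩
  tri l + tri l + (suc l + suc l)     ≡⟨ cong (_+ (suc l + suc l)) (tri+tri l) ⟩
  l * suc l + (suc l + suc l)         ≡⟨ +-*-Solver.solve 1 (λ l → l :* (con 1 :+ l) :+ (con 1 :+ l :+ (con 1 :+ l)) := (con 1 :+ l) :* (con 2 :+ l)) refl l ⟩
  suc l * suc (suc l)                 ∎
  where
  open ≡-Reasoning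
  open +-*-Solver using (_:+_; _:*_; _:=_; con)

-- a and b list the entries of A and B in row-major order.  The symbol n stands
-- for a zero entry and 1 + n + k starts row k; rows k ≥ n are all-zero.
module Encoding (n r : ℕ) {{n≢0 : NonZero n}} {{r≢0 : NonZero r}} (a b : ℕ → ℕ)
  (b-zero : ∀ x → n * n ≤ x → b x ≡ 0) where

  -- A row takes `m` phrases, one for its start symbol and one for each entry. Their lengths 1, ...,
  -- `m` add up to a triangular number; the even number `2 * r` of rows cancels the factor one half,
  -- so that `rowsLength` is a polynomial in `n` and `r`.
  m rowsSize size blockLength rowsLength textLength : ℕ
  m = suc n
  rowsSize = 2 * r * m
  size = rowsSize + n * n
  blockLength = n * (2 + n)
  rowsLength = r * (m * (2 + n))
  textLength = rowsLength + n * blockLength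

  -- The symbol at position 0 is private to row `k`. Without it, rows that begin alike would lead to
  -- the same pairs.
  rowChar : ℕ → ℕ → ℕ
  rowChar k zero    = 1 + n + k
  rowChar k (suc t) = choose (b (k * n + t)) t n

  -- Row `n` is the first one beyond the matrix and therefore all-zero. Repeating it where `A` has a
  -- zero keeps all block phrases equally long.
  target : ℕ → ℕ
  target q = choose (a q) (q % n) n

  -- Since phrase numbers exceed positions by one, `q` is the number of the phrase just before
  -- position `q`, and `suc (target q) * m` is that of the complete row `target q`. The block
  -- symbols begin after the `n` columns, the symbol for zero and the `2 * r` row markers.
  rowParent rowSymbol blockParent blockSymbol parent char : ℕ → ℕ
  rowParent q = choose (q % m) q 0
  rowSymbol q = rowChar (q / m) (q % m)
  blockParent q = suc (target q) * m
  blockSymbol q = 1 + n + 2 * r + q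
  parent = glue rowsSize rowParent blockParent
  char = glue rowsSize rowSymbol blockSymbol

  row : ℕ → ℕ → List ℕ
  row k = applyUpTo (rowChar k)

  rowWord blockWord words : ℕ → List ℕ
  rowWord q = row (q / m) (suc (q % m))
  blockWord q = row (target q) m ∷ʳ blockSymbol q
  words = glue rowsSize rowWord blockWord

  1≤r : 1 ≤ r
  1≤r = >-nonZero⁻¹ r

  1≤n : 1 ≤ n
  1≤n = >-nonZero⁻¹ n

  -- Ensures that the all-zero row `n` is among the `2 * r` rows.
  n<2r⇒ : n ≤ r → suc n ≤ 2 * r
  n<2r⇒ n≤r = begin
    1 + n   ≤⟨ +-mono-≤ 1≤r n≤r ⟩
    r + r   ≡⟨ cong (r +_) (+-identityʳ r) ⟨
    2 * r   ∎
    where open ≤-Reasoning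

  target≤n : ∀ q → target q ≤ n
  target≤n q with a q
  ... | zero  = ≤-refl
  ... | suc _ = <⇒≤ (m%n<n q n)

  divmod : ∀ q → q ≡ q / m * m + q % m
  divmod q = trans (m≡m%n+[m/n]*n q m) (+-comm (q % m) _)

  module _ (n≤r : n ≤ r) where

    target-row : ∀ q → suc (target q) * m ≤ rowsSize
    target-row q = *-monoˡ-≤ m (≤-trans (s≤s (target≤n q)) (n<2r⇒ n≤r))

    parent-earlier : ∀ {q} → q < size → parent q ≤ q
    parent-earlier q< with split rowsSize q<
    ... | left {q} q<rows rewrite glue-left {f = rowParent} {g = blockParent} q<rows with q % m
    ...   | zero  = z≤n
    ...   | suc _ = ≤-refl
    parent-earlier q< | right q _ rewrite glue-right rowsSize {f = rowParent} {g = blockParent} q =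
      ≤-trans (target-row q) (m≤m+n rowsSize q)

    rowChar< : ∀ {k} t → k < 2 * r → t < m → rowChar k t < 1 + n + 2 * r
    rowChar< zero    k<  _ = +-monoʳ-< (1 + n) k<
    rowChar< {k} (suc t) _ (s≤s t<n) with b (k * n + t)
    ... | zero  = m≤m+n (1 + n) (2 * r)
    ... | suc _ = <-≤-trans (<-trans t<n (n<1+n n)) (m≤m+n (1 + n) (2 * r))

    rowSymbol< : ∀ {q} → q < rowsSize → rowSymbol q < 1 + n + 2 * r
    rowSymbol< {q} q< = rowChar< (q % m) (m<n*o⇒m/o<n {q} {2 * r} {m} q<) (m%n<n q m)

    char<sum : ∀ {q} → q < size → char q < 1 + n + 2 * r + n * n
    char<sum q< with split rowsSize q<
    ... | left {q} q<rows rewrite glue-left {f = rowSymbol} {g = blockSymbol} q<rows =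
      <-≤-trans (rowSymbol< q<rows) (m≤m+n _ _)
    ... | right q q<nn rewrite glue-right rowsSize {f = rowSymbol} {g = blockSymbol} q =
      +-monoʳ-< (1 + n + 2 * r) q<nn

    row-end : ∀ k → rowWord (k * m + n) ≡ row k m
    row-end k rewrite /-quotient k {m} (n<1+n n) | %-remainder k {m} (n<1+n n) = refl

    row-decodes : ∀ {q} → q < rowsSize → rowWord q ≡ prepend [] words (rowParent q) ∷ʳ rowSymbol q
    row-decodes {q} q< with q / m | q % m | m%n<n q m | divmod q
    ... | k | zero  | _   | _    = refl
    ... | k | suc t | t<m | refl = trans (sym (applyUpTo-∷ʳ (rowChar k) (suc t))) (cong (_∷ʳ rowChar k (suc t)) (sym before))
      where
      before : prepend [] words (k * m + suc t) ≡ row k (suc t)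
      before rewrite +-suc (k * m) t
        | glue-left {f = rowWord} {g = blockWord} (<-trans (n<1+n (k * m + t)) q<)
        | /-quotient k {m} (<-trans (n<1+n t) t<m)
        | %-remainder k {m} (<-trans (n<1+n t) t<m) = refl

    block-decodes : ∀ q → blockWord q ≡ prepend [] words (blockParent q) ∷ʳ blockSymbol q
    block-decodes q = cong (_∷ʳ blockSymbol q) (sym (begin
      words (n + target q * m)       ≡⟨ cong words (+-comm n (target q * m)) ⟩
      words (target q * m + n)       ≡⟨ glue-left {f = rowWord} {g = blockWord} (≤-trans
                                          (≤-reflexive (trans (cong suc (+-comm (target q * m) n)) refl))
                                          (target-row q)) ⟩
      rowWord (target q * m + n)     ≡⟨ row-end (target q) ⟩
      row (target q) m               ∎))
      where open ≡-Reasoning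

    words-decode : ∀ {q} → q < size → words q ≡ prepend [] words (parent q) ∷ʳ char q
    words-decode q< with split rowsSize q<
    ... | left {q} q<rows
      rewrite glue-left {f = rowParent} {g = blockParent} q<rows
            | glue-left {f = rowSymbol} {g = blockSymbol} q<rows
            = trans (glue-left {f = rowWord} {g = blockWord} q<rows) (row-decodes q<rows)
    ... | right q _
      rewrite glue-right rowsSize {f = rowParent} {g = blockParent} q
            | glue-right rowsSize {f = rowSymbol} {g = blockSymbol} q
            = trans (glue-right rowsSize {f = rowWord} {g = blockWord} q) (block-decodes q)

    -- A nonzero parent is the position itself. Phrases with parent 0 are row starts, and these
    -- differ in their markers.
    row-distinct : ∀ {p q} → rowParent p ≡ rowParent q → rowSymbol p ≡ rowSymbol q → p ≡ q
    row-distinct {p} {q} parents symbols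
      with p / m | p % m | divmod p | q / m | q % m | divmod q
    ... | k | zero  | p≡   | l | zero  | q≡   =
      trans p≡ (trans (cong (λ k → k * m + 0) (+-cancelˡ-≡ (1 + n) k l symbols)) (sym q≡))
    ... | k | suc s | p≡   | l | suc t | q≡   = parents
    ... | k | zero  | p≡   | l | suc t | q≡   = contradiction (trans (sym (+-suc (l * m) t)) (trans (sym q≡) (sym parents))) λ ()
    ... | k | suc s | p≡   | l | zero  | q≡   = contradiction (trans (sym (+-suc (k * m) s)) (trans (sym p≡) parents)) λ ()

    -- Block symbols never repeat and exceed all symbols used in rows, so the parents matter only
    -- for two row phrases.
    pairs-distinct : ∀ {p q} → p < size → q < size → parent p ≡ parent q → char p ≡ char q → p ≡ q
    pairs-distinct p< q< parents chars with split rowsSize p< | split rowsSize q<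
    ... | left p<rows | left q<rows
      rewrite glue-left {f = rowParent} {g = blockParent} p<rows | glue-left {f = rowParent} {g = blockParent} q<rows
            | glue-left {f = rowSymbol} {g = blockSymbol} p<rows | glue-left {f = rowSymbol} {g = blockSymbol} q<rows
            = row-distinct parents chars
    ... | right p _ | right q _
      rewrite glue-right rowsSize {f = rowSymbol} {g = blockSymbol} p
            | glue-right rowsSize {f = rowSymbol} {g = blockSymbol} q
            = cong (rowsSize +_) (+-cancelˡ-≡ (1 + n + 2 * r) p q chars)
    ... | left p<rows | right q _
      rewrite glue-left {f = rowSymbol} {g = blockSymbol} p<rows
            | glue-right rowsSize {f = rowSymbol} {g = blockSymbol} q
            = contradiction chars (<⇒≢ (<-≤-trans (rowSymbol< p<rows) (m≤m+n _ q)))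
    ... | right p _ | left q<rows
      rewrite glue-left {f = rowSymbol} {g = blockSymbol} q<rows
            | glue-right rowsSize {f = rowSymbol} {g = blockSymbol} p
            = contradiction (sym chars) (<⇒≢ (<-≤-trans (rowSymbol< q<rows) (m≤m+n _ p)))

  total-row : ∀ k t → t ≤ m → total rowWord (k * m + t) ≡ k * tri m + tri t
  total-row zero    zero    _   = refl
  total-row (suc k) zero    _   = begin
    total rowWord (m + k * m + 0)    ≡⟨ cong (total rowWord) (trans (+-identityʳ _) (+-comm m (k * m))) ⟩
    total rowWord (k * m + m)        ≡⟨ total-row k m ≤-refl ⟩
    k * tri m + tri m                ≡⟨ trans (+-comm _ (tri m)) (sym (+-identityʳ _)) ⟩
    tri m + k * tri m + 0            ∎
    where open ≡-Reasoning
  total-row k       (suc t) t<m = begin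
    total rowWord (k * m + suc t)                          ≡⟨ cong (total rowWord) (+-suc (k * m) t) ⟩
    total rowWord (suc (k * m + t))                        ≡⟨ total-suc rowWord (k * m + t) ⟩
    total rowWord (k * m + t) + length (rowWord (k * m + t))
      ≡⟨ cong₂ _+_ (total-row k t (<⇒≤ t<m))
           (trans (length-applyUpTo (rowChar ((k * m + t) / m)) (suc ((k * m + t) % m))) (cong suc (%-remainder k t<m))) ⟩
    k * tri m + tri t + suc t                              ≡⟨ +-assoc (k * tri m) (tri t) (suc t) ⟩
    k * tri m + tri (suc t)                                ∎
    where open ≡-Reasoning

  total-rows : total words rowsSize ≡ rowsLength
  total-rows = begin
    total words rowsSize             ≡⟨ cong (length ∘ concat) (applyUpTo-cong rowsSize glue-left) ⟩
    total rowWord (2 * r * m)        ≡⟨ cong (total rowWord) (+-identityʳ (2 * r * m)) ⟨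
    total rowWord (2 * r * m + 0)    ≡⟨ total-row (2 * r) 0 z≤n ⟩
    2 * r * tri m + 0                ≡⟨ solve 2 (λ r t → con 2 :* r :* t :+ con 0 := r :* (t :+ t)) refl r (tri m) ⟩
    r * (tri m + tri m)              ≡⟨ cong (r *_) (tri+tri m) ⟩
    rowsLength                       ∎
    where
    open ≡-Reasoning
    open +-*-Solver using (solve; _:+_; _:*_; _:=_; con)

  length-blockWord : ∀ q → length (blockWord q) ≡ 2 + n
  length-blockWord q = trans (length-∷ʳ (row (target q) m) _) (cong suc (length-applyUpTo (rowChar (target q)) m))

  total-blocks : ∀ s l → total (λ q → words (rowsSize + s + q)) l ≡ l * (2 + n)
  total-blocks s l = total-const _ l (λ {q} _ → trans (cong length (words-block s q)) (length-blockWord (s + q)))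
    where
    words-block : ∀ s q → words (rowsSize + s + q) ≡ blockWord (s + q)
    words-block s q = trans (cong words (+-assoc rowsSize s q)) (glue-right rowsSize (s + q))

  total-before : ∀ s → total words (rowsSize + s) ≡ rowsLength + s * (2 + n)
  total-before s = trans (total-+ words rowsSize s) (cong₂ _+_ total-rows
    (trans (cong (length ∘ concat) (applyUpTo-cong s (λ {q} _ → cong (λ z → words (z + q)) (sym (+-identityʳ rowsSize)))))
           (total-blocks 0 s)))

  total-words : total words size ≡ textLength
  total-words = trans (total-before (n * n)) (cong (rowsLength +_) (*-assoc n n (2 + n)))

  size≤textLength : size ≤ textLength
  size≤textLength = +-mono-≤
    (≤-trans (≤-reflexive (solve 2 (λ r m → con 2 :* r :* m := r :* (m :* con 2)) refl r m))
             (*-monoʳ-≤ r (*-monoʳ-≤ m (m≤m+n 2 n))))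
    (*-monoʳ-≤ n (m≤m*n n (2 + n)))
    where open +-*-Solver using (solve; _:+_; _:*_; _:=_; con)

  module Text (n≤r : n ≤ r) where

    -- This is what allows the alphabet to have size `textLength`: it has room for every symbol that
    -- occurs.
    symbols≤textLength : 1 + n + 2 * r + n * n ≤ textLength
    symbols≤textLength = +-mono-≤
      (begin
        1 + n + 2 * r          ≤⟨ +-monoˡ-≤ (2 * r) (n<2r⇒ n≤r) ⟩
        2 * r + 2 * r          ≡⟨ solve 1 (λ r → con 2 :* r :+ con 2 :* r := r :* con 4) refl r ⟩
        r * 4                  ≤⟨ *-monoʳ-≤ r (*-mono-≤ {2} {m} {2} (s≤s 1≤n) (m≤m+n 2 n)) ⟩
        r * (m * (2 + n))      ∎)
      (*-monoʳ-≤ n (m≤m*n n (2 + n)))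
      where
      open ≤-Reasoning
      open +-*-Solver using (solve; _:+_; _:*_; _:=_; con)

    char< : ∀ {q} → q < size → char q < textLength
    char< q< = <-≤-trans (char<sum n≤r q<) symbols≤textLength

    instance
      textLength≢0 : NonZero textLength
      textLength≢0 = >-nonZero (≤-trans (s≤s z≤n) symbols≤textLength)

    open WordTrie textLength size words parent char
      (parent-earlier n≤r) char< (words-decode n≤r) (pairs-distinct n≤r) public

    length-text : length (map (_mod textLength) text) ≡ textLength
    length-text = trans (length-map _ text) total-words

    T : Vec (Fin textLength) textLength
    T = Vec.cast length-text (fromList (map (_mod textLength) text))

    toList-T : map (_mod textLength) text ≡ toList T
    toList-T = sym (trans (toList-cast length-text _) (toList∘fromList _))

    R : LZ78Representation (toList T)
    R = representation toList-T

    pairWords-R : pairWords R ≡ concat (applyUpTo (λ q → parent q ∷ suc (char q) ∷ []) size)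
    pairWords-R = pairWords-representation toList-T

    module Block (i : ℕ) (i<n : i < n) where

      start : ℕ
      start = rowsSize + i * n

      before block after : List ℕ
      before = concat (applyUpTo words start)
      block  = concat (applyUpTo (λ k → words (start + k)) n)
      after  = concat (applyUpTo (λ q → words (start + n + q)) (n * n ∸ (i * n + n)))

      text-split : text ≡ before ++ block ++ after
      text-split = begin
        concat (applyUpTo words size)                      ≡⟨ cong (concat ∘ applyUpTo words) size≡ ⟩
        concat (applyUpTo words (start + (n + rest)))      ≡⟨ concat-applyUpTo-+ words start (n + rest) ⟩
        before ++ concat (applyUpTo (λ k → words (start + k)) (n + rest))
          ≡⟨ cong (before ++_) (concat-applyUpTo-+ (λ k → words (start + k)) n rest) ⟩
        before ++ block ++ concat (applyUpTo (λ q → words (start + (n + q))) rest)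
          ≡⟨ cong (λ z → before ++ block ++ concat z)
               (applyUpTo-cong rest (λ {q} _ → cong words (sym (+-assoc start n q)))) ⟩
        before ++ block ++ after                           ∎
        where
        open ≡-Reasoning
        rest = n * n ∸ (i * n + n)
        size≡ : size ≡ start + (n + rest)
        size≡ = begin
          rowsSize + n * n                         ≡⟨ cong (rowsSize +_) (m+[n∸m]≡n (≤-trans (≤-reflexive (+-comm (i * n) n)) (*-monoˡ-≤ n i<n))) ⟨
          rowsSize + (i * n + n + rest)            ≡⟨ cong (rowsSize +_) (+-assoc (i * n) n rest) ⟩
          rowsSize + (i * n + (n + rest))          ≡⟨ +-assoc rowsSize (i * n) (n + rest) ⟨
          start + (n + rest)                       ∎

      length-before : length before ≡ rowsLength + i * blockLength
      length-before = trans (total-before (i * n)) (cong (rowsLength +_) (*-assoc i n (2 + n)))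

      length-block : length block ≡ blockLength
      length-block = total-blocks (i * n) n

      -- A witness for entry `i`, `j` of the product, in terms of the numeric entry lists.
      Hit : ℕ → Set
      Hit j = ∃[ k ] k < n × a (i * n + k) ≢ 0 × b (k * n + j) ≢ 0

      word-at : ∀ k → words (start + k) ≡ blockWord (i * n + k)
      word-at k = trans (cong words (+-assoc rowsSize (i * n) k)) (glue-right rowsSize (i * n + k))

      target-hit : ∀ {k} → k < n → a (i * n + k) ≢ 0 → target (i * n + k) ≡ k
      target-hit k<n a≢0 = trans (choose-nonzero a≢0) (%-remainder i k<n)

      hit⇒∈ : ∀ {j} → j < n → Hit j → j ∈ block
      hit⇒∈ {j} j<n (k , k<n , a≢0 , b≢0) = ∈-concat⁺′ j∈word (∈-applyUpTo⁺ (λ k → words (start + k)) k<n)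
        where
        spelled : rowChar (target (i * n + k)) (suc j) ≡ j
        spelled rewrite target-hit k<n a≢0 = choose-nonzero b≢0
        j∈word : j ∈ words (start + k)
        j∈word rewrite word-at k =
          ∈-++⁺ˡ (subst (_∈ row (target (i * n + k)) m) spelled
                   (∈-applyUpTo⁺ (rowChar (target (i * n + k))) (s≤s j<n)))

      -- Zero entries, row markers and fresh symbols are all at least `n`, so a symbol `j < n` must
      -- spell a one of a repeated row. That row cannot be row `n`, which has no ones.
      ∈⇒hit : ∀ {j} → j < n → j ∈ block → Hit j
      ∈⇒hit {j} j<n j∈ with ∈-concat⁻′ (applyUpTo (λ k → words (start + k)) n) j∈
      ... | word , j∈word , word∈ with ∈-applyUpTo⁻ (λ k → words (start + k)) word∈
      ... | k , k<n , refl with ∈-++⁻ (row (target (i * n + k)) m) (subst (j ∈_) (word-at k) j∈word)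
      ... | inj₂ (here j≡) =
        contradiction j≡ (<⇒≢ (<-≤-trans j<n (≤-trans (n≤1+n n) (≤-trans (m≤m+n (1 + n) (2 * r)) (m≤m+n _ _)))))
      ... | inj₁ j∈row with ∈-applyUpTo⁻ (rowChar (target (i * n + k))) j∈row
      ... | zero  , _ , j≡ = contradiction j≡ (<⇒≢ (<-≤-trans j<n (≤-trans (n≤1+n n) (m≤m+n (1 + n) _))))
      ... | suc t , _ , j≡ with choose≡ (b (target (i * n + k) * n + t)) (sym j≡)
      ... | inj₂ (_ , n≡j) = contradiction (sym n≡j) (<⇒≢ j<n)
      ... | inj₁ (b≢0 , refl) with choose≡ (a (i * n + k)) {x = (i * n + k) % n} {y = n} refl
      ... | inj₁ (a≢0 , _) = k , k<n , a≢0 , subst (λ k → b (k * n + t) ≢ 0) (target-hit k<n a≢0) b≢0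
      -- Here `target` selected row `n`, whose entries would lie at positions from `n * n` on.
      ... | inj₂ (_ , n≡)  = contradiction (b-zero _ (≤-trans (≤-reflexive (cong (_* n) n≡)) (m≤m+n _ t))) b≢0

      block< : ∀ {c} → c ∈ block → c < textLength
      block< c∈ with ∈-concat⁻′ (applyUpTo (λ k → words (start + k)) n) c∈
      ... | word , c∈word , word∈ with ∈-applyUpTo⁻ (λ k → words (start + k)) word∈
      ... | k , k<n , refl with ∈-++⁻ (row (target (i * n + k)) m) (subst (_ ∈_) (word-at k) c∈word)
      ... | inj₁ c∈row with ∈-applyUpTo⁻ (rowChar (target (i * n + k))) c∈row
      ... | t , t<m , refl = <-≤-trans
        (rowChar< n≤r {target (i * n + k)} t (≤-trans (s≤s (target≤n _)) (n<2r⇒ n≤r)) t<m)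
        (≤-trans (m≤m+n _ (n * n)) symbols≤textLength)
      block< c∈ | word , c∈word , word∈ | k , k<n , refl | inj₂ (here refl) =
        <-≤-trans (+-monoʳ-< (1 + n + 2 * r)
          (<-≤-trans (+-monoʳ-< (i * n) k<n) (≤-trans (≤-reflexive (+-comm (i * n) n)) (*-monoˡ-≤ n i<n))))
          symbols≤textLength

      toList-T-split : toList T ≡ map (_mod textLength) before ++ map (_mod textLength) block ++ map (_mod textLength) after
      toList-T-split = begin
        toList T                                    ≡⟨ toList-T ⟨
        map (_mod textLength) text                  ≡⟨ cong (map (_mod textLength)) text-split ⟩
        map (_mod textLength) (before ++ block ++ after)
          ≡⟨ map-++ (_mod textLength) before (block ++ after) ⟩
        map (_mod textLength) before ++ map (_mod textLength) (block ++ after)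
          ≡⟨ cong (map (_mod textLength) before ++_) (map-++ (_mod textLength) block after) ⟩
        _ ∎
        where open ≡-Reasoning

      from to : ℕ
      from = rowsLength + i * blockLength
      to   = from + blockLength

      mapped-before : length (map (_mod textLength) before) ≡ from
      mapped-before = trans (length-map _ before) length-before

      mapped-to : length (map (_mod textLength) before) + length (map (_mod textLength) block) ≡ to
      mapped-to = cong₂ _+_ mapped-before (trans (length-map _ block) length-block)

      pattern₁ : ℕ → Vec (Fin textLength) 1
      pattern₁ j = (j mod textLength) ∷ []

      private
        Xs = map (_mod textLength) before
        Ys = map (_mod textLength) block
        Zs = map (_mod textLength) after

      hit⇒occurs : ∀ {j} → j < n → Hit j → OccursIn T (pattern₁ j) from to
      hit⇒occurs j<n hit = ∈⇒occurs T Xs Ys Zs toList-T-split mapped-before mapped-to (∈-map⁺ (_mod textLength) (hit⇒∈ j<n hit))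

      -- The text was reduced modulo `textLength`; as all symbols involved are smaller, the
      -- reduction has merged none of them.
      occurs⇒hit : ∀ {j} → j < n → OccursIn T (pattern₁ j) from to → Hit j
      occurs⇒hit {j} j<n occurs = ∈⇒hit j<n (unmap (∈-map⁻ (_mod textLength)
        (occurs⇒∈ T Xs Ys Zs toList-T-split mapped-before mapped-to occurs)))
        where
        j< : j < textLength
        j< = <-≤-trans j<n (≤-trans (≤-trans (n≤1+n n) (≤-trans (m≤m+n _ (2 * r)) (m≤m+n _ (n * n)))) symbols≤textLength)
        unmap : ∃[ c ] c ∈ block × j mod textLength ≡ c mod textLength → j ∈ block
        unmap (c , c∈ , same) = subst (_∈ block)
          (sym (trans (sym (mod-small j<)) (trans (cong toℕ same) (mod-small (block< c∈))))) c∈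

      to≤ : to ≤ textLength
      to≤ = begin
        rowsLength + i * blockLength + blockLength    ≡⟨ +-assoc rowsLength _ _ ⟩
        rowsLength + (i * blockLength + blockLength)  ≡⟨ cong (rowsLength +_) (+-comm (i * blockLength) blockLength) ⟩
        rowsLength + suc i * blockLength              ≤⟨ +-monoʳ-≤ rowsLength (*-monoˡ-≤ blockLength i<n) ⟩
        textLength                                    ∎
        where open ≤-Reasoning

-- Boolean matrices

nth-++ˡ : ∀ xs {ys i} → i < length xs → nth (xs ++ ys) i ≡ nth xs i
nth-++ˡ (x ∷ xs) {i = zero}  _         = refl
nth-++ˡ (x ∷ xs) {i = suc i} (s≤s i<l) = nth-++ˡ xs i<l

nth-++ʳ : ∀ xs {ys} i → nth (xs ++ ys) (length xs + i) ≡ nth ys i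
nth-++ʳ []       i = refl
nth-++ʳ (x ∷ xs) i = nth-++ʳ xs i

nth-beyond : ∀ xs {i} → length xs ≤ i → nth xs i ≡ 0
nth-beyond []       _             = refl
nth-beyond (x ∷ xs) {suc i} (s≤s l≤i) = nth-beyond xs l≤i

nth-∷ʳ : ∀ xs v i → update (nth xs) (length xs) v i ≡ nth (xs ∷ʳ v) i
nth-∷ʳ []       v zero    = refl
nth-∷ʳ []       v (suc i) = refl
nth-∷ʳ (x ∷ xs) v zero    = refl
nth-∷ʳ (x ∷ xs) v (suc i) = nth-∷ʳ xs v i

update-shift : ∀ f m i v j → update f (m + i) v (m + j) ≡ update (λ x → f (m + x)) i v j
update-shift f zero    i v j = refl
update-shift f (suc m) i v j = update-shift (f ∘ suc) m i v j

nth-++≤ : ∀ {c} xs {ys} → (∀ x → nth xs x ≤ c) → (∀ x → nth ys x ≤ c) → ∀ x → nth (xs ++ ys) x ≤ c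
nth-++≤ []       p q x       = q x
nth-++≤ (_ ∷ xs) p q zero    = p 0
nth-++≤ (_ ∷ xs) p q (suc x) = nth-++≤ xs (p ∘ suc) q x

nth-tabulate : ∀ {n} (f : Fin n → ℕ) j → nth (List.tabulate f) (toℕ j) ≡ f j
nth-tabulate f zero    = refl
nth-tabulate f (suc j) = nth-tabulate (f ∘ suc) j

module _ {c : ℕ} where

  length-concat-tabulate : ∀ {p} (F : Fin p → List ℕ) → (∀ i → length (F i) ≡ c) →
                           length (concat (List.tabulate F)) ≡ p * c
  length-concat-tabulate {zero}  F _       = refl
  length-concat-tabulate {suc p} F lengths = trans (length-++ (F zero))
    (cong₂ _+_ (lengths zero) (length-concat-tabulate (F ∘ suc) (lengths ∘ suc)))

  nth-concat-tabulate : ∀ {p} (F : Fin p → List ℕ) → (∀ i → length (F i) ≡ c) →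
                        ∀ i {j} → j < c → nth (concat (List.tabulate F)) (toℕ i * c + j) ≡ nth (F i) j
  nth-concat-tabulate F lengths zero    j<c = nth-++ˡ (F zero) (subst (_ <_) (sym (lengths zero)) j<c)
  nth-concat-tabulate F lengths (suc i) {j} j<c = begin
    nth (F zero ++ rest) (c + toℕ i * c + j)
      ≡⟨ cong (nth (F zero ++ rest)) (trans (+-assoc c _ j) (cong (_+ (toℕ i * c + j)) (sym (lengths zero)))) ⟩
    nth (F zero ++ rest) (length (F zero) + (toℕ i * c + j))
      ≡⟨ nth-++ʳ (F zero) _ ⟩
    nth rest (toℕ i * c + j)
      ≡⟨ nth-concat-tabulate (F ∘ suc) (lengths ∘ suc) i j<c ⟩
    nth (F (suc i)) j ∎
    where
    open ≡-Reasoning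
    rest = concat (List.tabulate (F ∘ suc))

module _ {n : ℕ} where

  private
    rows : BoolMatrix n → Fin n → List ℕ
    rows A i = map (λ j → fromBool (A i j)) (allFin n)

    rowMajor-tabulate : ∀ A → rowMajor A ≡ concat (List.tabulate (rows A))
    rowMajor-tabulate A = cong concat (map-tabulate id (rows A))

    length-row : ∀ A i → length (rows A i) ≡ n
    length-row A i = trans (cong length (map-tabulate id (λ j → fromBool (A i j)))) (length-tabulate (λ j → fromBool (A i j)))

  length-rowMajor : ∀ A → length (rowMajor A) ≡ n * n
  length-rowMajor A = trans (cong length (rowMajor-tabulate A)) (length-concat-tabulate (rows A) (length-row A))

  nth-rowMajor : ∀ A i j → nth (rowMajor A) (toℕ i * n + toℕ j) ≡ fromBool (A i j)
  nth-rowMajor A i j = begin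
    nth (rowMajor A) (toℕ i * n + toℕ j)     ≡⟨ cong (λ l → nth l (toℕ i * n + toℕ j)) (rowMajor-tabulate A) ⟩
    _                                        ≡⟨ nth-concat-tabulate (rows A) (length-row A) i (toℕ<n j) ⟩
    nth (rows A i) (toℕ j)                   ≡⟨ cong (λ l → nth l (toℕ j)) (map-tabulate id (λ j → fromBool (A i j))) ⟩
    _                                        ≡⟨ nth-tabulate (λ j → fromBool (A i j)) j ⟩
    fromBool (A i j)                         ∎
    where open ≡-Reasoning

  entry< : ∀ (i j : Fin n) → toℕ i * n + toℕ j < n * n
  entry< i j = begin-strict
    toℕ i * n + toℕ j    <⟨ +-monoʳ-< (toℕ i * n) (toℕ<n j) ⟩
    toℕ i * n + n        ≡⟨ +-comm (toℕ i * n) n ⟩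
    suc (toℕ i) * n      ≤⟨ *-monoˡ-≤ n (toℕ<n i) ⟩
    n * n                ∎
    where open ≤-Reasoning

  rowMajor-entry≤1 : ∀ A x → nth (rowMajor A) x ≤ 1
  rowMajor-entry≤1 A x = subst (λ l → nth l x ≤ 1) (sym (rowMajor-tabulate A)) (concat≤1 (rows A) (λ i → tab≤1 i) x)
    where
    concat≤1 : ∀ {p} (F : Fin p → List ℕ) → (∀ i x → nth (F i) x ≤ 1) → ∀ x → nth (concat (List.tabulate F)) x ≤ 1
    concat≤1 {zero}  F _  x = z≤n
    concat≤1 {suc p} F F≤ x = nth-++≤ (F zero) (F≤ zero) (concat≤1 (F ∘ suc) (F≤ ∘ suc)) x
    map≤1 : ∀ i (xs : List (Fin n)) x → nth (map (λ j → fromBool (A i j)) xs) x ≤ 1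
    map≤1 i []       x       = z≤n
    map≤1 i (j ∷ xs) zero    = fromBool≤1 (A i j)
    map≤1 i (j ∷ xs) (suc x) = map≤1 i xs x
    tab≤1 : ∀ i x → nth (rows A i) x ≤ 1
    tab≤1 i = map≤1 i (allFin n)

  module _ (A B : BoolMatrix n) where

    left-entry : ∀ i k → nth (productInput A B) (1 + (toℕ i * n + toℕ k)) ≡ fromBool (A i k)
    left-entry i k = trans (nth-++ˡ (rowMajor A) (subst (toℕ i * n + toℕ k <_) (sym (length-rowMajor A)) (entry< i k)))
      (nth-rowMajor A i k)

    right-shift : ∀ x → nth (productInput A B) (1 + n * n + x) ≡ nth (rowMajor B) x
    right-shift x = trans (cong (λ l → nth (rowMajor A ++ rowMajor B) (l + x)) (sym (length-rowMajor A)))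
      (nth-++ʳ (rowMajor A) x)

    right-entry : ∀ k j → nth (productInput A B) (1 + n * n + (toℕ k * n + toℕ j)) ≡ fromBool (B k j)
    right-entry k j = trans (right-shift (toℕ k * n + toℕ j)) (nth-rowMajor B k j)

    right-end : ∀ x → n * n ≤ x → nth (productInput A B) (1 + n * n + x) ≡ 0
    right-end x ≤x = trans (right-shift x) (nth-beyond (rowMajor B) (≤-trans (≤-reflexive (length-rowMajor B)) ≤x))

    productInput≤ : 1 ≤ n → ∀ x → nth (productInput A B) x ≤ n
    productInput≤ 1≤n zero    = ≤-refl
    productInput≤ 1≤n (suc x) = ≤-trans (nth-++≤ (rowMajor A) (rowMajor-entry≤1 A) (rowMajor-entry≤1 B) x) 1≤n

or-tabulate⁻ : ∀ {n} (f : Fin n → Bool) → or (List.tabulate f) ≡ true → ∃[ k ] f k ≡ true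
or-tabulate⁻ {suc n} f any with f zero in f0
... | true  = zero , f0
... | false with or-tabulate⁻ (f ∘ suc) any
...   | k , fk = suc k , fk

or-tabulate⁺ : ∀ {n} (f : Fin n → Bool) k → f k ≡ true → or (List.tabulate f) ≡ true
or-tabulate⁺ f zero    fk rewrite fk = refl
or-tabulate⁺ f (suc k) fk with f zero
... | true  = refl
... | false = or-tabulate⁺ (f ∘ suc) k fk

⊗-tabulate : ∀ {n} (A B : BoolMatrix n) i j → (A ⊗ B) i j ≡ or (List.tabulate (λ k → A i k ∧ B k j))
⊗-tabulate A B i j = cong or (map-tabulate id (λ k → A i k ∧ B k j))

-- Binary logarithms

2^⌊log₂⌋≤ : ∀ n .{{_ : NonZero n}} → 2 ^ ⌊log₂ n ⌋ ≤ n
2^⌊log₂⌋≤ n = go n n ≤-refl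
  where
  go : ∀ b n .{{_ : NonZero n}} → n ≤ b → 2 ^ ⌊log₂ n ⌋ ≤ n
  go (suc b) 1 _ = s≤s z≤n
  go (suc b) n@(suc (suc n₀)) (s≤s n≤b) = begin
    2 ^ ⌊log₂ n ⌋                  ≡⟨ cong (2 ^_) (m+[n∸m]≡n {1} (⌊log₂⌋-mono-≤ {2} {n} (s≤s (s≤s z≤n)))) ⟨
    2 * 2 ^ (⌊log₂ n ⌋ ∸ 1)        ≡⟨ cong (λ k → 2 * 2 ^ k) (⌊log₂⌊n/2⌋⌋≡⌊log₂n⌋∸1 n) ⟨
    2 * 2 ^ ⌊log₂ h ⌋              ≤⟨ *-monoʳ-≤ 2 (go b h (≤-trans (s≤s (⌊n/2⌋≤n n₀)) n≤b)) ⟩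
    2 * h                          ≡⟨ cong (h +_) (+-identityʳ h) ⟩
    h + h                          ≤⟨ +-monoʳ-≤ h (⌊n/2⌋≤⌈n/2⌉ n) ⟩
    h + ⌈ n /2⌉                    ≡⟨ ⌊n/2⌋+⌈n/2⌉≡n n ⟩
    n                              ∎
    where
    open ≤-Reasoning
    h = ⌊ n /2⌋

n<2^lg : ∀ n → n < 2 ^ lg n
n<2^lg n = ≰⇒> λ 2^≤n → 1+n≰n (≤-trans (≤-reflexive (sym (⌊log₂[2^n]⌋≡n (lg n)))) (⌊log₂⌋-mono-≤ 2^≤n))

<2^⇒lg≤ : ∀ {n k} .{{_ : NonZero n}} → n < 2 ^ k → lg n ≤ k
<2^⇒lg≤ {n} {k} n<2^k = ≰⇒> λ k≤ → <⇒≱ n<2^k (≤-trans (^-monoʳ-≤ 2 k≤) (2^⌊log₂⌋≤ n))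

<lg⇒2^≤ : ∀ {n j} .{{_ : NonZero n}} → j < lg n → 2 ^ j ≤ n
<lg⇒2^≤ {n} (s≤s j≤) = ≤-trans (^-monoʳ-≤ 2 j≤) (2^⌊log₂⌋≤ n)

-- The multiplication program

-- The variables are: 0 the dimension n, 1 the number r = κ n (there are 2 r
-- rows), 2 the modulus W, 3 the offset of the simulated input, 4 a write
-- pointer, 5 a counter, 6 a loop flag.  The memory holds the product below W,
-- the simulated memory from W, a query from 2 W and the pairs from 3 W.
pattern vn = var 0F
pattern vr = var 1F
pattern vW = var 2F
pattern vP = var 4F
pattern vq = var 5F

textLengthExp rowsSizeExp sizeExp : Exp
textLengthExp = vr ⊛ ((lit 1 ⊕ vn) ⊛ (lit 2 ⊕ vn)) ⊕ vn ⊛ (vn ⊛ (lit 2 ⊕ vn))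
rowsSizeExp   = lit 2 ⊛ vr ⊛ (lit 1 ⊕ vn)
sizeExp       = rowsSizeExp ⊕ vn ⊛ vn

-- Symbols are stored one larger than their index in `Fin`, so at position `suc t` of a row the
-- symbol `t` is written as the position itself. The entry of `B` is at input position
-- `1 + n * n + (k * n + t)`, which absorbs the same shift. Rows beyond the matrix read the zeros
-- after the end of the input.
columnExp rowExp rowParentExp rowSymbolExp blockParentExp blockSymbolExp : Exp
columnExp      = vq ⊚ (lit 1 ⊕ vn)
rowExp         = vq ⊘ (lit 1 ⊕ vn)
rowParentExp   = cond columnExp vq (lit 0)
rowSymbolExp   = cond columnExp
  (cond (read (vn ⊛ vn ⊕ (rowExp ⊛ vn ⊕ columnExp))) columnExp (lit 1 ⊕ vn))
  (lit 2 ⊕ vn ⊕ rowExp)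
blockParentExp = (lit 1 ⊕ cond (read (lit 1 ⊕ vq)) (vq ⊚ vn) vn) ⊛ (lit 1 ⊕ vn)
blockSymbolExp = lit 2 ⊕ vn ⊕ lit 2 ⊛ vr ⊕ vq

-- Doubles variable 4, starting from 1, until it exceeds the text length `N`. This yields
-- `2 ^ lg N`; the logarithm itself is never computed.
powerLoop : Program
powerLoop = while 6F (assign 4F (lit 2 ⊛ vP) ⨾ assign 6F (vP ≺ lit 1 ⊕ textLengthExp))

-- Started with 1 in variable 2 and run for the word factor of the data structure, this multiplies
-- up the modulus `W` from copies of the power in variable 4.
wordPower : ℕ → Program
wordPower zero    = skip
wordPower (suc k) = assign 2F (vP ⊛ vW) ⨾ wordPower k

emit : Exp → Exp → Exp → Program
emit limit parentExp symbolExp =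
  put vP parentExp ⨾ put (lit 1 ⊕ vP) symbolExp ⨾ assign 4F (lit 2 ⊕ vP) ⨾
  assign 5F (lit 1 ⊕ vq) ⨾ assign 6F (vq ≺ limit)

countUpTo : Exp → Program → Program
countUpTo limit body = assign 5F (lit 0) ⨾ assign 6F (vq ≺ limit) ⨾ while 6F body

emitTime : Exp → Exp → Exp → ℕ
emitTime limit parentExp symbolExp =
  cost vP + (cost parentExp + 1) + (cost (lit 1 ⊕ vP) + (cost symbolExp + 1) +
  (cost (lit 2 ⊕ vP) + 2 + (cost (lit 1 ⊕ vq) + 2 + (cost (vq ≺ limit) + 2))))

prepare : ℕ → ℕ → Program
prepare κ wF =
  assign 0F (read (lit 0)) ⨾ assign 1F (lit κ ⊛ vn) ⨾
  assign 4F (lit 1) ⨾ assign 6F (vP ≺ lit 1 ⊕ textLengthExp) ⨾ powerLoop ⨾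
  assign 2F (lit 1) ⨾ wordPower wF ⨾
  -- The same number is written twice, as the length of the text and as the size of its alphabet.
  put (lit 3 ⊛ vW) textLengthExp ⨾ put (lit 3 ⊛ vW ⊕ lit 1) textLengthExp ⨾ put (lit 3 ⊛ vW ⊕ lit 2) sizeExp ⨾
  assign 4F (lit 3 ⊛ vW ⊕ lit 3) ⨾
  countUpTo rowsSizeExp (emit rowsSizeExp rowParentExp rowSymbolExp) ⨾
  countUpTo (vn ⊛ vn) (emit (vn ⊛ vn) blockParentExp blockSymbolExp)

rowTime blockTime : ℕ
rowTime   = emitTime rowsSizeExp rowParentExp rowSymbolExp
blockTime = emitTime (vn ⊛ vn) blockParentExp blockSymbolExp

prepareTime : (κ wF power rows blocks : ℕ) → ℕ
prepareTime κ wF power rows blocks =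
  cost (read (lit 0)) + 2 + (cost (lit κ ⊛ vn) + 2 + (cost (lit 1) + 2 + (cost (vP ≺ lit 1 ⊕ textLengthExp) + 2 +
  (1 + power + (cost (lit 1) + 2 + (wF * 7 + (cost (lit 3 ⊛ vW) + (cost textLengthExp + 1) +
  (cost (lit 3 ⊛ vW ⊕ lit 1) + (cost textLengthExp + 1) + (cost (lit 3 ⊛ vW ⊕ lit 2) + (cost sizeExp + 1) +
  (cost (lit 3 ⊛ vW ⊕ lit 3) + 2 +
  (3 + (cost (vq ≺ rowsSizeExp) + 2 + (1 + rows)) +
   (3 + (cost (vq ≺ vn ⊛ vn) + 2 + (1 + blocks))))))))))))))

fromExp toExp addressExp : Exp
fromExp = vr ⊛ ((lit 1 ⊕ vn) ⊛ (lit 2 ⊕ vn)) ⊕ (vq ⊘ vn) ⊛ (vn ⊛ (lit 2 ⊕ vn))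
toExp   = fromExp ⊕ vn ⊛ (lit 2 ⊕ vn)
addressExp = lit 2 ⊛ vW

-- The queries are numbered by `q = i * n + j`, so the counter is also the address of the answer in
-- row-major order.
queryStep : Program → Program
queryStep query =
  put (addressExp ⊕ lit 0) (lit 1) ⨾ put (addressExp ⊕ lit 1) fromExp ⨾
  put (addressExp ⊕ lit 2) toExp ⨾ put (addressExp ⊕ lit 3) (lit 1 ⊕ vq ⊚ vn) ⨾
  compile query ⨾ putAnswer vq ⨾ assign 5F (lit 1 ⊕ vq) ⨾ assign 6F (vq ≺ vn ⊛ vn)

-- The input of `build` lies at `3 * W`, that of a query at `2 * W`; changing variable 3 redirects
-- the compiled input instructions. The simulated registers and memory are left alone between the
-- runs.
multiplication : (κ wF : ℕ) → (build query : Program) → Program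
multiplication κ wF build query =
  prepare κ wF ⨾ assign 3F (lit 3 ⊛ vW) ⨾ compile build ⨾ assign 3F (lit 2 ⊛ vW) ⨾
  countUpTo (vn ⊛ vn) (queryStep query)

queryStepTime : ℕ → ℕ
queryStepTime t =
  cost (addressExp ⊕ lit 0) + (cost (lit 1) + 1) + (cost (addressExp ⊕ lit 1) + (cost fromExp + 1) +
  (cost (addressExp ⊕ lit 2) + (cost toExp + 1) + (cost (addressExp ⊕ lit 3) + (cost (lit 1 ⊕ vq ⊚ vn) + 1) +
  (2 * t + (cost vq + 1 + (cost (lit 1 ⊕ vq) + 2 + (cost (vq ≺ vn ⊛ vn) + 2)))))))

multiplyTime : (κ wF power rows blocks build queries : ℕ) → ℕ
multiplyTime κ wF power rows blocks build queries =
  prepareTime κ wF power rows blocks + (cost (lit 3 ⊛ vW) + 2 + (2 * build + (cost (lit 2 ⊛ vW) + 2 +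
  (3 + (cost (vq ≺ vn ⊛ vn) + 2 + (1 + queries))))))

-- Opaque, as comparing unfolded running times is infeasible.
opaque
  hostTime : (κ wF L rows blocks build query : ℕ) → ℕ
  hostTime κ wF L rows blocks build query = multiplyTime κ wF (L * 60) (rows * suc rowTime) (blocks * suc blockTime)
    build (blocks * suc (queryStepTime query))

  multiplyTime≤hostTime : ∀ κ wF L rows blocks build query →
    multiplyTime κ wF (L * 60) (rows * suc rowTime) (blocks * suc blockTime) build (blocks * suc (queryStepTime query))
    ≤ hostTime κ wF L rows blocks build query
  multiplyTime≤hostTime κ wF L rows blocks build query = ≤-refl

-- Correctness of the multiplication program

nth< : ∀ {l W} → 0 < W → ListAll.All (_< W) l → ∀ x → nth l x < W
nth< 0<W []ₗ       x       = 0<W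
nth< 0<W (p ∷ₗ ps) zero    = p
nth< 0<W (p ∷ₗ ps) (suc x) = nth< 0<W ps x

-- As `nth` is zero beyond the end, the list is followed by zeros in memory, just as an input is
-- when read past its end.
record Region (B : ℕ) (l : List ℕ) (μ : ℕ → ℕ) : Set where
  constructor region
  field at : ∀ x → μ (B + x) ≡ nth l x

open Region public

region-cast : ∀ {B l l′ μ} → l ≡ l′ → Region B l μ → Region B l′ μ
region-cast refl R = R

region-append : ∀ {B l μ v P} → P ≡ B + length l → Region B l μ → Region B (l ∷ʳ v) (update μ P v)
region-append {B} {l} {μ} {v} refl (region at) = region λ x → begin
  update μ (B + length l) v (B + x)                  ≡⟨ update-shift μ B (length l) v x ⟩
  update (λ x → μ (B + x)) (length l) v x            ≡⟨ update-cong (length l) x refl (at x) ⟩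
  update (nth l) (length l) v x                      ≡⟨ nth-∷ʳ l v x ⟩
  nth (l ∷ʳ v) x                                     ∎
  where open ≡-Reasoning

fromBool≢0 : ∀ {b} → True b → fromBool b ≢ 0
fromBool≢0 {true} _ ()

fromBool≡0 : ∀ {b} → ¬ True b → fromBool b ≡ 0
fromBool≡0 {true}  ¬b = contradiction tt ¬b
fromBool≡0 {false} _  = refl

module Setup (κ n′ : ℕ) {{κ≢0 : NonZero κ}} (inp : List ℕ)
  (B-end : ∀ x → suc n′ * suc n′ ≤ x → nth inp (1 + suc n′ * suc n′ + x) ≡ 0) where

  n r : ℕ
  n = suc n′
  r = κ * n

  private instance
    r≢0 : NonZero r
    r≢0 = m*n≢0 κ n

  n≤r : n ≤ r
  n≤r = m≤n*m n κ

  module Enc = Encoding n r (λ q → nth inp (1 + q)) (λ x → nth inp (1 + n * n + x)) B-end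
  module Txt = Enc.Text n≤r
  open Enc using (rowsSize; size; rowsLength; blockLength; textLength; parent; char; rowParent; rowSymbol; blockParent; blockSymbol)

  pairList : ℕ → List ℕ
  pairList q = parent q ∷ suc (char q) ∷ []

  -- The output after `s` pairs. Its header holds the final number of pairs from the beginning,
  -- since that number depends on `n` and `r` only.
  listing : ℕ → List ℕ
  listing s = textLength ∷ textLength ∷ size ∷ concat (applyUpTo pairList s)

  length-listing : ∀ s → length (listing s) ≡ 3 + s * 2
  length-listing s = cong (3 +_) (total-const pairList s (λ _ → refl))

  listing-suc : ∀ s → listing (suc s) ≡ (listing s ∷ʳ parent s) ∷ʳ suc (char s)
  listing-suc s = cong (λ l → textLength ∷ textLength ∷ size ∷ l)
    (trans (concat-applyUpTo-suc pairList s) (sym (++-assoc (concat (applyUpTo pairList s)) (parent s ∷ []) _)))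

  blockStart blockEnd : ℕ → ℕ
  blockStart q = rowsLength + q / n * blockLength
  blockEnd q = blockStart q + blockLength

  queryList : ℕ → List ℕ
  queryList q = 1 ∷ blockStart q ∷ blockEnd q ∷ suc (q % n) ∷ []

  nn≤N : n * n ≤ textLength
  nn≤N = ≤-trans (m≤n+m (n * n) rowsSize) Enc.size≤textLength

  module Prepare (wF L w : ℕ) {{wF≢0 : NonZero wF}}
    (2^≤N : ∀ {j} → j < L → 2 ^ j ≤ textLength) (N<2^ : textLength < 2 ^ L)
    (1≤L : 1 ≤ L) (inp-0 : nth inp 0 ≡ n) (inp≤n : ∀ x → nth inp x ≤ n)
    (fits-w : (2 ^ (wF * L + 3)) ^ (60 + κ) < 2 ^ w) where

    -- The bound `8 * W` leaves room for every address: the listing starts at `3 * W` and takes at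
    -- most `3 + 2 * size` cells, which is at most `5 * W`.
    W U : ℕ
    W = 2 ^ (wF * L)
    U = 2 ^ (wF * L + 3)

    U≡8W : U ≡ W * 8
    U≡8W = ^-distribˡ-+-* 2 (wF * L) 3

    1≤W : 1 ≤ W
    1≤W = m^n>0 2 (wF * L)

    N<W : textLength < W
    N<W = <-≤-trans N<2^ (^-monoʳ-≤ 2 (m≤n*m L wF))

    multiple≤U : ∀ k → k ≤ 8 → W * k ≤ U
    multiple≤U k k≤8 = ≤-trans (*-monoʳ-≤ W k≤8) (≤-reflexive (sym U≡8W))

    W≤U : W ≤ U
    W≤U = ≤-trans (≤-reflexive (sym (*-identityʳ W))) (multiple≤U 1 (s≤s z≤n))

    N≤U : textLength ≤ U
    N≤U = ≤-trans (<⇒≤ N<W) W≤U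

    8≤U : 8 ≤ U
    8≤U = ≤-trans (m≤n*m 8 W {{>-nonZero 1≤W}}) (≤-reflexive (sym U≡8W))

    small≤U : ∀ k {k≤8 : True (k ≤ᵇ 8)} → k ≤ U
    small≤U k {k≤8} = ≤-trans (≤ᵇ⇒≤ k 8 k≤8) 8≤U

    bool≤U : ∀ b → fromBool b ≤ U
    bool≤U b = ≤-trans (fromBool≤1 b) (small≤U 1)

    size≤N : size ≤ textLength
    size≤N = Enc.size≤textLength

    n≤U : n ≤ U
    n≤U = ≤-trans (≤-trans (m≤n+m n rowsLength) (+-monoʳ-≤ rowsLength (m≤m*n n (n * (2 + n))))) N≤U

    r≤U : r ≤ U
    r≤U = ≤-trans (≤-trans (m≤m*n r ((1 + n) * (2 + n))) (m≤m+n rowsLength (n * blockLength))) N≤U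

    open Machine w inp U (≤-trans (s≤s (s≤s z≤n)) 8≤U) (λ x → ≤-trans (inp≤n x) n≤U)
      (60 + κ) (m≤m+n 60 κ) fits-w public

    vs : ℕ → ℕ → ℕ → ℕ → ℕ → Vec ℕ V
    vs m base P q f = n ∷ r ∷ m ∷ base ∷ P ∷ q ∷ f ∷ []

    vs-small : ∀ {m base P q f} → m ≤ U → base ≤ U → P ≤ U → q ≤ U → f ≤ U → All (_≤ U) (vs m base P q f)
    vs-small m≤ base≤ P≤ q≤ f≤ = n≤U ∷ r≤U ∷ m≤ ∷ base≤ ∷ P≤ ∷ q≤ ∷ f≤ ∷ []

    -- The zeros below the listing provide the empty memory in which the simulated machine must
    -- start and the zeros that follow a query.
    record Emitted (s : ℕ) (μ : ℕ → ℕ) : Set where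
      field
        listed : Region (3 * W) (listing s) μ
        below  : ∀ x → x < 3 * W → μ x ≡ 0

    open Emitted

    end : ℕ → ℕ
    end s = 3 * W + length (listing s)

    end-suc : ∀ s → end (suc s) ≡ 2 + end s
    end-suc s = begin
      3 * W + length (listing (suc s))       ≡⟨ cong (3 * W +_) (trans (length-listing (suc s)) (cong (2 +_) (sym (length-listing s)))) ⟩
      3 * W + (2 + length (listing s))       ≡⟨ +-suc (3 * W) _ ⟩
      suc (3 * W + suc (length (listing s))) ≡⟨ cong suc (+-suc (3 * W) _) ⟩
      2 + end s                              ∎
      where open ≡-Reasoning

    end≤U : ∀ {s} → s ≤ size → end s ≤ U
    end≤U {s} s≤ = begin
      3 * W + length (listing s)   ≡⟨ cong (3 * W +_) (length-listing s) ⟩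
      3 * W + (3 + s * 2)          ≤⟨ +-monoʳ-≤ (3 * W) (+-mono-≤ (m≤m*n 3 W {{>-nonZero 1≤W}})
                                        (*-monoˡ-≤ 2 (≤-trans s≤ (≤-trans size≤N (<⇒≤ N<W))))) ⟩
      3 * W + (3 * W + W * 2)      ≡⟨ cong (λ x → x + (x + W * 2)) (*-comm 3 W) ⟩
      W * 3 + (W * 3 + W * 2)      ≡⟨ cong (W * 3 +_) (*-distribˡ-+ W 3 2) ⟨
      W * 3 + W * 5                ≡⟨ *-distribˡ-+ W 3 5 ⟨
      W * 8                        ≡⟨ U≡8W ⟨
      U                            ∎
      where open ≤-Reasoning

    emitted-suc : ∀ {s μ P p c} → P ≡ end s → p ≡ parent s → c ≡ suc (char s) → Emitted s μ →
                  Emitted (suc s) (update (update μ P p) (1 + P) c)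
    emitted-suc {s} {μ} {P} P≡ refl refl e = record
      { listed = region-cast (sym (listing-suc s))
          (region-append
            (trans (cong suc P≡) (trans (sym (+-suc (3 * W) _)) (cong (3 * W +_) (sym (length-∷ʳ (listing s) (parent s))))))
            (region-append P≡ (listed e)))
      ; below = λ x x< → trans (update-other (<⇒≢ (≤-trans (<-≤-trans x< 3W≤P) (n≤1+n P))))
                           (trans (update-other (<⇒≢ (<-≤-trans x< 3W≤P))) (below e x x<)) }
      where
      3W≤P : 3 * W ≤ P
      3W≤P = ≤-trans (m≤m+n (3 * W) _) (≤-reflexive (sym P≡))

    emitted-cast : ∀ {s t μ} → s ≡ t → Emitted s μ → Emitted t μ
    emitted-cast refl e = e

    EmitState : ℕ → ℕ → ℕ → Config → Set
    EmitState s k j c = ∃[ μ ] ∃[ P ] c ≡ config (vs W 0 P j (fromBool (j <ᵇ k))) (λ _ → 0) μ × P ≡ end (s + j) × Emitted (s + j) μ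

    -- Serves for the rows and for the blocks: `s` pairs have been written before, and the counter
    -- starts again from 0.
    module EmitLoop (limit parentExp symbolExp : Exp)
      (limit-ok : Suitable (vq ≺ limit)) (parent-ok : Suitable parentExp) (symbol-ok : Suitable symbolExp)
      (s k : ℕ) (s+k≤ : s + k ≤ size)
      (limit≡ : ∀ {P j f μ} → eval inp (config (vs W 0 P j f) (λ _ → 0) μ) limit ≡ k)
      (parent≡ : ∀ {P j f μ} → j < k → eval inp (config (vs W 0 P j f) (λ _ → 0) μ) parentExp ≡ parent (s + j))
      (symbol≡ : ∀ {P j f μ} → j < k → eval inp (config (vs W 0 P j f) (λ _ → 0) μ) symbolExp ≡ suc (char (s + j))) where

      j≤U : ∀ {j} → j ≤ k → j ≤ U
      j≤U j≤k = ≤-trans j≤k (≤-trans (m≤n+m k s) (≤-trans s+k≤ (≤-trans size≤N N≤U)))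

      emit-triple : ∀ {j c} → j < k → EmitState s k j c →
                    Triple c (emit limit parentExp symbolExp) (emitTime limit parentExp symbolExp) (EmitState s k (suc j))
      emit-triple {j} j<k (μ , P , refl , P≡ , e) =
        put-triple vP parentExp sm suitable parent-ok then λ { refl →
        put-triple (lit 1 ⊕ vP) symbolExp sm suitable symbol-ok then λ { refl →
        assign-triple 4F (lit 2 ⊕ vP) sm suitable then λ { refl →
        assign-triple 5F (lit 1 ⊕ vq) sm′ suitable then λ { refl →
        weaken ≤-refl (λ { refl → _ , _ ,
            cong (λ b → config (vs W 0 (2 + P) (suc j) (fromBool (suc j <ᵇ b))) _ _) limit≡ ,
            P′≡ ,
            emitted-cast (sym (+-suc s j)) (emitted-suc P≡ (parent≡ j<k) (symbol≡ j<k) e) })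
          (assign-triple 6F (vq ≺ limit) sm″ limit-ok) } } } }
        where
        P′≡ : 2 + P ≡ end (s + suc j)
        P′≡ = trans (cong (2 +_) P≡) (trans (sym (end-suc (s + j))) (cong end (sym (+-suc s j))))
        s+j≤ : s + j ≤ size
        s+j≤ = ≤-trans (+-monoʳ-≤ s (<⇒≤ j<k)) s+k≤
        P≤ : P ≤ U
        P≤ = ≤-trans (≤-reflexive P≡) (end≤U s+j≤)
        P′≤ : 2 + P ≤ U
        P′≤ = ≤-trans (≤-reflexive P′≡) (end≤U (≤-trans (+-monoʳ-≤ s j<k) s+k≤))
        sm  = vs-small W≤U z≤n P≤ (j≤U (<⇒≤ j<k)) (bool≤U (j <ᵇ k))
        sm′ = vs-small W≤U z≤n P′≤ (j≤U (<⇒≤ j<k)) (bool≤U (j <ᵇ k))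
        sm″ = vs-small W≤U z≤n P′≤ (j≤U j<k) (bool≤U (j <ᵇ k))

      loop-triple : ∀ {P q f μ} → P ≡ end s → q ≤ U → f ≤ U → Emitted s μ →
                    Triple (config (vs W 0 P q f) (λ _ → 0) μ)
                      (countUpTo limit (emit limit parentExp symbolExp))
                      (3 + (cost (vq ≺ limit) + 2 + (1 + k * suc (emitTime limit parentExp symbolExp))))
                      (EmitState s k k)
      loop-triple {P} {q} {f} {μ} P≡ q≤ f≤ e =
        assign-triple 5F (lit 0) (vs-small W≤U z≤n P≤ q≤ f≤) suitable then λ { refl →
        assign-triple 6F (vq ≺ limit) (vs-small W≤U z≤n P≤ z≤n f≤) limit-ok then λ { refl →
        while-triple (EmitState s k) 6F
          (λ { j<k (_ , _ , refl , _) → fromBool≢0 (<⇒<ᵇ j<k) })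
          (λ { (_ , _ , refl , _) → fromBool≡0 (n≮n k ∘ <ᵇ⇒< k k) })
          emit-triple
          (_ , _ , cong (λ b → config (vs W 0 P 0 (fromBool (0 <ᵇ b))) _ _) limit≡ ,
            trans P≡ (cong end (sym (+-identityʳ s))) ,
            emitted-cast (sym (+-identityʳ s)) e) } }
        where
        P≤ : P ≤ U
        P≤ = ≤-trans (≤-reflexive P≡) (end≤U (≤-trans (m≤m+n s k) s+k≤))

    -- The left-hand side is what `rowSymbolExp` evaluates to when the counter is `q`.
    rowSymbol-eval : ∀ q → choose (q % suc n)
        (choose (nth inp (n * n + (q / suc n * n + q % suc n))) (q % suc n) (1 + n)) (2 + n + q / suc n) ≡
      suc (rowSymbol q)
    rowSymbol-eval q with q / suc n | q % suc n
    ... | k | zero  = refl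
    ... | k | suc t
      rewrite +-suc (k * n) t | +-suc (n * n) (k * n + t) with nth inp (suc (n * n + (k * n + t)))
    ...   | zero  = refl
    ...   | suc _ = refl

    module Rows = EmitLoop rowsSizeExp rowParentExp rowSymbolExp suitable suitable suitable
      0 rowsSize (m≤m+n rowsSize (n * n)) refl
      (λ {P} {j} j<k → sym (glue-left {f = rowParent} {g = blockParent} j<k))
      (λ {P} {j} j<k → trans (rowSymbol-eval j) (cong suc (sym (glue-left {f = rowSymbol} {g = blockSymbol} j<k))))

    module Blocks = EmitLoop (vn ⊛ vn) blockParentExp blockSymbolExp suitable suitable suitable
      rowsSize (n * n) ≤-refl refl
      (λ {P} {j} _ → sym (glue-right rowsSize {f = rowParent} {g = blockParent} j))
      (λ {P} {j} _ → cong suc (sym (glue-right rowsSize {f = rowSymbol} {g = blockSymbol} j)))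

    PowerState : ℕ → Config → Set
    PowerState j c = c ≡ config (vs 0 0 (2 ^ j) 0 (fromBool (2 ^ j <ᵇ suc textLength))) (λ _ → 0) (λ _ → 0)

    2^≤U : ∀ {j} → j ≤ L → 2 ^ j ≤ U
    2^≤U j≤L = ≤-trans (^-monoʳ-≤ 2 (≤-trans j≤L (m≤n*m L wF))) W≤U

    power-triple : ∀ {c} → PowerState 0 c → Triple c powerLoop (1 + L * 60) (PowerState L)
    power-triple = while-triple PowerState 6F
      (λ { {j} j<L refl → fromBool≢0 (<⇒<ᵇ (s≤s (2^≤N j<L))) })
      (λ { refl → fromBool≡0 (λ 2^< → <⇒≱ N<2^ (≤-pred (<ᵇ⇒< (2 ^ L) (suc textLength) 2^<))) })
      -- The 59 steps of the body and the test make up the 60 charged for a round.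
      (λ { {j} j<L refl → weaken (≤ᵇ⇒≤ _ 59 tt) (λ post → post)
        (assign-triple 4F (lit 2 ⊛ vP) (vs-small z≤n z≤n (2^≤U (<⇒≤ j<L)) z≤n (bool≤U (2 ^ j <ᵇ suc textLength))) suitable then λ { refl →
         assign-triple 6F (vP ≺ lit 1 ⊕ textLengthExp)
           (vs-small z≤n z≤n (2^≤U j<L) z≤n (bool≤U (2 ^ j <ᵇ suc textLength))) suitable }) })

    power≤U : ∀ {i} → i ≤ wF → (2 ^ L) ^ i ≤ U
    power≤U {i} i≤ = ≤-trans (≤-reflexive (trans (^-*-assoc 2 L i) (cong (2 ^_) (*-comm L i))))
      (≤-trans (^-monoʳ-≤ 2 (*-monoˡ-≤ L i≤)) W≤U)

    wordPower-triple : ∀ i k {f} → i + k ≡ wF → f ≤ U →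
      Triple (config (vs ((2 ^ L) ^ i) 0 (2 ^ L) 0 f) (λ _ → 0) (λ _ → 0)) (wordPower k) (k * 7)
             (_≡ config (vs W 0 (2 ^ L) 0 f) (λ _ → 0) (λ _ → 0))
    wordPower-triple i zero {f} i+k≡ f≤ = done (cong (λ m → config (vs m 0 (2 ^ L) 0 f) (λ _ → 0) (λ _ → 0))
      (trans (cong ((2 ^ L) ^_) (trans (sym (+-identityʳ i)) i+k≡)) (trans (^-*-assoc 2 L wF) (cong (2 ^_) (*-comm L wF)))))
    wordPower-triple i (suc k) i+k≡ f≤ =
      assign-triple 2F (vP ⊛ vW) (vs-small (power≤U (≤-trans (m≤m+n i (suc k)) (≤-reflexive i+k≡))) z≤n (2^≤U ≤-refl) z≤n f≤) suitable then λ { refl →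
      wordPower-triple (suc i) k (trans (sym (+-suc i k)) i+k≡) f≤ }

    emitted-header : Emitted 0 (update (update (update (λ _ → 0) (3 * W) textLength) (3 * W + 1) textLength) (3 * W + 2) size)
    emitted-header = record
      { listed = region-append refl (region-append refl
          (region-append {l = []} (sym (+-identityʳ (3 * W))) (region λ _ → refl)))
      ; below = λ x x< →
          trans (update-other (<⇒≢ (<-≤-trans x< (m≤m+n (3 * W) 2))))
          (trans (update-other (<⇒≢ (<-≤-trans x< (m≤m+n (3 * W) 1)))) (update-other (<⇒≢ x<))) }

    Prepared : Config → Set
    Prepared c = ∃[ μ ] ∃[ P ] ∃[ f ]
      c ≡ config (vs W 0 P (n * n) f) (λ _ → 0) μ × P ≤ U × f ≤ U × Emitted size μ

    prepare-triple : Triple (config (0 ∷ 0 ∷ 0 ∷ 0 ∷ 0 ∷ 0 ∷ 0 ∷ []) (λ _ → 0) (λ _ → 0)) (prepare κ wF)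
      (prepareTime κ wF (L * 60) (rowsSize * suc rowTime) (n * n * suc blockTime)) Prepared
    prepare-triple =
       assign-value 0F (read (lit 0)) inp-0 (z≤n ∷ z≤n ∷ z≤n ∷ z≤n ∷ z≤n ∷ z≤n ∷ z≤n ∷ []) suitable then λ { refl →
       assign-triple 1F (lit κ ⊛ vn) (n≤U ∷ z≤n ∷ z≤n ∷ z≤n ∷ z≤n ∷ z≤n ∷ z≤n ∷ []) κ-suitable then λ { refl →
       assign-triple 4F (lit 1) (vs-small z≤n z≤n z≤n z≤n z≤n) suitable then λ { refl →
       assign-triple 6F (vP ≺ lit 1 ⊕ textLengthExp) (vs-small z≤n z≤n (small≤U 1) z≤n z≤n) suitable then λ { refl →
       power-triple refl then λ { refl →
       assign-triple 2F (lit 1) (vs-small z≤n z≤n (2^≤U ≤-refl) z≤n flag≤) suitable then λ { refl →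
       wordPower-triple 0 wF refl flag≤ then λ { refl →
       put-triple (lit 3 ⊛ vW) textLengthExp small₁ suitable suitable then λ { refl →
       put-triple (lit 3 ⊛ vW ⊕ lit 1) textLengthExp small₁ suitable suitable then λ { refl →
       put-triple (lit 3 ⊛ vW ⊕ lit 2) sizeExp small₁ suitable suitable then λ { refl →
       assign-triple 4F (lit 3 ⊛ vW ⊕ lit 3) small₁ suitable then λ { refl →
       Rows.loop-triple refl z≤n flag≤ emitted-header then λ { (μ , P , refl , P≡ , e) →
       weaken ≤-refl (λ { (μ′ , P′ , refl , P′≡ , e′) → μ′ , P′ , _ , refl ,
           ≤-trans (≤-reflexive P′≡) (end≤U ≤-refl) , bool≤U (n * n <ᵇ n * n) , e′ })
         (Blocks.loop-triple P≡ (≤-trans (m≤m+n rowsSize (n * n)) (≤-trans size≤N N≤U)) (bool≤U (rowsSize <ᵇ rowsSize)) e) }}}}}}}}}}}}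
      where
      -- The weight `κ + 2` contains a parameter, so the tests of `suitable` do not compute. This
      -- literal is the reason for the exponent `60 + κ`.
      κ-suitable : Suitable (lit κ ⊛ vn)
      κ-suitable = record
        { height≤ = ≤ᵇ⇒≤ (V + 3) K tt
        ; fits-weight = fits-≤ (≤-trans (≤-reflexive (+-comm (suc κ) 1)) (+-monoˡ-≤ κ (≤ᵇ⇒≤ 2 60 tt))) (fits fits-w) }
      flag≤ : fromBool (2 ^ L <ᵇ suc textLength) ≤ U
      flag≤ = bool≤U (2 ^ L <ᵇ suc textLength)
      small₁ = vs-small W≤U z≤n (2^≤U ≤-refl) z≤n flag≤

    w₀ : ℕ
    w₀ = wF * L

    -- The host word length is known only through the capacity bound `fits-w`, from which this has
    -- to be recovered.
    w₀+3≤w : w₀ + 3 ≤ w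
    w₀+3≤w = ≮⇒≥ λ w< → <⇒≱ fits-w (begin
      2 ^ w                        ≤⟨ ^-monoʳ-≤ 2 (<⇒≤ w<) ⟩
      2 ^ (w₀ + 3)                 ≤⟨ U≤U^ {60 + κ} (s≤s z≤n) ⟩
      (2 ^ (w₀ + 3)) ^ (60 + κ)    ∎)
      where open ≤-Reasoning

    1≤w₀ : 1 ≤ w₀
    1≤w₀ = ≤-trans 1≤L (m≤n*m L wF)

    -- The part of `Simulates` that must survive between two compiled runs, while the host changes
    -- its variables and its own cells.
    record Linked (s : State) (μ : ℕ → ℕ) : Set where
      field
        inside : ∀ a → a < W → μ (W + a) ≡ mem s a
        reg<   : ∀ i → reg s i < W
        mem<   : ∀ a → mem s a < W

    open Linked

    linked-cong : ∀ {s μ μ′} → (∀ a → a < W → μ′ (W + a) ≡ μ (W + a)) → Linked s μ → Linked s μ′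
    linked-cong same l = record { inside = λ a a< → trans (same a a<) (inside l a a<) ; reg< = reg< l ; mem< = mem< l }

    Simulated : ℕ → ℕ → ℕ → ℕ → State → (ℕ → ℕ) → Config → Set
    Simulated base P q f s μ c = ∃[ μ′ ]
      c ≡ config (vs W base P q f) (reg s) μ′ × Linked s μ′ × (∀ a → a < W ⊎ W + W ≤ a → μ′ a ≡ μ a)

    simulation-triple : ∀ {base P q f s s′ t t′ μ p I} → W + W ≤ base → base + W ≤ U → Linked s μ →
      (∀ a → a < W → μ (base + a) ≡ nth I a mod2^ w₀) → Run w₀ I p s s′ t → t ≤ t′ →
      Triple (config (vs W base P q f) (reg s) μ) (compile p) (2 * t′) (Simulated base P q f s′ μ)
    simulation-triple {base} {P} {q} {f} {s} {s′} {t} {t′} {μ} {p} {I} W+W≤ base+W≤ l input≡ run t≤ = triple reach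
      where
      module Sm = Simulation w inp w₀ I 1≤w₀ (≤-trans (m≤m+n w₀ 3) w₀+3≤w) (vs W base P q f) μ refl
        W+W≤ (≤-trans base+W≤ (^-monoʳ-≤ 2 w₀+3≤w)) input≡
      reach : ∀ {h} → Holds h (config (vs W base P q f) (reg s) μ) →
              Reaches (compile p) h (2 * t′) (Simulated base P q f s′ μ)
      reach {h} holds = record
        { run = O.run
        ; time≤ = ≤-trans O.time≤ (*-monoʳ-≤ 2 t≤)
        ; holds = record { vars-≡ = S.vars-≡ ; sim-≡ = S.sim-≡ ; cells-≡ = λ _ → refl }
        ; post = mem O.final , refl , record { inside = S.inside ; reg< = S.reg< ; mem< = S.mem< } , S.outside }
        where
        module H = Holds holds
        start : Sm.Simulates s h
        start = record
          { vars-≡  = H.vars-≡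
          ; sim-≡   = H.sim-≡
          ; inside  = λ a a< → trans (H.cells-≡ (W + a)) (inside l a a<)
          ; outside = λ a _ → H.cells-≡ a
          ; reg<    = reg< l
          ; mem<    = mem< l }
        module O = Sm.Outcome (Sm.compile-correct run start)
        module S = Sm.Simulates O.simulates

    W+W≤2W : W + W ≤ 2 * W
    W+W≤2W = ≤-reflexive (cong (W +_) (sym (+-identityʳ W)))

    scaled≤U : ∀ k → k ≤ 8 → k * W ≤ U
    scaled≤U k k≤8 = ≤-trans (≤-reflexive (*-comm k W)) (multiple≤U k k≤8)

    listing< : ∀ x → nth (listing size) x < W
    listing< = nth< 1≤W (N<W ∷ₗ N<W ∷ₗ ≤-<-trans size≤N N<W ∷ₗ concat⁺ (applyUpTo⁺₁ pairList size λ {q} q<size →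
      ≤-<-trans (Enc.parent-earlier n≤r q<size) (<-trans q<size (≤-<-trans size≤N N<W)) ∷ₗ
      ≤-<-trans (Txt.char< q<size) N<W ∷ₗ []ₗ))

    nn<W : n * n < W
    nn<W = ≤-<-trans nn≤N N<W

    2W≤U : 2 * W ≤ U
    2W≤U = scaled≤U 2 (≤ᵇ⇒≤ 2 8 tt)

    queryList< : ∀ {q} → q < n * n → ∀ x → nth (queryList q) x < W
    queryList< {q} q<nn = nth< 1≤W (≤-<-trans (≤-trans (s≤s z≤n) nn≤N) N<W ∷ₗ ≤-<-trans (m≤m+n (blockStart q) blockLength) end<W ∷ₗ
      end<W ∷ₗ ≤-<-trans (≤-trans (m%n<n q n) (m≤m*n n n)) nn<W ∷ₗ []ₗ)
      where
      end<W : blockEnd q < W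
      end<W = ≤-<-trans (begin
        rowsLength + q / n * blockLength + blockLength     ≡⟨ +-assoc rowsLength _ _ ⟩
        rowsLength + (q / n * blockLength + blockLength)   ≡⟨ cong (rowsLength +_) (+-comm (q / n * blockLength) blockLength) ⟩
        rowsLength + suc (q / n) * blockLength             ≤⟨ +-monoʳ-≤ rowsLength (*-monoˡ-≤ blockLength (m<n*o⇒m/o<n {q} {n} {n} q<nn)) ⟩
        textLength                                         ∎) N<W
        where open ≤-Reasoning

    -- The data structure is represented by its runs and by a predicate `Ready`. Since a query may
    -- modify registers and memory, each run has to re-establish `Ready` for the next one.
    module Queries (build query : Program) (Ready : State → Set) (buildTime queryTime : ℕ) (answer : ℕ → ℕ)
      (build-run : ∃[ s ] ∃[ t ] Run w₀ (listing size) build initial s t × t ≤ buildTime × Ready s)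
      (query-run : ∀ {q s} → q < n * n → Ready s →
        ∃[ s′ ] ∃[ t ] Run w₀ (queryList q) query s s′ t × t ≤ queryTime × Ready s′ × reg s′ 0 ≡ answer q) where

      -- Beyond its four words a query must read as zero. Compiled queries write only between `W`
      -- and `2 * W`, and the host writes answers below `W` and those four words, so the zeros
      -- persist from query to query.
      Zeros : (ℕ → ℕ) → Set
      Zeros μ = ∀ x → 4 ≤ x → x < W → μ (2 * W + x) ≡ 0

      Built : ℕ → ℕ → ℕ → Config → Set
      Built P q f c = ∃[ s ] ∃[ μ ] c ≡ config (vs W (3 * W) P q f) (reg s) μ × Ready s × Linked s μ × Zeros μ

      build-triple : ∀ {P q f μ} → Emitted size μ →
        Triple (config (vs W (3 * W) P q f) (λ _ → 0) μ) (compile build) (2 * buildTime) (Built P q f)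
      build-triple {P} {q} {f} {μ} e = let s , t , run , t≤ , ready = build-run in weaken ≤-refl
        (λ { (μ′ , refl , l , outside) → s , μ′ , refl , ready , l ,
             λ x _ x<W → trans (outside (2 * W + x) (inj₂ (≤-trans W+W≤2W (m≤m+n (2 * W) x))))
               (Emitted.below e (2 * W + x) (begin-strict
                  2 * W + x    <⟨ +-monoʳ-< (2 * W) x<W ⟩
                  2 * W + W    ≡⟨ +-comm (2 * W) W ⟩
                  3 * W        ∎)) })
        (simulation-triple (≤-trans W+W≤2W (m≤n+m (2 * W) W)) 4W≤U
          (record { inside = λ a a<W → Emitted.below e (W + a) (+-monoʳ-< W (<-≤-trans a<W (m≤m+n W (W + 0))))
                  ; reg< = λ _ → 1≤W ; mem< = λ _ → 1≤W })
          (λ a _ → trans (at (Emitted.listed e) a)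
            (sym (mod2^-small w₀ (listing< a))))
          run t≤)
        where
        open ≤-Reasoning
        4W≤U : 3 * W + W ≤ U
        4W≤U = ≤-trans (≤-reflexive (+-comm (3 * W) W)) (scaled≤U 4 (≤ᵇ⇒≤ 4 8 tt))

      Results : ℕ → (ℕ → ℕ) → Set
      Results q μ = ∀ x → x < q → μ x ≡ answer x

      record Answering (q : ℕ) (s : State) (μ : ℕ → ℕ) : Set where
        field
          ready   : Ready s
          linked  : Linked s μ
          zeros   : Zeros μ
          results : Results q μ

      open Answering

      QueryState : ℕ → ℕ → Config → Set
      QueryState P q c = ∃[ s ] ∃[ μ ] c ≡ config (vs W (2 * W) P q (fromBool (q <ᵇ n * n))) (reg s) μ × Answering q s μ

      module Step {q} (q<nn : q < n * n) where

        posed : (ℕ → ℕ) → ℕ → ℕ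
        posed μ = update (update (update (update μ (2 * W + 0) 1) (2 * W + 1) (blockStart q)) (2 * W + 2) (blockEnd q))
                    (2 * W + 3) (suc (q % n))

        posed-below : ∀ μ x → x < 2 * W → posed μ x ≡ μ x
        posed-below μ x x< = trans (update-other (≢ 3)) (trans (update-other (≢ 2)) (trans (update-other (≢ 1)) (update-other (≢ 0))))
          where
          ≢ : ∀ k → x ≢ 2 * W + k
          ≢ k = <⇒≢ (<-≤-trans x< (m≤m+n (2 * W) k))

        posed-at : ∀ μ x → posed μ (2 * W + x) ≡
          update (update (update (update (λ x → μ (2 * W + x)) 0 1) 1 (blockStart q)) 2 (blockEnd q)) 3 (suc (q % n)) x
        posed-at μ x =
          trans (update-shift μ₃ (2 * W) 3 _ x) (update-cong 3 x refl
          (trans (update-shift μ₂ (2 * W) 2 _ x) (update-cong 2 x refl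
          (trans (update-shift μ₁ (2 * W) 1 _ x) (update-cong 1 x refl
          (update-shift μ (2 * W) 0 _ x))))))
          where
          μ₁ μ₂ μ₃ : ℕ → ℕ
          μ₁ = update μ (2 * W + 0) 1
          μ₂ = update μ₁ (2 * W + 1) (blockStart q)
          μ₃ = update μ₂ (2 * W + 2) (blockEnd q)

        posed-input : ∀ μ → Zeros μ → ∀ x → x < W → posed μ (2 * W + x) ≡ nth (queryList q) x
        posed-input μ z x x<W = trans (posed-at μ x) (go x x<W)
          where
          go : ∀ x → x < W → update (update (update (update (λ x → μ (2 * W + x)) 0 1) 1 (blockStart q)) 2 (blockEnd q)) 3 (suc (q % n)) x ≡ nth (queryList q) x
          go 0 _ = refl
          go 1 _ = refl
          go 2 _ = refl
          go 3 _ = refl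
          go (suc (suc (suc (suc x)))) x<W = z (4 + x) (s≤s (s≤s (s≤s (s≤s z≤n)))) x<W

        results-suc : ∀ μ {v} → v ≡ answer q → Results q μ → Results (suc q) (update μ q v)
        results-suc μ v≡ old x x< with x ≟ q
        ... | yes refl = trans (update-same q) v≡
        ... | no  x≢q  = trans (update-other x≢q) (old x (≤∧≢⇒< (≤-pred x<) x≢q))

        q<W : q < W
        q<W = <-trans q<nn nn<W

        step-triple : ∀ {P c} → P ≤ U → QueryState P q c → Triple c (queryStep query) (queryStepTime queryTime) (QueryState P (suc q))
        step-triple {P} P≤ (s , μ , refl , answering) =
          let s′ , t , run , t≤ , ready′ , answer≡ = query-run q<nn (ready answering) in
          put-triple (addressExp ⊕ lit 0) (lit 1) sm suitable suitable then λ { refl →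
          put-triple (addressExp ⊕ lit 1) fromExp sm suitable suitable then λ { refl →
          put-triple (addressExp ⊕ lit 2) toExp sm suitable suitable then λ { refl →
          put-triple (addressExp ⊕ lit 3) (lit 1 ⊕ vq ⊚ vn) sm suitable suitable then λ { refl →
          simulation-triple W+W≤2W (≤-trans (≤-reflexive (+-comm (2 * W) W)) (scaled≤U 3 (≤ᵇ⇒≤ 3 8 tt)))
            (linked-cong (λ a a<W → posed-below μ (W + a) (+-monoʳ-< W (<-≤-trans a<W (m≤m+n W 0)))) (linked answering))
            (λ a a<W → trans (posed-input μ (zeros answering) a a<W)
              (sym (mod2^-small w₀ (queryList< q<nn a))))
            run t≤ then λ { (μ′ , refl , l , outside) →
          putAnswer-triple vq sm suitable then λ { refl →
          assign-triple 5F (lit 1 ⊕ vq) sm suitable then λ { refl →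
          weaken ≤-refl (λ { refl → s′ , update μ′ q (reg s′ 0) , refl , record
              { ready   = ready′
              ; linked  = linked-cong (λ a _ → update-other (≢q (m≤m+n W a))) l
              ; zeros   = λ x 4≤x x<W → trans (update-other (≢q (≤-trans (m≤m+n W (W + 0)) (m≤m+n (2 * W) x))))
                  (trans (outside (2 * W + x) (inj₂ (≤-trans W+W≤2W (m≤m+n (2 * W) x))))
                  (trans (posed-input μ (zeros answering) x x<W) (nth-beyond (queryList q) 4≤x)))
              ; results = results-suc μ′ answer≡ (λ x x< → trans (outside x (inj₁ (<-trans x< q<W)))
                  (trans (posed-below μ x (<-≤-trans (<-trans x< q<W) (m≤m+n W (W + 0)))) (results answering x x<))) } })
            (assign-triple 6F (vq ≺ vn ⊛ vn) sm′ suitable) } } } } } } }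
          where
          q≤U : ∀ {q} → q ≤ n * n → q ≤ U
          q≤U q≤ = ≤-trans q≤ (≤-trans nn≤N N≤U)
          sm  = vs-small W≤U 2W≤U P≤ (q≤U (<⇒≤ q<nn)) (bool≤U (q <ᵇ n * n))
          sm′ = vs-small W≤U 2W≤U P≤ (q≤U q<nn) (bool≤U (q <ᵇ n * n))
          ≢q : ∀ {x} → W ≤ x → x ≢ q
          ≢q W≤x x≡q = <⇒≱ q<W (≤-trans W≤x (≤-reflexive x≡q))

      multiply-triple : Triple (config (0 ∷ 0 ∷ 0 ∷ 0 ∷ 0 ∷ 0 ∷ 0 ∷ []) (λ _ → 0) (λ _ → 0))
        (multiplication κ wF build query)
        (multiplyTime κ wF (L * 60) (rowsSize * suc rowTime) (n * n * suc blockTime) buildTime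
          (n * n * suc (queryStepTime queryTime)))
        (λ c → ∀ x → x < n * n → Config.cells c x ≡ answer x)
      multiply-triple =
        prepare-triple then λ { (μ , P , f , refl , P≤ , f≤ , e) →
        assign-triple 3F (lit 3 ⊛ vW) (vs-small W≤U z≤n P≤ (≤-trans nn≤N N≤U) f≤) suitable then λ { refl →
        build-triple e then λ { (s , μ , refl , ready , linked , zeros) →
        assign-triple 3F (lit 2 ⊛ vW) (vs-small W≤U 3W≤U P≤ (≤-trans nn≤N N≤U) f≤) suitable then λ { refl →
        assign-triple 5F (lit 0) (vs-small W≤U 2W≤U P≤ (≤-trans nn≤N N≤U) f≤) suitable then λ { refl →
        assign-triple 6F (vq ≺ vn ⊛ vn) (vs-small W≤U 2W≤U P≤ z≤n f≤) suitable then λ { refl →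
        weaken ≤-refl (λ { (_ , _ , refl , answered) → results answered })
          (while-triple (QueryState P) 6F
            (λ { q<nn (_ , _ , refl , _) → fromBool≢0 (<⇒<ᵇ q<nn) })
            (λ { (_ , _ , refl , _) → fromBool≡0 (n≮n (n * n) ∘ <ᵇ⇒< (n * n) (n * n)) })
            (λ q<nn → Step.step-triple q<nn P≤)
            (s , μ , refl , record { ready = ready ; linked = linked ; zeros = zeros ; results = λ _ () })) } } } } } }
        where
        3W≤U : 3 * W ≤ U
        3W≤U = scaled≤U 3 (≤ᵇ⇒≤ 3 8 tt)

      multiply-run : ∃[ s ] ∃[ t ] Run w inp (multiplication κ wF build query) initial s t
        × t ≤ hostTime κ wF L rowsSize (n * n) buildTime queryTime
        × (∀ x → x < n * n → mem s x ≡ answer x)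
      multiply-run = R.final , R.time , R.run ,
        ≤-trans R.time≤ (multiplyTime≤hostTime κ wF L rowsSize (n * n) buildTime queryTime) , λ x x< → trans (Holds.cells-≡ R.holds x) (R.post x x<)
        where
        start : Holds initial (config (0 ∷ 0 ∷ 0 ∷ 0 ∷ 0 ∷ 0 ∷ 0 ∷ []) (λ _ → 0) (λ _ → 0))
        start = record { vars-≡ = λ i → sym (lookup-replicate i 0) ; sim-≡ = λ _ → refl ; cells-≡ = λ _ → refl }
        module R = Reaches (Triple.from multiply-triple start)

-- Time bounds

*-distrib-^ : ∀ c x y → (x * y) ^ c ≡ x ^ c * y ^ c
*-distrib-^ zero    x y = refl
*-distrib-^ (suc c) x y = begin
  x * y * (x * y) ^ c          ≡⟨ cong (x * y *_) (*-distrib-^ c x y) ⟩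
  x * y * (x ^ c * y ^ c)      ≡⟨ solve 4 (λ x y a b → x :* y :* (a :* b) := x :* a :* (y :* b)) refl x y (x ^ c) (y ^ c) ⟩
  x * x ^ c * (y * y ^ c)      ∎
  where
  open ≡-Reasoning
  open +-*-Solver using (solve; _:*_; _:=_)

-- The time formulas are sums of constants and of terms bounded by multiples of `X`. Replacing every
-- such term by its coefficient gives the coefficient of the whole sum.
module Linear {X : ℕ} (1≤X : 1 ≤ X) where

  infix  4 _⊑_
  infixr 5 _⊞_

  record _⊑_ (t a : ℕ) : Set where
    constructor bound
    field at-most : t ≤ a * X

  open _⊑_ public

  _⊞_ : ∀ {s t a b} → s ⊑ a → t ⊑ b → s + t ⊑ a + b
  _⊞_ {a = a} {b} (bound s≤) (bound t≤) =
    bound (≤-trans (+-mono-≤ s≤ t≤) (≤-reflexive (sym (*-distribʳ-+ X a b))))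

  constant : ∀ k → k ⊑ k
  constant k = bound (m≤m*n k X {{>-nonZero 1≤X}})

  double : ∀ {t b} → t ⊑ b → 2 * t ⊑ 2 * b
  double {t} {b} (bound t≤) = bound (≤-trans (*-monoʳ-≤ 2 t≤) (≤-reflexive (sym (*-assoc 2 b X))))

  prepareTime-linear : ∀ κ wF {p p′ q q′ s s′} → p ⊑ p′ → q ⊑ q′ → s ⊑ s′ →
    prepareTime κ wF p q s ⊑ prepareTime κ wF p′ q′ s′
  prepareTime-linear κ wF p≤ q≤ s≤ =
    constant (cost (read (lit 0)) + 2) ⊞ constant (cost (lit κ ⊛ vn) + 2) ⊞ constant (cost (lit 1) + 2) ⊞
    constant (cost (vP ≺ lit 1 ⊕ textLengthExp) + 2) ⊞ (constant 1 ⊞ p≤) ⊞ constant (cost (lit 1) + 2) ⊞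
    constant (wF * 7) ⊞ constant (cost (lit 3 ⊛ vW) + (cost textLengthExp + 1)) ⊞
    constant (cost (lit 3 ⊛ vW ⊕ lit 1) + (cost textLengthExp + 1)) ⊞
    constant (cost (lit 3 ⊛ vW ⊕ lit 2) + (cost sizeExp + 1)) ⊞
    constant (cost (lit 3 ⊛ vW ⊕ lit 3) + 2) ⊞
    (constant 3 ⊞ constant (cost (vq ≺ rowsSizeExp) + 2) ⊞ constant 1 ⊞ q≤) ⊞
    (constant 3 ⊞ constant (cost (vq ≺ vn ⊛ vn) + 2) ⊞ constant 1 ⊞ s≤)

  multiplyTime-linear : ∀ κ wF {p p′ q q′ s s′ b b′ t t′} →
    p ⊑ p′ → q ⊑ q′ → s ⊑ s′ → b ⊑ b′ → t ⊑ t′ →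
    multiplyTime κ wF p q s b t ⊑ multiplyTime κ wF p′ q′ s′ b′ t′
  multiplyTime-linear κ wF {p} {p′} {q} {q′} {s} {s′} p≤ q≤ s≤ b≤ t≤ =
    preparation ⊞ constant (cost (lit 3 ⊛ vW) + 2) ⊞ double b≤ ⊞
    constant (cost (lit 2 ⊛ vW) + 2) ⊞ constant 3 ⊞ constant (cost (vq ≺ vn ⊛ vn) + 2) ⊞ constant 1 ⊞ t≤
    where
    preparation : prepareTime κ wF p q s ⊑ prepareTime κ wF p′ q′ s′
    preparation = prepareTime-linear κ wF {p} {p′} {q} {q′} {s} {s′} p≤ q≤ s≤

  queryStepTime-linear : ∀ {t t′} → t ⊑ t′ → suc (queryStepTime t) ⊑ suc (queryStepTime t′)
  queryStepTime-linear t≤ =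
    constant 1 ⊞
    constant (cost (addressExp ⊕ lit 0) + (cost (lit 1) + 1)) ⊞
    constant (cost (addressExp ⊕ lit 1) + (cost fromExp + 1)) ⊞
    constant (cost (addressExp ⊕ lit 2) + (cost toExp + 1)) ⊞
    constant (cost (addressExp ⊕ lit 3) + (cost (lit 1 ⊕ vq ⊚ vn) + 1)) ⊞
    double t≤ ⊞ constant (cost vq + 1) ⊞ constant (cost (lit 1 ⊕ vq) + 2) ⊞ constant (cost (vq ≺ vn ⊛ vn) + 2)

-- Accounts for `n * n` rounds of length `u`, with `d` a power of the logarithm. The factor 1 is the
-- coefficient of the number of blocks in `constantFactor`.
scale-square : ∀ n {u v d} → u ≤ v * d → n * n * u ≤ 1 * v * (n ^ 2 * d)
scale-square n {u} {v} {d} u≤ = begin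
  n * n * u                      ≤⟨ *-monoʳ-≤ (n * n) u≤ ⟩
  n * n * (v * d)                ≡⟨ solve 3 (λ n v d → n :* n :* (v :* d) := con 1 :* v :* (n :* (n :* con 1) :* d)) refl n v d ⟩
  1 * v * (n ^ 2 * d)            ∎
  where
  open ≤-Reasoning
  open +-*-Solver using (solve; _:*_; _:=_; con)

module TimeBound (κ wF y ρ buildC buildc queryC queryc : ℕ) where

  -- One logarithm comes from the loop that doubles up to the text length; adding the exponents of
  -- construction and query dominates both. The constant is the time formula itself, evaluated at
  -- the coefficients of its arguments.
  exponent constantFactor : ℕ
  exponent = 1 + buildc + queryc
  constantFactor = hostTime κ wF y ρ 1 (buildC * ρ * y ^ buildc) (queryC * y ^ queryc)

  module _ (n l L rows size : ℕ) (1≤n : 1 ≤ n) (1≤l : 1 ≤ l) (L≤ : L ≤ y * l)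
    (rows≤size : rows ≤ size) (size≤ : size ≤ ρ * (n * n)) where

    private
      X : ℕ
      X = n ^ 2 * l ^ exponent

      instance
        l≢0 : NonZero l
        l≢0 = >-nonZero 1≤l
        n≢0 : NonZero n
        n≢0 = >-nonZero 1≤n

      l^≤X : ∀ {c} → c ≤ exponent → l ^ c ≤ X
      l^≤X c≤ = ≤-trans (^-monoʳ-≤ l c≤) (m≤n*m _ (n ^ 2) {{m^n≢0 n 2}})

      nn≤X : n * n ≤ X
      nn≤X = ≤-trans (≤-reflexive (cong (n *_) (sym (*-identityʳ n)))) (m≤m*n (n ^ 2) _ {{m^n≢0 l exponent}})

      L^≤ : ∀ c → L ^ c ≤ y ^ c * l ^ c
      L^≤ c = ≤-trans (^-monoˡ-≤ c L≤) (≤-reflexive (*-distrib-^ c y l))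

    private
      rowT blockT : ℕ
      rowT   = suc rowTime
      blockT = suc blockTime

    open Linear {X} (≤-trans (m^n>0 l 0) (l^≤X {0} z≤n))
    open ≤-Reasoning
    open +-*-Solver using (solve; _:+_; _:*_; _:=_; con)

    private
      power≤ : L * 60 ⊑ y * 60
      power≤ = bound (begin
        L * 60             ≤⟨ *-monoˡ-≤ 60 L≤ ⟩
        y * l * 60         ≡⟨ solve 3 (λ y l c → y :* l :* c := y :* c :* l) refl y l 60 ⟩
        y * 60 * l         ≤⟨ *-monoʳ-≤ (y * 60) (≤-trans (≤-reflexive (sym (*-identityʳ l))) (l^≤X {1} (s≤s z≤n))) ⟩
        y * 60 * X         ∎)

      rows≤ : rows * rowT ⊑ ρ * rowT
      rows≤ = bound (begin
        rows * rowT            ≤⟨ *-monoˡ-≤ rowT (≤-trans rows≤size size≤) ⟩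
        ρ * (n * n) * rowT     ≡⟨ solve 3 (λ a b c → a :* b :* c := a :* c :* b) refl ρ (n * n) rowT ⟩
        ρ * rowT * (n * n)     ≤⟨ *-monoʳ-≤ (ρ * rowT) nn≤X ⟩
        ρ * rowT * X           ∎)

      blocks≤ : n * n * blockT ⊑ 1 * blockT
      blocks≤ = bound (scale-square n {blockT} {blockT} {l ^ exponent} (m≤m*n blockT _ {{m^n≢0 l exponent}}))

      build≤ : buildC * size * L ^ buildc ⊑ buildC * ρ * y ^ buildc
      build≤ = bound (begin
        buildC * size * L ^ buildc
          ≤⟨ *-mono-≤ (*-monoʳ-≤ buildC size≤) (≤-trans (L^≤ buildc) (*-monoʳ-≤ (y ^ buildc)
               (^-monoʳ-≤ l (≤-trans (m≤m+n buildc queryc) (n≤1+n _))))) ⟩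
        buildC * (ρ * (n * n)) * (y ^ buildc * l ^ exponent)
          ≡⟨ solve 5 (λ a b n c d → a :* (b :* (n :* n)) :* (c :* d) := a :* b :* c :* (n :* (n :* con 1) :* d)) refl
               buildC ρ n (y ^ buildc) (l ^ exponent) ⟩
        buildC * ρ * y ^ buildc * X ∎)

      query≤ : queryC * L ^ queryc ≤ queryC * y ^ queryc * l ^ exponent
      query≤ = begin
        queryC * L ^ queryc
          ≤⟨ *-monoʳ-≤ queryC (≤-trans (L^≤ queryc) (*-monoʳ-≤ (y ^ queryc)
               (^-monoʳ-≤ l (≤-trans (m≤n+m queryc buildc) (n≤1+n _))))) ⟩
        queryC * (y ^ queryc * l ^ exponent)
          ≡⟨ *-assoc queryC (y ^ queryc) (l ^ exponent) ⟨
        queryC * y ^ queryc * l ^ exponent ∎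

      -- A single query is measured against the power of the logarithm alone; `scale-square` then
      -- supplies the factor `n ^ 2`.
      module Step = Linear (m^n>0 l exponent)

      step≤ : suc (queryStepTime (queryC * L ^ queryc)) Step.⊑ suc (queryStepTime (queryC * y ^ queryc))
      step≤ = Step.queryStepTime-linear {queryC * L ^ queryc} {queryC * y ^ queryc} (Step.bound query≤)

      queries≤ : n * n * suc (queryStepTime (queryC * L ^ queryc)) ⊑ 1 * suc (queryStepTime (queryC * y ^ queryc))
      queries≤ = bound (scale-square n {suc (queryStepTime (queryC * L ^ queryc))}
        {suc (queryStepTime (queryC * y ^ queryc))} {l ^ exponent}
        (Step.at-most {suc (queryStepTime (queryC * L ^ queryc))} {suc (queryStepTime (queryC * y ^ queryc))} step≤))

    opaque
      unfolding hostTime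

      hostTime≤ : hostTime κ wF L rows (n * n) (buildC * size * L ^ buildc) (queryC * L ^ queryc)
                  ≤ constantFactor * n ^ 2 * l ^ exponent
      hostTime≤ = ≤-trans
        (at-most (multiplyTime-linear κ wF {L * 60} {y * 60} {rows * rowT} {ρ * rowT} {n * n * blockT} {1 * blockT}
          {buildC * size * L ^ buildc} {buildC * ρ * y ^ buildc}
          {n * n * suc (queryStepTime (queryC * L ^ queryc))} {1 * suc (queryStepTime (queryC * y ^ queryc))}
          power≤ rows≤ blocks≤ build≤ queries≤))
        (≤-reflexive (sym (*-assoc constantFactor (n ^ 2) (l ^ exponent))))

-- With `κ < 2 ^ κ` and `n < 2 ^ l` the length is at most `2 ^ (κ + 3 * l + 2)`, and `1 ≤ l` puts
-- that exponent below `(κ + 6) * l`. Hence the logarithm of the text length exceeds that of `n` by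
-- a constant factor at most.
length<2^ : ∀ κ n {l} → 1 ≤ l → n < 2 ^ l → κ * n * ((1 + n) * (2 + n)) + n * (n * (2 + n)) < 2 ^ ((κ + 6) * l)
length<2^ κ n {l} 1≤l n<2^l = begin-strict
  κ * n * ((1 + n) * (2 + n)) + n * (n * (2 + n))                              ≤⟨ +-mono-≤
    (*-mono-≤ {κ * n} {2 ^ (κ + l)} r≤ (*-mono-≤ {1 + n} {2 ^ l} {2 + n} {2 ^ (1 + l)} n<2^l 2+n≤))
    (*-mono-≤ {n} {2 ^ (κ + l)} {n * (2 + n)} n≤ (*-mono-≤ {n} {2 ^ l} {2 + n} {2 ^ (1 + l)} (<⇒≤ n<2^l) 2+n≤)) ⟩
  Z + Z                                              ≡⟨ cong (Z +_) (+-identityʳ Z) ⟨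
  2 * Z                                              ≡⟨ cong (λ z → 2 * (2 ^ (κ + l) * z)) (^-distribˡ-+-* 2 l (1 + l)) ⟨
  2 * (2 ^ (κ + l) * 2 ^ (l + (1 + l)))              ≡⟨ cong (2 *_) (^-distribˡ-+-* 2 (κ + l) (l + (1 + l))) ⟨
  2 ^ suc (κ + l + (l + (1 + l)))                    <⟨ ^-monoʳ-< 2 (s≤s (s≤s z≤n)) exponents ⟩
  2 ^ ((κ + 6) * l)                                        ∎
  where
  open ≤-Reasoning
  Z = 2 ^ (κ + l) * (2 ^ l * 2 ^ (1 + l))
  2+n≤ : 2 + n ≤ 2 ^ (1 + l)
  2+n≤ = begin
    2 + n             ≤⟨ +-mono-≤ {1} {2 ^ l} {1 + n} (m^n>0 2 l) n<2^l ⟩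
    2 ^ l + 2 ^ l     ≡⟨ cong (2 ^ l +_) (+-identityʳ _) ⟨
    2 ^ (1 + l)       ∎
  r≤ : κ * n ≤ 2 ^ (κ + l)
  r≤ = ≤-trans (*-mono-≤ (<⇒≤ (n<2^n κ)) (<⇒≤ n<2^l)) (≤-reflexive (sym (^-distribˡ-+-* 2 κ l)))
  n≤ : n ≤ 2 ^ (κ + l)
  n≤ = ≤-trans (<⇒≤ n<2^l) (^-monoʳ-≤ 2 (m≤n+m l κ))
  exponents : suc (κ + l + (l + (1 + l))) < (κ + 6) * l
  exponents = begin-strict
    suc (κ + l + (l + (1 + l)))    <⟨ n<1+n _ ⟩
    suc (suc (κ + l + (l + (1 + l)))) ≡⟨ solve 2 (λ k l → con 2 :+ (k :+ l :+ (l :+ (con 1 :+ l))) := k :+ con 3 :* con 1 :+ con 3 :* l) refl κ l ⟩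
    κ + 3 * 1 + 3 * l              ≤⟨ +-monoˡ-≤ (3 * l) (+-mono-≤ (m≤m*n κ l {{>-nonZero 1≤l}}) (*-monoʳ-≤ 3 1≤l)) ⟩
    κ * l + 3 * l + 3 * l          ≡⟨ solve 2 (λ k l → k :* l :+ con 3 :* l :+ con 3 :* l := (k :+ con 6) :* l) refl κ l ⟩
    (κ + 6) * l                    ∎
    where open +-*-Solver using (solve; _:+_; _:*_; _:=_; con)

-- The factor `4 * κ + 1` arises from `1 + n ≤ n + n`.
count≤ : ∀ κ n → 1 ≤ n → 2 * (κ * n) * (1 + n) + n * n ≤ (4 * κ + 1) * (n * n)
count≤ κ n 1≤n = begin
  2 * (κ * n) * (1 + n) + n * n          ≤⟨ +-monoˡ-≤ (n * n) (*-monoʳ-≤ (2 * (κ * n)) (+-monoˡ-≤ n 1≤n)) ⟩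
  2 * (κ * n) * (n + n) + n * n          ≡⟨ solve 2 (λ k n → con 2 :* (k :* n) :* (n :+ n) :+ n :* n := (con 4 :* k :+ con 1) :* (n :* n)) refl κ n ⟩
  (4 * κ + 1) * (n * n)                  ∎
  where
  open ≤-Reasoning
  open +-*-Solver using (solve; _:+_; _:*_; _:=_; con)

-- The 3 accounts for the factor 8 between `U` and the modulus, and the successor in the word factor
-- makes the inequality strict.
word-fits : ∀ wF y l Ω {L} → 1 ≤ l → L ≤ y * l → (2 ^ (wF * L + 3)) ^ Ω < 2 ^ (suc ((wF * y + 3) * Ω) * l)
word-fits wF y l Ω {L} 1≤l L≤ = begin-strict
  (2 ^ (wF * L + 3)) ^ Ω                   ≡⟨ ^-*-assoc 2 (wF * L + 3) Ω ⟩
  2 ^ ((wF * L + 3) * Ω)                   <⟨ ^-monoʳ-< 2 (s≤s (s≤s z≤n)) exponents ⟩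
  2 ^ (suc ((wF * y + 3) * Ω) * l)         ∎
  where
  open ≤-Reasoning
  exponents : (wF * L + 3) * Ω < suc ((wF * y + 3) * Ω) * l
  exponents = begin-strict
    (wF * L + 3) * Ω                       ≤⟨ *-monoˡ-≤ Ω (+-mono-≤ (*-monoʳ-≤ wF L≤) (*-monoʳ-≤ 3 1≤l)) ⟩
    (wF * (y * l) + 3 * l) * Ω             ≡⟨ solve 4 (λ f y l o → (f :* (y :* l) :+ con 3 :* l) :* o := (f :* y :+ con 3) :* o :* l) refl wF y l Ω ⟩
    (wF * y + 3) * Ω * l                   <⟨ m<n+m _ 1≤l ⟩
    suc ((wF * y + 3) * Ω) * l             ∎
    where open +-*-Solver using (solve; _:+_; _:*_; _:=_; con)

truth-value : ∀ {A : Set} {v b} → (A → b ≡ true) → (b ≡ true → A) → IsTruthValue A v → v ≡ fromBool b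
truth-value {b = true}  _    _    (inj₁ (_ , v≡)) = v≡
truth-value {b = false} to   _    (inj₁ (a , _))  = contradiction (to a) λ ()
truth-value {b = true}  _    from (inj₂ (¬a , _)) = contradiction (from refl) ¬a
truth-value {b = false} _    _    (inj₂ (_ , v≡)) = v≡

-- Answering the queries

module Multiply (D : PositionRestrictedMatching) (n′ : ℕ) (A B : BoolMatrix (suc n′)) where

  open PositionRestrictedMatching D

  κ : ℕ
  κ = κ-num ^ 3

  instance
    κ≢0 : NonZero κ
    κ≢0 = m^n≢0 κ-num 3

  inp : List ℕ
  inp = productInput A B

  open Setup κ n′ inp (right-end A B) using (n; r; listing; queryList; nn≤N; module Enc; module Txt)
  open Enc using (size; rowsSize; rowsLength; blockLength; textLength; parent; char)
  open Txt using (T; R; textLength≢0)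

  L w₀ : ℕ
  L = lg textLength
  w₀ = wordLength textLength

  -- The number of rows scales with `κ`, so `κ ≤ N`. Thus `κ * N` is at most the square of `N`,
  -- which the cube of `κ-den * N` dominates.
  admissible : AdmissibleAlphabet textLength textLength
  admissible = cubes , <-≤-trans (n<2^lg textLength) (^-monoʳ-≤ 2 (m≤n*m L wordFactor))
    where
    N X : ℕ
    N = textLength
    X = κ-den * N
    N≤X : N ≤ X
    N≤X = m≤n*m N κ-den
    κ≤N : κ ≤ N
    κ≤N = ≤-trans (m≤m*n κ n) (≤-trans (m≤m*n r ((1 + n) * (2 + n))) (m≤m+n rowsLength (n * blockLength)))
    cubes : κ * N ≤ X ^ 3
    cubes = *-mono-≤ (≤-trans κ≤N N≤X) (≤-trans N≤X (m≤m*n X (X * 1)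
      {{>-nonZero (≤-trans (>-nonZero⁻¹ N) (≤-trans N≤X (≤-reflexive (sym (*-identityʳ X)))))}}))

  listing≡buildInput : listing size ≡ buildInput R
  listing≡buildInput = cong (λ l → textLength ∷ textLength ∷ size ∷ l) (sym Txt.pairWords-R)

  product-true : ∀ i j → (A ⊗ B) i j ≡ true → Txt.Block.Hit (toℕ i) (toℕ<n i) (toℕ j)
  product-true i j p with or-tabulate⁻ (λ k → A i k ∧ B k j) (trans (sym (⊗-tabulate A B i j)) p)
  ... | k , both = toℕ k , toℕ<n k ,
      (λ ≡0 → true≢0 (A i k) (proj₁ (∧-true (A i k) (B k j) both)) (trans (sym (left-entry A B i k)) ≡0)) ,
      (λ ≡0 → true≢0 (B k j) (proj₂ (∧-true (A i k) (B k j) both)) (trans (sym (right-entry A B k j)) ≡0))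
    where
    ∧-true : ∀ x y → x ∧ y ≡ true → x ≡ true × y ≡ true
    ∧-true true true _ = refl , refl
    true≢0 : ∀ b → b ≡ true → fromBool b ≢ 0
    true≢0 true _ ()

  true-product : ∀ i j → Txt.Block.Hit (toℕ i) (toℕ<n i) (toℕ j) → (A ⊗ B) i j ≡ true
  true-product i j (k , k<n , a≢0 , b≢0) = trans (⊗-tabulate A B i j)
    (or-tabulate⁺ (λ k → A i k ∧ B k j) k′ (∧-nonzero (A i k′) (B k′ j)
      (λ ≡0 → a≢0 (trans (cong (λ k → nth inp (1 + (toℕ i * n + k))) (sym k′≡k)) (trans (left-entry A B i k′) ≡0)))
      (λ ≡0 → b≢0 (trans (cong (λ k → nth inp (1 + n * n + (k * n + toℕ j))) (sym k′≡k)) (trans (right-entry A B k′ j) ≡0)))))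
    where
    k′ : Fin n
    k′ = fromℕ< k<n
    k′≡k : toℕ k′ ≡ k
    k′≡k = toℕ-fromℕ< k<n
    ∧-nonzero : ∀ x y → fromBool x ≢ 0 → fromBool y ≢ 0 → x ∧ y ≡ true
    ∧-nonzero true  true  _ _ = refl
    ∧-nonzero false _     x _ = contradiction refl x
    ∧-nonzero true  false _ y = contradiction refl y

  pattern₁ : ℕ → Vec (Fin textLength) 1
  pattern₁ j = (j mod textLength) ∷ []

  -- The row index is reduced modulo `n` to make the function total; for `q < n * n` this changes
  -- nothing.
  expected : ℕ → ℕ
  expected q = fromBool ((A ⊗ B) (fromℕ< (m%n<n (q / n) n)) (fromℕ< (m%n<n q n)))

  l y hostFactor : ℕ
  l = lg n
  y = κ + 6
  hostFactor = suc ((wordFactor * y + 3) * (60 + κ))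

  private
    w : ℕ
    w = hostFactor * l

  1≤l : 1 ≤ l
  1≤l = s≤s z≤n

  L≤ : L ≤ y * l
  L≤ = <2^⇒lg≤ {{textLength≢0}} (length<2^ κ n 1≤l (n<2^lg n))

  Ready′ : State → Set
  Ready′ = Ready build query w₀ R

  buildTime queryTime : ℕ
  buildTime = build-C * size * L ^ build-c
  queryTime = query-C * 1 ^ query-a * L ^ query-c

  build-run : ∃[ s ] ∃[ t ] Run w₀ (listing size) build initial s t × t ≤ buildTime × Ready′ s
  build-run = let s , t , run , t≤ = build-correct textLength≢0 admissible T R in
    s , t , subst (λ I → Run w₀ I build initial s t) (sym listing≡buildInput) run , t≤ , built run

  module Query {q} (q<nn : q < n * n) where

    row< : q / n < n
    row< = m<n*o⇒m/o<n {q} {n} {n} q<nn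

    column< : q % n < n
    column< = m%n<n q n

    rowF columnF : Fin n
    rowF = fromℕ< (m%n<n (q / n) n)
    columnF = fromℕ< column<

    row≡ : toℕ rowF ≡ q / n
    row≡ = trans (toℕ-fromℕ< (m%n<n (q / n) n)) (m<n⇒m%n≡m row<)

    column≡ : toℕ columnF ≡ q % n
    column≡ = toℕ-fromℕ< column<

    module Block = Txt.Block (q / n) row<

    queryList≡ : queryList q ≡ queryInput (pattern₁ (q % n)) Block.from Block.to
    queryList≡ = cong (λ x → 1 ∷ Block.from ∷ Block.to ∷ suc x ∷ [])
      (sym (mod-small (<-≤-trans column< (≤-trans (m≤m*n n n) nn≤N))))

    is-query : IsQuery textLength 1 Block.from Block.to
    is-query = nonZero , ≤-trans (≤-reflexive (+-comm Block.from 1)) (s≤s (≤-trans (m≤m+n Block.from blockLength) Block.to≤)) ,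
      ≤-trans (≤-reflexive (+-comm Block.to 1)) (s≤s Block.to≤)

    -- `Hit` receives the bound on `i` only as a parameter of its module, so one proof of the bound
    -- may replace another.
    transport : ∀ {i i′ j j′} (i<n : i < n) (i′<n : i′ < n) → i ≡ i′ → j ≡ j′ →
                Txt.Block.Hit i i<n j → Txt.Block.Hit i′ i′<n j′
    transport _ _ refl refl hit = hit

    answer≡ : ∀ {v} → IsTruthValue (OccursIn T (pattern₁ (q % n)) Block.from Block.to) v → v ≡ expected q
    answer≡ = truth-value
      (λ occurs → true-product rowF columnF
        (transport row< (toℕ<n rowF) (sym row≡) (sym column≡) (Block.occurs⇒hit column< occurs)))
      (λ p → Block.hit⇒occurs column<
        (transport (toℕ<n rowF) row< row≡ column≡ (product-true rowF columnF p)))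

    query-run : ∀ {s} → Ready′ s →
      ∃[ s′ ] ∃[ t ] Run w₀ (queryList q) query s s′ t × t ≤ queryTime × Ready′ s′ × reg s′ 0 ≡ expected q
    query-run {s} ready =
      let s′ , t , run , t≤ , truth = query-correct textLength≢0 admissible T R ready (pattern₁ (q % n)) Block.from Block.to is-query
      in s′ , t , subst (λ I → Run w₀ I query s s′ t) (sym queryList≡) run , t≤ , queried is-query ready run , answer≡ truth

  stored : ∀ i j → expected (toℕ i * n + toℕ j) ≡ fromBool ((A ⊗ B) i j)
  stored i j = cong₂ (λ i j → fromBool ((A ⊗ B) i j))
    (toℕ-injective (trans (toℕ-fromℕ< (m%n<n ((toℕ i * n + toℕ j) / n) n))
      (trans (cong (_% n) (/-quotient (toℕ i) (toℕ<n j))) (m<n⇒m%n≡m (toℕ<n i)))))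
    (toℕ-injective (trans (toℕ-fromℕ< (m%n<n (toℕ i * n + toℕ j) n)) (%-remainder (toℕ i) (toℕ<n j))))

  Answered : State → Set
  Answered s = ∀ x → x < n * n → mem s x ≡ expected x

  stores : ∀ s → Answered s → Stores s (A ⊗ B)
  stores s answered i j = trans (answered (toℕ i * n + toℕ j) (entry< i j)) (stored i j)

  open TimeBound κ wordFactor y (4 * κ + 1) build-C build-c (query-C * 1 ^ query-a) query-c
    using (exponent; constantFactor; hostTime≤)

  Outcome : (State → Set) → ℕ → Set
  Outcome Q bound = ∃[ s ] ∃[ t ] Run w inp (multiplication κ wordFactor build query) initial s t × t ≤ bound × Q s

  weaken-outcome : ∀ {Q R : State → Set} {t u} → (∀ s → Q s → R s) → t ≤ u → Outcome Q t → Outcome R u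
  weaken-outcome Q⇒R t≤u (s , t , run , t≤ , post) = s , t , run , ≤-trans t≤ t≤u , Q⇒R s post

  answered-run : Outcome Answered (hostTime κ wordFactor L rowsSize (n * n) buildTime queryTime)
  answered-run = Setup.Prepare.Queries.multiply-run κ n′ inp (right-end A B) wordFactor L w
    <lg⇒2^≤ (n<2^lg textLength) (s≤s z≤n) refl (productInput≤ A B (s≤s z≤n))
    (word-fits wordFactor y l (60 + κ) 1≤l L≤)
    build query Ready′ buildTime queryTime expected build-run (λ q<nn → Query.query-run q<nn)

  product-run : Outcome (λ s → Stores s (A ⊗ B)) (constantFactor * n ^ 2 * l ^ exponent)
  product-run = weaken-outcome stores
    (hostTime≤ n l L rowsSize size (s≤s z≤n) 1≤l L≤ (m≤m+n rowsSize (n * n)) (count≤ κ n (s≤s z≤n)))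
    answered-run

corollary1p12 : PositionRestrictedMatching →
    ∃[ multiply ] ∃[ wordFactor ] ∃[ C ] ∃[ c ]
    NonZero wordFactor ×
    ((n : ℕ) → NonZero n → (A B : BoolMatrix n) →
    ∃[ s ] ∃[ t ]
    Run (wordFactor * lg n) (productInput A B) multiply initial s t
    × t ≤ C * n ^ 2 * lg n ^ c
    × Stores s (A ⊗ B))
corollary1p12 D =
  -- The witnesses are chosen before `n` and the matrices; they are the program and constants of
  -- `Multiply`, rewritten in terms of the data structure alone.
  multiplication κ wordFactor build query ,
  suc ((wordFactor * (κ + 6) + 3) * (60 + κ)) ,
  constantFactor , exponent , nonZero ,
  λ { (suc n′) _ A B → Multiply.product-run D n′ A B }
  where
  open PositionRestrictedMatching D
  κ : ℕ
  κ = κ-num ^ 3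
  open TimeBound κ wordFactor (κ + 6) (4 * κ + 1) build-C build-c (query-C * 1 ^ query-a) query-c
    using (exponent; constantFactor)
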